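{- For all integers $0\leq k\leq n$, \[ S_2[n,k] = (-1)^{n-k} \sum_{j=0}^{n-k} (-1)^j \binom{n-1+j}{n-k+j} \binom{2n-k}{n-k-j} S_1[n-k+j,j]. \]
   Context: Let $q$ be an indeterminate. For $n\geq 0$ let $\mathfrak{S}_n$ be the set of permutations of $\{1,\dots,n\}$. For $\sigma\in\mathfrak{S}_n$, a right-to-left maximum is an index $i$ such that $\sigma(i)>\sigma(j)$ for all $j$ with $i<j\leq n$; let $\mathrm{rlm}(\sigma)$ be their number. An inversion of $\sigma$ is a pair $(i,j)$ with $1\leq i<j\leq n$ and $\sigma(i)>\sigma(j)$; it is special if there exists $k'$ with $j<k'\leq n$ and $\sigma(i)<\sigma(k')$. Let $\mathrm{inv}'(\sigma)$ be the number of special inversions. For $0\leq k\leq n$, define $S_1[n,k]=\sum_{\sigma} q^{\mathrm{inv}'(\sigma)}$, summed over $\sigma\in\mathfrak{S}_n$ with $\mathrm{rlm}(\sigma)=k$. For a set partition $\pi$ of $\{1,\dots,n\}$, draw an arc $(b_t,b_{t+1})$ for each pair of consecutive elements $b_t<b_{t+1}$ of each block $\{b_1<\dots<b_m\}$. A crossing is a pair of arcs $(a,c),(b,d)$ with $a<b<c<d$; let $\mathrm{cro}(\pi)$ be the number of crossings. For $0\leq k\leq n$, define $S_2[n,k]=\sum_\pi q^{\mathrm{cro}(\pi)}$, summed over set partitions $\pi$ of $\{1,\dots,n\}$ into exactly $k$ blocks (so $S_2[0,0]=1$). -}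

module Defs where

open import Data.Bool using (Bool; true; false; _∧_; _∨_; not; if_then_else_)
open import Data.Nat using (ℕ; zero; suc; _+_; _*_; _∸_; _≡ᵇ_; _<ᵇ_)
open import Data.Nat.Combinatorics using (_C_)
open import Data.List using (List; []; _∷_; length; map; concatMap; upTo; filterᵇ; foldr)
open import Data.Bool.ListAction using (all; any)
open import Data.Integer as ℤ using (ℤ; +_; -[1+_])

-- Indices/positions are 0-based: position i ∈ {0,…,n-1} stands for i+1.
-- A "word" of length n over alphabet {0,…,m-1} is a list of naturals.

words : ℕ → ℕ → List (List ℕ)
words zero    m = [] ∷ []
words (suc n) m = concatMap (λ w → map (λ x → x ∷ w) (upTo m)) (words n m)

-- i-th entry (0-based) of a word (default 0, never used out of range)
at : List ℕ → ℕ → ℕ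
at []       i       = 0
at (x ∷ w)  zero    = x
at (x ∷ w)  (suc i) = at w i

all< : ℕ → (ℕ → Bool) → Bool
all< n p = all p (upTo n)

any< : ℕ → (ℕ → Bool) → Bool
any< n p = any p (upTo n)

count< : ℕ → (ℕ → Bool) → ℕ
count< n p = length (filterᵇ p (upTo n))

_≠ᵇ_ : ℕ → ℕ → Bool
a ≠ᵇ b = not (a ≡ᵇ b)

-- Permutations of {1,…,n}: a word σ of length n with letters in
-- {0,…,n-1} (value v stands for v+1) that is injective.

_⇒ᵇ_ : Bool → Bool → Bool
a ⇒ᵇ b = not a ∨ b

isPerm : ℕ → List ℕ → Bool
isPerm n σ = all< n (λ i → all< n (λ j → (i <ᵇ j) ⇒ᵇ (at σ i ≠ᵇ at σ j)))

rlm : ℕ → List ℕ → ℕ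
rlm n σ = count< n (λ i → all< n (λ j → (i <ᵇ j) ⇒ᵇ (at σ j <ᵇ at σ i)))

isSpecialInv : ℕ → List ℕ → ℕ → ℕ → Bool
isSpecialInv n σ i j =
  (i <ᵇ j) ∧ (at σ j <ᵇ at σ i) ∧ any< n (λ k′ → (j <ᵇ k′) ∧ (at σ i <ᵇ at σ k′))

inv′ : ℕ → List ℕ → ℕ
inv′ n σ = foldr _+_ 0 (map (λ i → count< n (isSpecialInv n σ i)) (upTo n))

S₁coeff : ℕ → ℕ → ℕ → ℕ
S₁coeff n k d = length (filterᵇ
  (λ σ → isPerm n σ ∧ (rlm n σ ≡ᵇ k) ∧ (inv′ n σ ≡ᵇ d)) (words n n))

-- Set partitions of {1,…,n} into exactly k blocks, each encoded by its
-- unique canonical block labelling f : {0..n-1} → {0..k-1}: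
--  * surjective (every label c < k is used, so exactly k nonempty blocks),
--  * blocks are labelled in order of their minimal elements: every label
--    smaller than f(i) already occurs at some position before i.
-- (Each set partition into k blocks has exactly one such labelling.)

isSurj : ℕ → ℕ → List ℕ → Bool
isSurj n k f = all< k (λ c → any< n (λ i → at f i ≡ᵇ c))

isCanonical : ℕ → List ℕ → Bool
isCanonical n f = all< n (λ i → all< (at f i) (λ c → any< i (λ j → at f j ≡ᵇ c)))

isArc : ℕ → List ℕ → ℕ → ℕ → Bool
isArc n f a c = (a <ᵇ c) ∧ (at f a ≡ᵇ at f c)
  ∧ all< c (λ b → (a <ᵇ b) ⇒ᵇ (at f b ≠ᵇ at f a))

cro : ℕ → List ℕ → ℕ
cro n f = foldr _+_ 0 (map (λ a → foldr _+_ 0 (map (λ b → foldr _+_ 0 (map (λ c →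
  count< n (λ d → (a <ᵇ b) ∧ (b <ᵇ c) ∧ (c <ᵇ d) ∧ isArc n f a c ∧ isArc n f b d))
  (upTo n))) (upTo n))) (upTo n))

S₂coeff : ℕ → ℕ → ℕ → ℕ
S₂coeff n k d = length (filterᵇ
  (λ f → isSurj n k f ∧ isCanonical n f ∧ (cro n f ≡ᵇ d)) (words n k))

sgn : ℕ → ℤ
sgn m = (ℤ.- (+ 1)) ℤ.^ m

Σℤ≤ : ℕ → (ℕ → ℤ) → ℤ
Σℤ≤ m f = foldr ℤ._+_ (+ 0) (map f (upTo (suc m)))

RHScoeff : ℕ → ℕ → ℕ → ℤ
RHScoeff n k d = sgn (n ∸ k) ℤ.* Σℤ≤ (n ∸ k) (λ j →
  sgn j ℤ.* (+ (((n ∸ 1) + j) C ((n ∸ k) + j)))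
        ℤ.* (+ ((2 * n ∸ k) C ((n ∸ k) ∸ j)))
        ℤ.* (+ S₁coeff ((n ∸ k) + j) j d))

{-# OPTIONS --safe #-}
module Submission where

-- Both sides are sums over Dyck paths of semilength m = n − k in which the down step from height h has
-- weight [h]_q = 1 + q + … + q^(h−1). Reading a set partition from left to right, with the open blocks
-- ordered by their last elements, S₂[m+k,k] is the sum over Dyck paths P of weight(P) · C(m + k + v(P), 2m),
-- where v(P) is the number of valleys. Reading a permutation from right to left, with height the number of
-- missing values below the last record, S₁[m+j,j] is the sum of weight(P) · C(j − v(P) − 1 + 2m, 2m). Up to
-- the substitution j = −m − k these are the same polynomial of degree 2m for each P, so that the identity is
-- Lagrange interpolation of this polynomial at the points −m, …, m. The identity is shown
-- at every integer q, which determines the coefficients.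

open import Defs
open import Data.Bool using (Bool; true; false; if_then_else_; _∧_; _∨_; not)
open import Data.Bool.ListAction using (all; any; and; or)
import Data.Bool.Properties as 𝔹ₚ
open import Data.Integer as ℤ using (ℤ; 0ℤ; 1ℤ; _^_)
  renaming (_+_ to _⊕_; _*_ to _⊗_; -_ to ⊝_)
import Data.Integer.Properties as ℤₚ
open import Data.Integer.Tactic.RingSolver using (solve-∀)
open import Data.List using (List; []; _∷_; _++_; map; foldr; upTo; concatMap; filterᵇ; length; null)
import Data.List.Properties as Listₚ
open import Data.List.Relation.Unary.All as All using (All; []; _∷_)
open import Data.List.Relation.Unary.AllPairs using ([]; _∷_)
open import Data.List.Relation.Unary.Unique.Propositional using (Unique)
open import Data.Nat using (ℕ; zero; suc; pred; _+_; _*_; _∸_; _≤_; _<_; z≤n; s≤s; _≤?_; _≟_; _≡ᵇ_; _<ᵇ_)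
open import Data.Nat.Combinatorics using (_C_; k>n⇒nCk≡0; nCn≡1; nCk≡nC[n∸k]; nCk+nC[k+1]≡[n+1]C[k+1])
import Data.Nat.Properties as ℕₚ
open import Data.Nat.Tactic.RingSolver using () renaming (solve-∀ to solveℕ-∀)
open import Data.Product using (_×_; _,_; proj₁; proj₂)
open import Data.Sum using (_⊎_; inj₁; inj₂)
open import Function using (_∘_)
open import Relation.Nullary using (yes; no; contradiction)
open import Relation.Binary.PropositionalEquality
  using (_≡_; _≢_; refl; sym; trans; cong; cong₂; subst; module ≡-Reasoning)

open ≡-Reasoning

-- The factor [h]_q comes from where each pair is charged. A crossing is charged where its first arc
-- ends: the letter read there contributes the number of open blocks more recent than its own. A
-- special inversion is charged where its smaller entry is read: that entry contributes the number
-- of missing values between it and the last record. In both cases the h candidates receive the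
-- exponents 0, ..., h - 1, once each. Hence q enters only through the weight of the path, and for
-- each path an identity between integers remains. The substitution leaves no sign because the
-- degree 2m is even. For m ≥ 1 a path has v < m valleys, so the polynomial in j vanishes at -m,
-- ..., 0 and only the nodes j > 0 contribute; the binomial coefficients of the theorem are the
-- Lagrange weights of the nodes. Both path formulas are proved for suffixes from an arbitrary
-- height, since the recursions pass through all heights.

private variable
  A B : Set

-- Finite sums

∑ : List A → (A → ℤ) → ℤ
∑ xs f = foldr _⊕_ 0ℤ (map f xs)

∑-cong : ∀ (xs : List A) {f g : A → ℤ} → (∀ x → f x ≡ g x) → ∑ xs f ≡ ∑ xs g
∑-cong []       e = refl
∑-cong (x ∷ xs) e = cong₂ _⊕_ (e x) (∑-cong xs e)

∑-zero : ∀ (xs : List A) {f : A → ℤ} → (∀ x → f x ≡ 0ℤ) → ∑ xs f ≡ 0ℤ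
∑-zero []       e = refl
∑-zero (x ∷ xs) e = cong₂ _⊕_ (e x) (∑-zero xs e)

⊕-interchange : ∀ a b c d → (a ⊕ b) ⊕ (c ⊕ d) ≡ (a ⊕ c) ⊕ (b ⊕ d)
⊕-interchange = solve-∀

∑-⊕ : ∀ (xs : List A) (f g : A → ℤ) → ∑ xs (λ x → f x ⊕ g x) ≡ ∑ xs f ⊕ ∑ xs g
∑-⊕ []       f g = refl
∑-⊕ (x ∷ xs) f g = trans (cong (f x ⊕ g x ⊕_) (∑-⊕ xs f g)) (⊕-interchange (f x) (g x) (∑ xs f) (∑ xs g))

∑-⊗ˡ : ∀ (xs : List A) c (f : A → ℤ) → ∑ xs (λ x → c ⊗ f x) ≡ c ⊗ ∑ xs f
∑-⊗ˡ []       c f = sym (ℤₚ.*-zeroʳ c)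
∑-⊗ˡ (x ∷ xs) c f = trans (cong (c ⊗ f x ⊕_) (∑-⊗ˡ xs c f)) (sym (ℤₚ.*-distribˡ-+ c (f x) (∑ xs f)))

∑-swap : ∀ (xs : List A) (ys : List B) (f : A → B → ℤ) →
         ∑ xs (λ x → ∑ ys (f x)) ≡ ∑ ys (λ y → ∑ xs (λ x → f x y))
∑-swap []       ys f = sym (∑-zero ys (λ _ → refl))
∑-swap (x ∷ xs) ys f = trans (cong (∑ ys (f x) ⊕_) (∑-swap xs ys f)) (sym (∑-⊕ ys (f x) _))

∑-map : ∀ (h : A → B) (xs : List A) (f : B → ℤ) → ∑ (map h xs) f ≡ ∑ xs (f ∘ h)
∑-map h xs f = cong (foldr _⊕_ 0ℤ) (sym (Listₚ.map-∘ xs))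

∑-++ : ∀ (xs ys : List A) (f : A → ℤ) → ∑ (xs ++ ys) f ≡ ∑ xs f ⊕ ∑ ys f
∑-++ []       ys f = sym (ℤₚ.+-identityˡ _)
∑-++ (x ∷ xs) ys f = trans (cong (f x ⊕_) (∑-++ xs ys f)) (sym (ℤₚ.+-assoc (f x) _ _))

∑-concatMap : ∀ (h : A → List B) (xs : List A) (f : B → ℤ) →
              ∑ (concatMap h xs) f ≡ ∑ xs (λ x → ∑ (h x) f)
∑-concatMap h []       f = refl
∑-concatMap h (x ∷ xs) f = trans (∑-++ (h x) (concatMap h xs) f) (cong (∑ (h x) f ⊕_) (∑-concatMap h xs f))

upTo-suc : ∀ n → upTo (suc n) ≡ 0 ∷ map suc (upTo n)
upTo-suc n = cong (0 ∷_) (sym (Listₚ.map-upTo suc n))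

∑-upTo-suc : ∀ n f → ∑ (upTo (suc n)) f ≡ f 0 ⊕ ∑ (upTo n) (f ∘ suc)
∑-upTo-suc n f = trans (cong (λ xs → ∑ xs f) (upTo-suc n)) (cong (f 0 ⊕_) (∑-map suc (upTo n) f))

∑-upTo-cong : ∀ n {f g : ℕ → ℤ} → (∀ i → i < n → f i ≡ g i) → ∑ (upTo n) f ≡ ∑ (upTo n) g
∑-upTo-cong zero    e = refl
∑-upTo-cong (suc n) {f} {g} e = begin
  ∑ (upTo (suc n)) f           ≡⟨ ∑-upTo-suc n f ⟩
  f 0 ⊕ ∑ (upTo n) (f ∘ suc)   ≡⟨ cong₂ _⊕_ (e 0 (s≤s z≤n)) (∑-upTo-cong n (λ i i<n → e (suc i) (s≤s i<n))) ⟩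
  g 0 ⊕ ∑ (upTo n) (g ∘ suc)   ≡⟨ ∑-upTo-suc n g ⟨
  ∑ (upTo (suc n)) g           ∎

∑-upTo-zero : ∀ n {f : ℕ → ℤ} → (∀ i → i < n → f i ≡ 0ℤ) → ∑ (upTo n) f ≡ 0ℤ
∑-upTo-zero n e = trans (∑-upTo-cong n e) (∑-zero (upTo n) (λ _ → refl))

∑-upTo-+ : ∀ a b f → ∑ (upTo (a + b)) f ≡ ∑ (upTo a) f ⊕ ∑ (upTo b) (λ i → f (a + i))
∑-upTo-+ zero    b f = sym (ℤₚ.+-identityˡ _)
∑-upTo-+ (suc a) b f = begin
  ∑ (upTo (suc a + b)) f
    ≡⟨ ∑-upTo-suc (a + b) f ⟩
  f 0 ⊕ ∑ (upTo (a + b)) (f ∘ suc)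
    ≡⟨ cong (f 0 ⊕_) (∑-upTo-+ a b (f ∘ suc)) ⟩
  f 0 ⊕ (∑ (upTo a) (f ∘ suc) ⊕ ∑ (upTo b) (λ i → f (suc a + i)))
    ≡⟨ ℤₚ.+-assoc (f 0) _ _ ⟨
  f 0 ⊕ ∑ (upTo a) (f ∘ suc) ⊕ ∑ (upTo b) (λ i → f (suc a + i))
    ≡⟨ cong (_⊕ ∑ (upTo b) (λ i → f (suc a + i))) (∑-upTo-suc a f) ⟨
  ∑ (upTo (suc a)) f ⊕ ∑ (upTo b) (λ i → f (suc a + i)) ∎

∑-upTo-last : ∀ n f → ∑ (upTo (suc n)) f ≡ ∑ (upTo n) f ⊕ f n
∑-upTo-last n f = begin
  ∑ (upTo (suc n)) f            ≡⟨ cong (λ j → ∑ (upTo j) f) (ℕₚ.+-comm 1 n) ⟩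
  ∑ (upTo (n + 1)) f            ≡⟨ ∑-upTo-+ n 1 f ⟩
  ∑ (upTo n) f ⊕ (f (n + 0) ⊕ 0ℤ) ≡⟨ cong (∑ (upTo n) f ⊕_) (trans (ℤₚ.+-identityʳ _) (cong f (ℕₚ.+-identityʳ n))) ⟩
  ∑ (upTo n) f ⊕ f n            ∎

∑-upTo-reverse : ∀ n f → ∑ (upTo (suc n)) f ≡ ∑ (upTo (suc n)) (λ i → f (n ∸ i))
∑-upTo-reverse zero    f = refl
∑-upTo-reverse (suc n) f = begin
  ∑ (upTo (2 + n)) f                                      ≡⟨ ∑-upTo-last (suc n) f ⟩
  ∑ (upTo (suc n)) f ⊕ f (suc n)                          ≡⟨ ℤₚ.+-comm _ (f (suc n)) ⟩
  f (suc n) ⊕ ∑ (upTo (suc n)) f                          ≡⟨ cong (f (suc n) ⊕_) (∑-upTo-reverse n f) ⟩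
  f (suc n) ⊕ ∑ (upTo (suc n)) (λ i → f (n ∸ i))          ≡⟨ ∑-upTo-suc (suc n) (λ i → f (suc n ∸ i)) ⟨
  ∑ (upTo (2 + n)) (λ i → f (suc n ∸ i))                  ∎

-- Binomial coefficients and finite differences

binom : ℕ → ℕ → ℤ
binom n k = ℤ.+ (n C k)

binom-Pascal : ∀ n k → binom (suc n) (suc k) ≡ binom n k ⊕ binom n (suc k)
binom-Pascal n k = cong ℤ.+_ (sym (nCk+nC[k+1]≡[n+1]C[k+1] n k))

binom-> : ∀ {n k} → n < k → binom n k ≡ 0ℤ
binom-> n<k = cong ℤ.+_ (k>n⇒nCk≡0 n<k)

-- binom⊖ c t r is the binomial coefficient of the integer c − t over r.
binom⊖ : ℕ → ℕ → ℕ → ℤ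
binom⊖ c       zero    r = binom c r
binom⊖ zero    (suc t) r = sgn r ⊗ binom (t + r) r
binom⊖ (suc c) (suc t) r = binom⊖ c t r

binom⊖-∸ : ∀ {c t} r → t ≤ c → binom⊖ c t r ≡ binom (c ∸ t) r
binom⊖-∸ r z≤n       = refl
binom⊖-∸ r (s≤s t≤c) = binom⊖-∸ r t≤c

binom⊖-neg : ∀ c e r → binom⊖ c (c + suc e) r ≡ sgn r ⊗ binom (e + r) r
binom⊖-neg zero    e r = refl
binom⊖-neg (suc c) e r = binom⊖-neg c e r

binom⊖-0 : ∀ c t → binom⊖ c t 0 ≡ 1ℤ
binom⊖-0 c       zero    = refl
binom⊖-0 zero    (suc t) = refl
binom⊖-0 (suc c) (suc t) = binom⊖-0 c t

∇ : (ℕ → ℤ) → ℕ → ℤ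
∇ f t = f t ⊕ ⊝ f (suc t)

-- Pascal's rule for an arbitrary integer top. As the top c - t decreases with t, no sign appears.
-- The clause `zero zero` is the passage from top 0 to top -1, where the two formulas for `binom⊖`
-- meet.
∇-binom⊖ : ∀ c t r → ∇ (λ s → binom⊖ c s (suc r)) t ≡ binom⊖ c (suc t) r
∇-binom⊖ (suc c) (suc t) r = ∇-binom⊖ c t r
∇-binom⊖ (suc c) zero    r = trans (cong (_⊕ ⊝ binom c (suc r)) (binom-Pascal c r)) (cancel (binom c r) (binom c (suc r)))
  where
  cancel : ∀ x y → x ⊕ y ⊕ ⊝ y ≡ x
  cancel = solve-∀
∇-binom⊖ zero    zero    r = begin
  binom 0 (suc r) ⊕ ⊝ (⊝ 1ℤ ⊗ sgn r ⊗ binom (suc r) (suc r))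
    ≡⟨ cong₂ (λ x y → x ⊕ ⊝ (⊝ 1ℤ ⊗ sgn r ⊗ y)) (binom-> {0} {suc r} (s≤s z≤n)) (cong ℤ.+_ (nCn≡1 (suc r))) ⟩
  0ℤ ⊕ ⊝ (⊝ 1ℤ ⊗ sgn r ⊗ 1ℤ)
    ≡⟨ simplify (sgn r) ⟩
  sgn r ⊗ 1ℤ
    ≡⟨ cong (λ y → sgn r ⊗ ℤ.+ y) (nCn≡1 r) ⟨
  sgn r ⊗ binom r r ∎
  where
  simplify : ∀ s → 0ℤ ⊕ ⊝ (⊝ 1ℤ ⊗ s ⊗ 1ℤ) ≡ s ⊗ 1ℤ
  simplify = solve-∀
∇-binom⊖ zero    (suc t) r = begin
  ⊝ 1ℤ ⊗ sgn r ⊗ binom (t + suc r) (suc r) ⊕ ⊝ (⊝ 1ℤ ⊗ sgn r ⊗ binom (suc t + suc r) (suc r))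
    ≡⟨ cong (λ y → ⊝ 1ℤ ⊗ sgn r ⊗ binom (t + suc r) (suc r) ⊕ ⊝ (⊝ 1ℤ ⊗ sgn r ⊗ y)) (binom-Pascal (t + suc r) r) ⟩
  ⊝ 1ℤ ⊗ sgn r ⊗ binom (t + suc r) (suc r) ⊕ ⊝ (⊝ 1ℤ ⊗ sgn r ⊗ (binom (t + suc r) r ⊕ binom (t + suc r) (suc r)))
    ≡⟨ simplify (sgn r) (binom (t + suc r) (suc r)) (binom (t + suc r) r) ⟩
  sgn r ⊗ binom (t + suc r) r
    ≡⟨ cong (λ j → sgn r ⊗ binom j r) (ℕₚ.+-suc t r) ⟩
  sgn r ⊗ binom (suc t + r) r ∎
  where
  simplify : ∀ s x y → ⊝ 1ℤ ⊗ s ⊗ x ⊕ ⊝ (⊝ 1ℤ ⊗ s ⊗ (y ⊕ x)) ≡ s ⊗ y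
  simplify = solve-∀

-- Degree is expressed by iterated differences, so that no polynomial with rational coefficients has
-- to be represented.
Deg< : ℕ → (ℕ → ℤ) → Set
Deg< zero    f = ∀ t → f t ≡ 0ℤ
Deg< (suc d) f = Deg< d (∇ f)

Deg<-cong : ∀ d {f g} → (∀ t → f t ≡ g t) → Deg< d f → Deg< d g
Deg<-cong zero    e f₀ t = trans (sym (e t)) (f₀ t)
Deg<-cong (suc d) e      = Deg<-cong d (λ t → cong₂ (λ x y → x ⊕ ⊝ y) (e t) (e (suc t)))

Deg<-zero : ∀ d {f} → (∀ t → f t ≡ 0ℤ) → Deg< d f
Deg<-zero zero    f₀ = f₀
Deg<-zero (suc d) f₀ = Deg<-zero d (λ t → cong₂ (λ x y → x ⊕ ⊝ y) (f₀ t) (f₀ (suc t)))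

Deg<-⊕ : ∀ d {f g} → Deg< d f → Deg< d g → Deg< d (λ t → f t ⊕ g t)
Deg<-⊕ zero            p q t = cong₂ _⊕_ (p t) (q t)
Deg<-⊕ (suc d) {f} {g} p q   =
  Deg<-cong d (λ t → regroup (f t) (f (suc t)) (g t) (g (suc t))) (Deg<-⊕ d p q)
  where
  regroup : ∀ a a′ b b′ → (a ⊕ ⊝ a′) ⊕ (b ⊕ ⊝ b′) ≡ (a ⊕ b) ⊕ ⊝ (a′ ⊕ b′)
  regroup = solve-∀

Deg<-shift : ∀ d {f} → Deg< d f → Deg< d (f ∘ suc)
Deg<-shift zero    p t = p (suc t)
Deg<-shift (suc d) p   = Deg<-shift d p

-- Degrees at most a - 1 and b - 1 add up to at most a + b - 2; the form `a + b ≤ suc c` avoids the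
-- subtraction. The induction is the Leibniz rule for differences, in which one factor is shifted.
Deg<-⊗ : ∀ a b c {f g} → a + b ≤ suc c → Deg< a f → Deg< b g → Deg< c (λ t → f t ⊗ g t)
Deg<-⊗ zero    b       c       {g = g} le       p q = Deg<-zero c (λ t → cong (_⊗ g t) (p t))
Deg<-⊗ (suc a) zero    c       {f = f} le       p q =
  Deg<-zero c (λ t → trans (cong (f t ⊗_) (q t)) (ℤₚ.*-zeroʳ (f t)))
Deg<-⊗ (suc a) (suc b) zero            (s≤s le) p q =
  contradiction (ℕₚ.≤-trans (ℕₚ.m≤n+m (suc b) a) le) λ ()
Deg<-⊗ (suc a) (suc b) (suc c) {f} {g} (s≤s le) p q =
  Deg<-cong c (λ t → Leibniz (f t) (f (suc t)) (g t) (g (suc t)))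
    (Deg<-⊕ c (Deg<-⊗ a (suc b) c {g = g} le p q)
              (Deg<-⊗ (suc a) b c {f = f ∘ suc} (subst (_≤ suc c) (ℕₚ.+-suc a b) le) (Deg<-shift (suc a) {f} p) q))
  where
  Leibniz : ∀ x x′ y y′ → (x ⊕ ⊝ x′) ⊗ y ⊕ x′ ⊗ (y ⊕ ⊝ y′) ≡ x ⊗ y ⊕ ⊝ (x′ ⊗ y′)
  Leibniz = solve-∀

Deg<-binom⊖ : ∀ c r → Deg< (suc r) (λ t → binom⊖ c t r)
Deg<-binom⊖ c zero    t = cong₂ (λ x y → x ⊕ ⊝ y) (binom⊖-0 c t) (binom⊖-0 c (suc t))
Deg<-binom⊖ c (suc r)   = Deg<-cong (suc r) (λ t → sym (∇-binom⊖ c t r))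
  (Deg<-shift (suc r) {λ t → binom⊖ c t r} (Deg<-binom⊖ c r))

alternating : ℕ → (ℕ → ℤ) → ℤ
alternating N f = ∑ (upTo (suc N)) (λ t → sgn t ⊗ binom N t ⊗ f t)

-- Pascal's rule and a shift of the index. Iterated, it identifies `alternating N f` with the N-fold
-- `∇` of f at 0.
alternating-suc : ∀ N f → alternating (suc N) f ≡ alternating N (∇ f)
alternating-suc N f = begin
  alternating (suc N) f
    ≡⟨ ∑-upTo-suc (suc N) (λ t → sgn t ⊗ binom (suc N) t ⊗ f t) ⟩
  1ℤ ⊗ 1ℤ ⊗ f 0 ⊕ ∑ (upTo (suc N)) (λ t → sgn (suc t) ⊗ binom (suc N) (suc t) ⊗ f (suc t))
    ≡⟨ cong (1ℤ ⊗ 1ℤ ⊗ f 0 ⊕_) (trans (∑-cong (upTo (suc N)) split) (∑-⊕ (upTo (suc N)) u v)) ⟩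
  1ℤ ⊗ 1ℤ ⊗ f 0 ⊕ (∑ (upTo (suc N)) u ⊕ ∑ (upTo (suc N)) v)
    ≡⟨ ℤₚ.+-assoc (1ℤ ⊗ 1ℤ ⊗ f 0) (∑ (upTo (suc N)) u) (∑ (upTo (suc N)) v) ⟨
  1ℤ ⊗ 1ℤ ⊗ f 0 ⊕ ∑ (upTo (suc N)) u ⊕ ∑ (upTo (suc N)) v
    ≡⟨ cong (_⊕ ∑ (upTo (suc N)) v) (∑-upTo-suc (suc N) w) ⟨
  ∑ (upTo (suc (suc N))) w ⊕ ∑ (upTo (suc N)) v
    ≡⟨ cong (_⊕ ∑ (upTo (suc N)) v) (begin
        ∑ (upTo (suc (suc N))) w       ≡⟨ ∑-upTo-last (suc N) w ⟩
        ∑ (upTo (suc N)) w ⊕ w (suc N) ≡⟨ cong (∑ (upTo (suc N)) w ⊕_) top ⟩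
        ∑ (upTo (suc N)) w ⊕ 0ℤ        ≡⟨ ℤₚ.+-identityʳ (∑ (upTo (suc N)) w) ⟩
        ∑ (upTo (suc N)) w             ∎) ⟩
  ∑ (upTo (suc N)) w ⊕ ∑ (upTo (suc N)) v
    ≡⟨ ∑-⊕ (upTo (suc N)) w v ⟨
  ∑ (upTo (suc N)) (λ t → w t ⊕ v t)
    ≡⟨ ∑-cong (upTo (suc N)) (λ t → merge (sgn t) (binom N t) (f t) (f (suc t))) ⟩
  alternating N (∇ f) ∎
  where
  u v w : ℕ → ℤ
  u t = sgn (suc t) ⊗ binom N (suc t) ⊗ f (suc t)
  v t = sgn (suc t) ⊗ binom N t ⊗ f (suc t)
  w t = sgn t ⊗ binom N t ⊗ f t
  distr : ∀ s x y z → s ⊗ (x ⊕ y) ⊗ z ≡ s ⊗ y ⊗ z ⊕ s ⊗ x ⊗ z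
  distr = solve-∀
  split : ∀ t → sgn (suc t) ⊗ binom (suc N) (suc t) ⊗ f (suc t) ≡ u t ⊕ v t
  split t = trans (cong (λ b → sgn (suc t) ⊗ b ⊗ f (suc t)) (binom-Pascal N t))
                  (distr (sgn (suc t)) (binom N t) (binom N (suc t)) (f (suc t)))
  top : w (suc N) ≡ 0ℤ
  top = trans (cong (λ b → sgn (suc N) ⊗ b ⊗ f (suc N)) (binom-> (ℕₚ.n<1+n N)))
              (cong (_⊗ f (suc N)) (ℤₚ.*-zeroʳ (sgn (suc N))))
  merge : ∀ s b x y → s ⊗ b ⊗ x ⊕ ⊝ 1ℤ ⊗ s ⊗ b ⊗ y ≡ s ⊗ b ⊗ (x ⊕ ⊝ y)
  merge = solve-∀

alternating-Deg< : ∀ N f → Deg< N f → alternating N f ≡ 0ℤ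
alternating-Deg< zero    f p = trans (ℤₚ.+-identityʳ _) (trans (cong (1ℤ ⊗ 1ℤ ⊗_) (p 0)) refl)
alternating-Deg< (suc N) f p = trans (alternating-suc N f) (alternating-Deg< N (∇ f) p)

-- The number of multisets of k elements of an (ℓ + 1)-element set that contain ρ prescribed elements.
multichoose : ℕ → ℕ → ℕ → ℤ
multichoose k       zero    ℓ = binom (k + ℓ) ℓ
multichoose zero    (suc ρ) ℓ = 0ℤ
multichoose (suc k) (suc ρ) ℓ = multichoose k ρ ℓ

multichoose-+ : ∀ ρ i ℓ → multichoose (ρ + i) ρ ℓ ≡ binom (i + ℓ) ℓ
multichoose-+ zero    i ℓ = refl
multichoose-+ (suc ρ) i ℓ = multichoose-+ ρ i ℓ

multichoose-< : ∀ {k ρ} ℓ → k < ρ → multichoose k ρ ℓ ≡ 0ℤ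
multichoose-< {zero}  {suc ρ} ℓ _         = refl
multichoose-< {suc k} {suc ρ} ℓ (s≤s k<ρ) = multichoose-< ℓ k<ρ

-- Pascal's rule for tops k + 1 - ρ + ℓ + 1. At the boundary ρ = k + 1 the first summand on the
-- right vanishes and the other two terms are 1, which is the clause `zero (suc zero)`.
multichoose-Pascal : ∀ k ρ ℓ →
  multichoose (suc k) ρ (suc ℓ) ≡ multichoose k ρ (suc ℓ) ⊕ multichoose (suc k) ρ ℓ
multichoose-Pascal k       zero    ℓ = begin
  binom (suc (k + suc ℓ)) (suc ℓ)            ≡⟨ binom-Pascal (k + suc ℓ) ℓ ⟩
  binom (k + suc ℓ) ℓ ⊕ binom (k + suc ℓ) (suc ℓ) ≡⟨ ℤₚ.+-comm (binom (k + suc ℓ) ℓ) (binom (k + suc ℓ) (suc ℓ)) ⟩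
  binom (k + suc ℓ) (suc ℓ) ⊕ binom (k + suc ℓ) ℓ ≡⟨ cong (λ j → binom (k + suc ℓ) (suc ℓ) ⊕ binom j ℓ) (ℕₚ.+-suc k ℓ) ⟩
  binom (k + suc ℓ) (suc ℓ) ⊕ binom (suc k + ℓ) ℓ ∎
multichoose-Pascal zero    (suc zero)    ℓ =
  trans (cong ℤ.+_ (nCn≡1 (suc ℓ))) (sym (trans (ℤₚ.+-identityˡ _) (cong ℤ.+_ (nCn≡1 ℓ))))
multichoose-Pascal zero    (suc (suc ρ)) ℓ = refl
multichoose-Pascal (suc k) (suc ρ)       ℓ = multichoose-Pascal k ρ ℓ

sgn-+ : ∀ a b → sgn (a + b) ≡ sgn a ⊗ sgn b
sgn-+ zero    b = sym (ℤₚ.*-identityˡ (sgn b))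
sgn-+ (suc a) b = trans (cong (⊝ 1ℤ ⊗_) (sgn-+ a b)) (sym (ℤₚ.*-assoc (⊝ 1ℤ) (sgn a) (sgn b)))

sgn² : ∀ a → sgn a ⊗ sgn a ≡ 1ℤ
sgn² zero    = refl
sgn² (suc a) = trans (square (sgn a)) (sgn² a)
  where
  square : ∀ s → ⊝ 1ℤ ⊗ s ⊗ (⊝ 1ℤ ⊗ s) ≡ s ⊗ s
  square = solve-∀

sgn-∸ : ∀ {m j} → j ≤ m → sgn (m ∸ j) ≡ sgn m ⊗ sgn j
sgn-∸ {m} {j} j≤m = begin
  sgn (m ∸ j)                     ≡⟨ ℤₚ.*-identityʳ (sgn (m ∸ j)) ⟨
  sgn (m ∸ j) ⊗ 1ℤ                ≡⟨ cong (sgn (m ∸ j) ⊗_) (sgn² j) ⟨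
  sgn (m ∸ j) ⊗ (sgn j ⊗ sgn j)   ≡⟨ ℤₚ.*-assoc (sgn (m ∸ j)) (sgn j) (sgn j) ⟨
  sgn (m ∸ j) ⊗ sgn j ⊗ sgn j     ≡⟨ cong (_⊗ sgn j) (sgn-+ (m ∸ j) j) ⟨
  sgn (m ∸ j + j) ⊗ sgn j         ≡⟨ cong (λ i → sgn i ⊗ sgn j) (ℕₚ.m∸n+n≡m j≤m) ⟩
  sgn m ⊗ sgn j                   ∎

-- Lagrange interpolation for a path with v valleys

module Interpolation (κ v w : ℕ) where

  -- In terms of the theorem k = κ + 1 and n = k + m, so that N = 2n - k. The form `suc v + w` of
  -- the semilength encodes v < m.
  m ℓ N : ℕ
  m = suc v + w
  ℓ = m + m
  N = suc (ℓ + κ)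

  -- At t = m - j the second factor has top j - (v + 1) + ℓ; it is the polynomial to be
  -- interpolated. The first factor vanishes at ℓ + 1, ..., ℓ + κ, so that of the N + 1 nodes of an
  -- N-th difference only 0, ..., ℓ and N are left; its values at the other nodes complete the
  -- Lagrange weights.
  f : ℕ → ℤ
  f t = binom⊖ (ℓ + κ) t κ ⊗ binom⊖ (ℓ + w) t ℓ

  term : ℕ → ℤ
  term t = sgn t ⊗ binom N t ⊗ f t

  w<m : w < m
  w<m = s≤s (ℕₚ.m≤n+m w v)

  f-vanishes : Deg< N f
  f-vanishes = Deg<-⊗ (suc κ) (suc ℓ) N {λ t → binom⊖ (ℓ + κ) t κ} {λ t → binom⊖ (ℓ + w) t ℓ} (ℕₚ.≤-reflexive (arith κ ℓ))
                 (Deg<-binom⊖ (ℓ + κ) κ) (Deg<-binom⊖ (ℓ + w) ℓ)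
    where
    arith : ∀ κ ℓ → suc κ + suc ℓ ≡ suc (suc (ℓ + κ))
    arith = solveℕ-∀

  -- Up to t = ℓ the top of the second factor lies between 0 and ℓ - 1; beyond, up to t = ℓ + κ, the
  -- top of the first factor lies between 0 and κ - 1.
  f-middle : ∀ i → i < m + κ → f (suc m + i) ≡ 0ℤ
  f-middle i i< with i ℕₚ.<? m
  ... | yes i<m = trans (cong (binom⊖ (ℓ + κ) t κ ⊗_) (trans (binom⊖-∸ ℓ t≤) (binom-> small)))
                        (ℤₚ.*-zeroʳ (binom⊖ (ℓ + κ) t κ))
    where
    t = suc m + i
    t≤ℓ : t ≤ ℓ
    t≤ℓ = subst (_≤ ℓ) (ℕₚ.+-suc m i) (ℕₚ.+-monoʳ-≤ m i<m)
    t≤ : t ≤ ℓ + w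
    t≤ = ℕₚ.≤-trans t≤ℓ (ℕₚ.m≤m+n ℓ w)
    small : ℓ + w ∸ t < ℓ
    small = ℕₚ.+-cancelʳ-< t (ℓ + w ∸ t) ℓ (subst (_< ℓ + t) (sym (ℕₚ.m∸n+n≡m t≤))
              (ℕₚ.+-monoʳ-< ℓ (ℕₚ.<-trans w<m (s≤s (ℕₚ.m≤m+n m i)))))
  ... | no i≮m = cong (_⊗ binom⊖ (ℓ + w) t ℓ) (trans (binom⊖-∸ κ t≤) (binom-> small))
    where
    t = suc m + i
    t≤ : t ≤ ℓ + κ
    t≤ = subst (t ≤_) (sym (ℕₚ.+-assoc m m κ)) (subst (_≤ m + (m + κ)) (ℕₚ.+-suc m i) (ℕₚ.+-monoʳ-≤ m i<))
    small : ℓ + κ ∸ t < κ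
    small = ℕₚ.+-cancelʳ-< t (ℓ + κ ∸ t) κ (subst (_< κ + t) (trans (ℕₚ.+-comm κ ℓ) (sym (ℕₚ.m∸n+n≡m t≤)))
              (ℕₚ.+-monoʳ-< κ (s≤s (ℕₚ.+-monoʳ-≤ m (ℕₚ.≮⇒≥ i≮m)))))

  value : ℤ
  value = binom (κ + m + suc v) ℓ

  -- The top is w - κ - 1. If it is negative, upper negation produces the sign of ℓ, which is even.
  -- Otherwise both tops are nonnegative and smaller than ℓ, and both sides are 0.
  binom⊖-N : binom⊖ (ℓ + w) N ℓ ≡ value
  binom⊖-N with w ≤? κ
  ... | yes w≤κ = begin
    binom⊖ (ℓ + w) N ℓ                     ≡⟨ cong (λ t → binom⊖ (ℓ + w) t ℓ) (trans (cong (λ x → suc (ℓ + x)) (sym κ≡)) (arith₁ ℓ w e)) ⟩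
    binom⊖ (ℓ + w) (ℓ + w + suc e) ℓ       ≡⟨ binom⊖-neg (ℓ + w) e ℓ ⟩
    sgn ℓ ⊗ binom (e + ℓ) ℓ                ≡⟨ cong (_⊗ binom (e + ℓ) ℓ) (trans (sgn-+ m m) (sgn² m)) ⟩
    1ℤ ⊗ binom (e + ℓ) ℓ                   ≡⟨ ℤₚ.*-identityˡ (binom (e + ℓ) ℓ) ⟩
    binom (e + ℓ) ℓ                        ≡⟨ cong (λ t → binom t ℓ) (trans (arith₂ v w e) (cong (λ x → x + m + suc v) κ≡)) ⟩
    value                                  ∎
    where
    e = κ ∸ w
    κ≡ : w + e ≡ κ
    κ≡ = ℕₚ.m+[n∸m]≡n w≤κ
    arith₁ : ∀ ℓ w e → suc (ℓ + (w + e)) ≡ ℓ + w + suc e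
    arith₁ = solveℕ-∀
    arith₂ : ∀ v w e → e + (suc v + w + (suc v + w)) ≡ w + e + (suc v + w) + suc v
    arith₂ = solveℕ-∀
  ... | no w≰κ = begin
    binom⊖ (ℓ + w) N ℓ     ≡⟨ binom⊖-∸ ℓ N≤ ⟩
    binom (ℓ + w ∸ N) ℓ    ≡⟨ binom-> (ℕₚ.≤-<-trans (ℕₚ.≤-trans (ℕₚ.∸-monoʳ-≤ (ℓ + w) (ℕₚ.≤-trans (ℕₚ.m≤m+n ℓ κ) (ℕₚ.n≤1+n (ℓ + κ)))) (ℕₚ.≤-reflexive (ℕₚ.m+n∸m≡n ℓ w)))
                                 (ℕₚ.<-≤-trans w<m (ℕₚ.m≤m+n m m))) ⟩
    0ℤ                     ≡⟨ binom-> {κ + m + suc v} {ℓ} (subst (_< ℓ) (arith₃ v κ m) (ℕₚ.+-monoʳ-< m (ℕₚ.+-monoʳ-< (suc v) κ<w))) ⟨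
    value                  ∎
    where
    κ<w : κ < w
    κ<w = ℕₚ.≰⇒> w≰κ
    N≤ : N ≤ ℓ + w
    N≤ = subst (_≤ ℓ + w) (ℕₚ.+-suc ℓ κ) (ℕₚ.+-monoʳ-≤ ℓ κ<w)
    arith₃ : ∀ v κ m → m + (suc v + κ) ≡ κ + m + suc v
    arith₃ = solveℕ-∀

  term-last : term N ≡ ⊝ value
  term-last = begin
    sgn N ⊗ binom N N ⊗ (binom⊖ (ℓ + κ) N κ ⊗ binom⊖ (ℓ + w) N ℓ)
      ≡⟨ cong₂ (λ x y → sgn N ⊗ x ⊗ (y ⊗ binom⊖ (ℓ + w) N ℓ)) (cong ℤ.+_ (nCn≡1 N)) last-factor ⟩
    sgn N ⊗ 1ℤ ⊗ (sgn κ ⊗ 1ℤ ⊗ binom⊖ (ℓ + w) N ℓ)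
      ≡⟨ cong₂ (λ x y → ⊝ 1ℤ ⊗ x ⊗ 1ℤ ⊗ (sgn κ ⊗ 1ℤ ⊗ y))
               (trans (sgn-+ ℓ κ) (cong (_⊗ sgn κ) (trans (sgn-+ m m) (sgn² m)))) binom⊖-N ⟩
    ⊝ 1ℤ ⊗ (1ℤ ⊗ sgn κ) ⊗ 1ℤ ⊗ (sgn κ ⊗ 1ℤ ⊗ value)
      ≡⟨ regroup (sgn κ) value ⟩
    ⊝ (sgn κ ⊗ sgn κ ⊗ value)
      ≡⟨ cong (λ s → ⊝ (s ⊗ value)) (sgn² κ) ⟩
    ⊝ (1ℤ ⊗ value)
      ≡⟨ cong ⊝_ (ℤₚ.*-identityˡ value) ⟩
    ⊝ value ∎
    where
    last-factor : binom⊖ (ℓ + κ) N κ ≡ sgn κ ⊗ 1ℤ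
    last-factor = begin
      binom⊖ (ℓ + κ) N κ            ≡⟨ cong (λ t → binom⊖ (ℓ + κ) t κ) (ℕₚ.+-comm 1 (ℓ + κ)) ⟩
      binom⊖ (ℓ + κ) (ℓ + κ + 1) κ  ≡⟨ binom⊖-neg (ℓ + κ) 0 κ ⟩
      sgn κ ⊗ binom κ κ             ≡⟨ cong (λ x → sgn κ ⊗ ℤ.+ x) (nCn≡1 κ) ⟩
      sgn κ ⊗ 1ℤ                    ∎
    regroup : ∀ s x → ⊝ 1ℤ ⊗ (1ℤ ⊗ s) ⊗ 1ℤ ⊗ (s ⊗ 1ℤ ⊗ x) ≡ ⊝ (s ⊗ s ⊗ x)
    regroup = solve-∀

  f-first : ∀ {j} → j ≤ m → f (m ∸ j) ≡ binom (κ + m + j) (m + j) ⊗ multichoose j (suc v) ℓ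
  f-first {j} j≤m = cong₂ _⊗_ left right
    where
    i = m ∸ j
    j+i≡m : j + i ≡ m
    j+i≡m = ℕₚ.m+[n∸m]≡n j≤m
    i≤ℓ : i ≤ ℓ
    i≤ℓ = ℕₚ.≤-trans (ℕₚ.m∸n≤m m j) (ℕₚ.m≤m+n m m)
    ℓ∸i : ∀ x → ℓ + x ∸ i ≡ m + j + x
    ℓ∸i x = trans (cong (λ y → m + y + x ∸ i) (sym j+i≡m))
              (trans (cong (_∸ i) (arith m j i x)) (ℕₚ.m+n∸n≡m (m + j + x) i))
      where
      arith : ∀ m j i x → m + (j + i) + x ≡ m + j + x + i
      arith = solveℕ-∀
    left : binom⊖ (ℓ + κ) i κ ≡ binom (κ + m + j) (m + j)
    left = begin
      binom⊖ (ℓ + κ) i κ                  ≡⟨ binom⊖-∸ κ (ℕₚ.≤-trans i≤ℓ (ℕₚ.m≤m+n ℓ κ)) ⟩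
      binom (ℓ + κ ∸ i) κ                 ≡⟨ cong (λ x → binom x κ) (ℓ∸i κ) ⟩
      binom (m + j + κ) κ                 ≡⟨ cong ℤ.+_ (nCk≡nC[n∸k] (ℕₚ.m≤n+m κ (m + j))) ⟩
      binom (m + j + κ) (m + j + κ ∸ κ)   ≡⟨ cong₂ binom (trans (ℕₚ.+-comm (m + j) κ) (sym (ℕₚ.+-assoc κ m j))) (ℕₚ.m+n∸n≡m (m + j) κ) ⟩
      binom (κ + m + j) (m + j)           ∎
    right : binom⊖ (ℓ + w) i ℓ ≡ multichoose j (suc v) ℓ
    right with suc v ≤? j
    ... | yes v<j = begin
      binom⊖ (ℓ + w) i ℓ                  ≡⟨ binom⊖-∸ ℓ (ℕₚ.≤-trans i≤ℓ (ℕₚ.m≤m+n ℓ w)) ⟩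
      binom (ℓ + w ∸ i) ℓ                 ≡⟨ cong (λ x → binom x ℓ) (ℓ∸i w) ⟩
      binom (m + j + w) ℓ                 ≡⟨ cong (λ x → binom x ℓ) (trans (cong (λ y → m + y + w) (sym j≡)) (arith v w e)) ⟩
      binom (e + ℓ) ℓ                     ≡⟨ multichoose-+ (suc v) e ℓ ⟨
      multichoose (suc v + e) (suc v) ℓ   ≡⟨ cong (λ x → multichoose x (suc v) ℓ) j≡ ⟩
      multichoose j (suc v) ℓ             ∎
      where
      e = j ∸ suc v
      j≡ : suc v + e ≡ j
      j≡ = ℕₚ.m+[n∸m]≡n v<j
      arith : ∀ v w e → suc v + w + (suc v + e) + w ≡ e + (suc v + w + (suc v + w))
      arith = solveℕ-∀
    ... | no v≮j = begin
      binom⊖ (ℓ + w) i ℓ                  ≡⟨ binom⊖-∸ ℓ (ℕₚ.≤-trans i≤ℓ (ℕₚ.m≤m+n ℓ w)) ⟩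
      binom (ℓ + w ∸ i) ℓ                 ≡⟨ binom-> (subst (_< ℓ) (sym (trans (ℓ∸i w) (ℕₚ.+-assoc m j w)))
                                                (ℕₚ.+-monoʳ-< m (ℕₚ.+-monoˡ-< w (ℕₚ.≰⇒> v≮j)))) ⟩
      0ℤ                                  ≡⟨ multichoose-< ℓ (ℕₚ.≰⇒> v≮j) ⟨
      multichoose j (suc v) ℓ             ∎

  summand : ℕ → ℤ
  summand j = sgn j ⊗ binom (κ + m + j) (m + j) ⊗ binom N (m ∸ j) ⊗ multichoose j (suc v) ℓ

  term-first : ∀ j → j < suc m → term (m ∸ j) ≡ sgn m ⊗ summand j
  term-first j (s≤s j≤m) = trans
    (cong₂ (λ x y → x ⊗ binom N (m ∸ j) ⊗ y) (sgn-∸ j≤m) (f-first j≤m))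
    (regroup (sgn m) (sgn j) (binom N (m ∸ j)) (binom (κ + m + j) (m + j)) (multichoose j (suc v) ℓ))
    where
    regroup : ∀ s t b c d → s ⊗ t ⊗ b ⊗ (c ⊗ d) ≡ s ⊗ (t ⊗ c ⊗ b ⊗ d)
    regroup = solve-∀

  -- The N-th difference of f vanishes because f has degree κ + ℓ < N. Of the N + 1 points, those
  -- strictly between m and N are zeros of f, and the point N carries the value to be interpolated.
  interpolation : value ≡ sgn m ⊗ ∑ (upTo (suc m)) summand
  interpolation = begin
    value                                  ≡⟨ insert-zero value ⟩
    value ⊕ 0ℤ                             ≡⟨ cong (value ⊕_) (alternating-Deg< N f f-vanishes) ⟨
    value ⊕ alternating N f                ≡⟨ cong (value ⊕_) (∑-upTo-last N term) ⟩
    value ⊕ (∑ (upTo N) term ⊕ term N)     ≡⟨ cong₂ (λ x y → value ⊕ (x ⊕ y)) first-part term-last ⟩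
    value ⊕ (sgn m ⊗ ∑ (upTo (suc m)) summand ⊕ ⊝ value)
                                           ≡⟨ cancel value (sgn m ⊗ ∑ (upTo (suc m)) summand) ⟩
    sgn m ⊗ ∑ (upTo (suc m)) summand       ∎
    where
    insert-zero : ∀ x → x ≡ x ⊕ 0ℤ
    insert-zero = solve-∀
    cancel : ∀ x y → x ⊕ (y ⊕ ⊝ x) ≡ y
    cancel = solve-∀
    middle : ∀ i → i < m + κ → term (suc m + i) ≡ 0ℤ
    middle i i< = trans (cong (sgn (suc m + i) ⊗ binom N (suc m + i) ⊗_) (f-middle i i<))
                        (ℤₚ.*-zeroʳ (sgn (suc m + i) ⊗ binom N (suc m + i)))
    first-part : ∑ (upTo N) term ≡ sgn m ⊗ ∑ (upTo (suc m)) summand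
    first-part = begin
      ∑ (upTo N) term
        ≡⟨ cong (λ x → ∑ (upTo (suc x)) term) (ℕₚ.+-assoc m m κ) ⟩
      ∑ (upTo (suc m + (m + κ))) term
        ≡⟨ ∑-upTo-+ (suc m) (m + κ) term ⟩
      ∑ (upTo (suc m)) term ⊕ ∑ (upTo (m + κ)) (λ i → term (suc m + i))
        ≡⟨ cong (∑ (upTo (suc m)) term ⊕_) (∑-upTo-zero (m + κ) middle) ⟩
      ∑ (upTo (suc m)) term ⊕ 0ℤ
        ≡⟨ ℤₚ.+-identityʳ _ ⟩
      ∑ (upTo (suc m)) term
        ≡⟨ ∑-upTo-reverse m term ⟩
      ∑ (upTo (suc m)) (λ j → term (m ∸ j))
        ≡⟨ ∑-upTo-cong (suc m) term-first ⟩
      ∑ (upTo (suc m)) (λ j → sgn m ⊗ summand j)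
        ≡⟨ ∑-⊗ˡ (upTo (suc m)) (sgn m) summand ⟩
      sgn m ⊗ ∑ (upTo (suc m)) summand ∎

-- Dyck paths

≢⇒≡ᵇ-false : ∀ {m n} → m ≢ n → (m ≡ᵇ n) ≡ false
≢⇒≡ᵇ-false {zero}  {zero}  ne = contradiction refl ne
≢⇒≡ᵇ-false {zero}  {suc n} ne = refl
≢⇒≡ᵇ-false {suc m} {zero}  ne = refl
≢⇒≡ᵇ-false {suc m} {suc n} ne = ≢⇒≡ᵇ-false (ne ∘ cong suc)

≡ᵇ-refl : ∀ n → (n ≡ᵇ n) ≡ true
≡ᵇ-refl zero    = refl
≡ᵇ-refl (suc n) = ≡ᵇ-refl n

-- A Dyck suffix starts at height h, makes u up steps and u + h down steps, and ends at height 0; the down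
-- step from height h has weight a h. Its value is φ at the number of its valleys (a down step followed by
-- an up step). In pathD a down step precedes the suffix, so that an initial up step closes a valley.
module Paths (a : ℕ → ℤ) where

  stop : ℕ → ℕ → (ℕ → ℤ) → ℤ
  stop zero    zero    φ = φ 0
  stop zero    (suc h) φ = 0ℤ
  stop (suc u) h       φ = 0ℤ

  path pathD up down : ℕ → ℕ → (ℕ → ℤ) → ℤ
  path  u h φ = stop u h φ ⊕ up u h φ ⊕ down u h φ
  pathD u h φ = stop u h φ ⊕ up u h (φ ∘ suc) ⊕ down u h φ
  up   zero    h       φ = 0ℤ
  up   (suc u) h       φ = path u (suc h) φ
  down u       zero    φ = 0ℤ
  down u       (suc h) φ = a (suc h) ⊗ pathD u h φ

  private
    ⊕-cong₃ : ∀ {x x′ y y′ z z′} → x ≡ x′ → y ≡ y′ → z ≡ z′ → x ⊕ y ⊕ z ≡ x′ ⊕ y′ ⊕ z′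
    ⊕-cong₃ p q r = cong₂ _⊕_ (cong₂ _⊕_ p q) r

  stop-cong : ∀ u h {φ ψ} → φ 0 ≡ ψ 0 → stop u h φ ≡ stop u h ψ
  stop-cong zero    zero    e = e
  stop-cong zero    (suc h) e = refl
  stop-cong (suc u) h       e = refl

  -- Every valley uses up one of the u remaining up steps, which bounds the arguments at which φ
  -- matters. An initial up step outside `pathD` closes no valley, hence the strict bound in
  -- `up-cong`. These bounds are what makes the vanishing of binomial coefficients and v < m usable
  -- below.
  path-cong  : ∀ u h {φ ψ} → (∀ v → v ≤ u → φ v ≡ ψ v) → path u h φ ≡ path u h ψ
  pathD-cong : ∀ u h {φ ψ} → (∀ v → v ≤ u → φ v ≡ ψ v) → pathD u h φ ≡ pathD u h ψ
  up-cong    : ∀ u h {φ ψ} → (∀ v → v < u → φ v ≡ ψ v) → up u h φ ≡ up u h ψ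
  down-cong  : ∀ u h {φ ψ} → (∀ v → v ≤ u → φ v ≡ ψ v) → down u h φ ≡ down u h ψ
  path-cong  u h e = ⊕-cong₃ (stop-cong u h (e 0 z≤n)) (up-cong u h (λ v v<u → e v (ℕₚ.<⇒≤ v<u))) (down-cong u h e)
  pathD-cong u h e = ⊕-cong₃ (stop-cong u h (e 0 z≤n)) (up-cong u h (λ v v<u → e (suc v) v<u)) (down-cong u h e)
  up-cong   zero    h       e = refl
  up-cong   (suc u) h       e = path-cong u (suc h) (λ v v≤u → e v (s≤s v≤u))
  down-cong u       zero    e = refl
  down-cong u       (suc h) e = cong (a (suc h) ⊗_) (pathD-cong u h e)

  private
    regroup : ∀ p q r s t z → (p ⊕ q) ⊕ (r ⊕ s) ⊕ (t ⊕ z) ≡ (p ⊕ r ⊕ t) ⊕ (q ⊕ s ⊕ z)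
    regroup = solve-∀

  stop-⊕ : ∀ u h φ ψ → stop u h (λ v → φ v ⊕ ψ v) ≡ stop u h φ ⊕ stop u h ψ
  stop-⊕ zero    zero    φ ψ = refl
  stop-⊕ zero    (suc h) φ ψ = refl
  stop-⊕ (suc u) h       φ ψ = refl

  path-⊕  : ∀ u h φ ψ → path u h (λ v → φ v ⊕ ψ v) ≡ path u h φ ⊕ path u h ψ
  pathD-⊕ : ∀ u h φ ψ → pathD u h (λ v → φ v ⊕ ψ v) ≡ pathD u h φ ⊕ pathD u h ψ
  up-⊕    : ∀ u h φ ψ → up u h (λ v → φ v ⊕ ψ v) ≡ up u h φ ⊕ up u h ψ
  down-⊕  : ∀ u h φ ψ → down u h (λ v → φ v ⊕ ψ v) ≡ down u h φ ⊕ down u h ψ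
  path-⊕  u h φ ψ = trans (⊕-cong₃ (stop-⊕ u h φ ψ) (up-⊕ u h φ ψ) (down-⊕ u h φ ψ))
    (regroup (stop u h φ) (stop u h ψ) (up u h φ) (up u h ψ) (down u h φ) (down u h ψ))
  pathD-⊕ u h φ ψ = trans (⊕-cong₃ (stop-⊕ u h φ ψ) (up-⊕ u h (φ ∘ suc) (ψ ∘ suc)) (down-⊕ u h φ ψ))
    (regroup (stop u h φ) (stop u h ψ) (up u h (φ ∘ suc)) (up u h (ψ ∘ suc)) (down u h φ) (down u h ψ))
  up-⊕   zero    h       φ ψ = refl
  up-⊕   (suc u) h       φ ψ = path-⊕ u (suc h) φ ψ
  down-⊕ u       zero    φ ψ = refl
  down-⊕ u       (suc h) φ ψ = trans (cong (a (suc h) ⊗_) (pathD-⊕ u h φ ψ))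
                                     (ℤₚ.*-distribˡ-+ (a (suc h)) (pathD u h φ) (pathD u h ψ))

  private
    ⊗-distrib₃ : ∀ c x y z → c ⊗ x ⊕ c ⊗ y ⊕ c ⊗ z ≡ c ⊗ (x ⊕ y ⊕ z)
    ⊗-distrib₃ = solve-∀
    ⊗-swap : ∀ b c x → b ⊗ (c ⊗ x) ≡ c ⊗ (b ⊗ x)
    ⊗-swap = solve-∀

  stop-⊗ : ∀ u h c φ → stop u h (λ v → c ⊗ φ v) ≡ c ⊗ stop u h φ
  stop-⊗ zero    zero    c φ = refl
  stop-⊗ zero    (suc h) c φ = sym (ℤₚ.*-zeroʳ c)
  stop-⊗ (suc u) h       c φ = sym (ℤₚ.*-zeroʳ c)

  path-⊗  : ∀ u h c φ → path u h (λ v → c ⊗ φ v) ≡ c ⊗ path u h φ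
  pathD-⊗ : ∀ u h c φ → pathD u h (λ v → c ⊗ φ v) ≡ c ⊗ pathD u h φ
  up-⊗    : ∀ u h c φ → up u h (λ v → c ⊗ φ v) ≡ c ⊗ up u h φ
  down-⊗  : ∀ u h c φ → down u h (λ v → c ⊗ φ v) ≡ c ⊗ down u h φ
  path-⊗  u h c φ = trans (⊕-cong₃ (stop-⊗ u h c φ) (up-⊗ u h c φ) (down-⊗ u h c φ))
    (⊗-distrib₃ c (stop u h φ) (up u h φ) (down u h φ))
  pathD-⊗ u h c φ = trans (⊕-cong₃ (stop-⊗ u h c φ) (up-⊗ u h c (φ ∘ suc)) (down-⊗ u h c φ))
    (⊗-distrib₃ c (stop u h φ) (up u h (φ ∘ suc)) (down u h φ))
  up-⊗   zero    h       c φ = sym (ℤₚ.*-zeroʳ c)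
  up-⊗   (suc u) h       c φ = path-⊗ u (suc h) c φ
  down-⊗ u       zero    c φ = sym (ℤₚ.*-zeroʳ c)
  down-⊗ u       (suc h) c φ = trans (cong (a (suc h) ⊗_) (pathD-⊗ u h c φ)) (⊗-swap (a (suc h)) c (pathD u h φ))

  path-zero : ∀ u h {φ} → (∀ v → v ≤ u → φ v ≡ 0ℤ) → path u h φ ≡ 0ℤ
  path-zero u h {φ} e = trans (path-cong u h {φ} {λ v → 0ℤ ⊗ φ v} e) (path-⊗ u h 0ℤ φ)

  path-∑ : ∀ u h {A : Set} (xs : List A) (F : A → ℕ → ℤ) →
           path u h (λ v → ∑ xs (λ x → F x v)) ≡ ∑ xs (λ x → path u h (F x))
  path-∑ u h []       F = path-zero u h (λ _ _ → refl)
  path-∑ u h (x ∷ xs) F = trans (path-⊕ u h (F x) (λ v → ∑ xs (λ y → F y v)))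
                                (cong (path u h (F x) ⊕_) (path-∑ u h xs F))

  up-zero : ∀ u h {φ} → (∀ v → v < u → φ v ≡ 0ℤ) → up u h φ ≡ 0ℤ
  up-zero zero    h e = refl
  up-zero (suc u) h e = path-zero u (suc h) (λ v v≤u → e v (s≤s v≤u))

  private
    move-last : ∀ s x y d → s ⊕ (x ⊕ y) ⊕ d ≡ s ⊕ x ⊕ d ⊕ y
    move-last = solve-∀

  -- `path` and `pathD` treat only an initial up step differently, so a difference equation for φ
  -- becomes a correction by the paths that begin with an up step. It is applied with Pascal's rule
  -- as the difference equation, as is `path-pathD` for decreasing φ.
  pathD-path : ∀ u h {φ ψ} → (∀ v → φ (suc v) ≡ φ v ⊕ ψ v) → pathD u h φ ≡ path u h φ ⊕ up u h ψ
  pathD-path u h {φ} {ψ} e = trans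
    (cong (λ x → stop u h φ ⊕ x ⊕ down u h φ) (trans (up-cong u h (λ v _ → e v)) (up-⊕ u h φ ψ)))
    (move-last (stop u h φ) (up u h φ) (up u h ψ) (down u h φ))

  path-pathD : ∀ u h {φ ψ} → (∀ v → φ v ≡ φ (suc v) ⊕ ψ v) → path u h φ ≡ pathD u h φ ⊕ up u h ψ
  path-pathD u h {φ} {ψ} e = trans
    (cong (λ x → stop u h φ ⊕ x ⊕ down u h φ) (trans (up-cong u h (λ v _ → e v)) (up-⊕ u h (φ ∘ suc) ψ)))
    (move-last (stop u h φ) (up u h (φ ∘ suc)) (up u h ψ) (down u h φ))

  -- n elements of a set partition remain to be read, κ of them block minima, and h open blocks are to be continued.
  Z Zopen Znew Zold : ℕ → ℕ → ℕ → ℤ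
  Z zero    zero    zero    = 1ℤ
  Z zero    zero    (suc h) = 0ℤ
  Z zero    (suc κ) h       = 0ℤ
  Z (suc n) κ       h       = (Zopen n κ h ⊕ Znew n κ h) ⊕ Zold n κ h
  Zopen n zero    h = 0ℤ
  Zopen n (suc κ) h = Z n κ (suc h)
  Znew n zero    h = 0ℤ
  Znew n (suc κ) h = Z n κ h
  Zold n κ zero    = 0ℤ
  Zold n κ (suc h) = a (suc h) ⊗ (Z n κ (suc h) ⊕ Z n κ h)

  -- Each block minimum still to come and each open block to be continued claims an element of its
  -- own.
  Z-zero : ∀ n κ h → n < κ + h → Z n κ h ≡ 0ℤ
  Z-zero zero    zero    (suc h) lt = refl
  Z-zero zero    (suc κ) h       lt = refl
  Z-zero (suc n) κ       h       lt = ⊕-cong₃ (opened κ lt) (new κ lt) (old h lt)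
    where
    opened : ∀ κ → suc n < κ + h → Zopen n κ h ≡ 0ℤ
    opened zero    lt       = refl
    opened (suc κ) (s≤s lt) = Z-zero n κ (suc h) (ℕₚ.<-trans lt (ℕₚ.+-monoʳ-< κ (ℕₚ.n<1+n h)))
    new : ∀ κ → suc n < κ + h → Znew n κ h ≡ 0ℤ
    new zero    lt       = refl
    new (suc κ) (s≤s lt) = Z-zero n κ h lt
    old : ∀ h → suc n < κ + h → Zold n κ h ≡ 0ℤ
    old zero    lt = refl
    old (suc h) lt = trans
      (cong₂ (λ x y → a (suc h) ⊗ (x ⊕ y)) (Z-zero n κ (suc h) (ℕₚ.<-trans (ℕₚ.n<1+n n) lt))
                                           (Z-zero n κ h (ℕₚ.≤-pred (subst (suc n <_) (ℕₚ.+-suc κ h) lt))))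
      (ℤₚ.*-zeroʳ (a (suc h)))

  -- The u + h elements that are not minima end arcs and give the down steps. As h of these arcs are
  -- already open, u arcs start among the n elements and give the up steps, 2u + h steps in all.
  Z-claim : ℕ → Set
  Z-claim n = ∀ κ u h → n ≡ κ + u + h → Z n κ h ≡ path u h (λ v → binom (n + v) (u + u + h))

  Znew-path : ∀ {n} → Z-claim n → ∀ κ u h ℓ → suc ℓ ≡ u + u + h → suc n ≡ κ + u + h →
              Znew n κ h ≡ path u h (λ v → binom (n + v) (suc ℓ))
  Znew-path {n} IH zero u h ℓ eℓ en = sym (path-zero u h (λ v v≤u → binom-> (small v v≤u)))
    where
    small : ∀ v → v ≤ u → n + v < suc ℓ
    small v v≤u = subst (n + v <_) (trans (cong (_+ u) en) (trans (arith u h) (sym eℓ))) (s≤s (ℕₚ.+-monoʳ-≤ n v≤u))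
      where
      arith : ∀ u h → u + h + u ≡ u + u + h
      arith = solveℕ-∀
  Znew-path {n} IH (suc κ) u h ℓ eℓ en = trans (IH κ u h (ℕₚ.suc-injective en))
    (path-cong u h (λ v _ → cong (binom (n + v)) (sym eℓ)))

  Zopen-path : ∀ {n} → Z-claim n → ∀ κ u h ℓ → suc ℓ ≡ u + u + h → suc n ≡ κ + u + h →
               Zopen n κ h ≡ up u h (λ v → binom (n + v) ℓ)
  Zopen-path {n} IH zero u h ℓ eℓ en = sym (up-zero u h (λ v v<u → binom-> (small v v<u)))
    where
    small : ∀ v → v < u → n + v < ℓ
    small v v<u = ℕₚ.≤-pred (subst (suc n + v <_) (trans (cong (_+ u) en) (trans (arith u h) (sym eℓ))) (ℕₚ.+-monoʳ-< (suc n) v<u))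
      where
      arith : ∀ u h → u + h + u ≡ u + u + h
      arith = solveℕ-∀
  Zopen-path {n} IH (suc κ) zero h ℓ eℓ en =
    Z-zero n κ (suc h) (subst (_< κ + suc h) (trans (cong (_+ h) (sym (ℕₚ.+-identityʳ κ))) (sym (ℕₚ.suc-injective en)))
                              (ℕₚ.+-monoʳ-< κ (ℕₚ.n<1+n h)))
  Zopen-path {n} IH (suc κ) (suc u) h ℓ eℓ en =
    trans (IH κ u (suc h) (trans (ℕₚ.suc-injective en) (arith₁ κ u h)))
          (path-cong u (suc h) (λ v _ → cong (binom (n + v)) (trans (arith₂ u h) (sym (ℕₚ.suc-injective eℓ)))))
    where
    arith₁ : ∀ κ u h → κ + suc u + h ≡ κ + u + suc h
    arith₁ = solveℕ-∀
    arith₂ : ∀ u h → u + u + suc h ≡ u + suc u + h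
    arith₂ = solveℕ-∀

  -- The continued block stays open (the piece DU) or is closed (the piece D). The first case is a
  -- correction by paths with an initial up step, and Pascal's rule absorbs it into the valley shift
  -- of `pathD`.
  Zold-path : ∀ {n} → Z-claim n → ∀ κ u h ℓ → suc ℓ ≡ u + u + h → suc n ≡ κ + u + h →
              Zold n κ h ≡ down u h (λ v → binom (n + v) ℓ)
  Zold-path {n} IH κ u zero    ℓ eℓ en = refl
  Zold-path {n} IH κ u (suc h) ℓ eℓ en = cong (a (suc h) ⊗_) (split u eℓ en)
    where
    predecessor : ∀ {x} y z → suc x ≡ y + suc z → x ≡ y + z
    predecessor y z e = ℕₚ.suc-injective (trans e (ℕₚ.+-suc y z))
    split : ∀ u → suc ℓ ≡ u + u + suc h → suc n ≡ κ + u + suc h →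
            Z n κ (suc h) ⊕ Z n κ h ≡ pathD u h (λ v → binom (n + v) ℓ)
    split zero eℓ en = begin
      Z n κ (suc h) ⊕ Z n κ h
        ≡⟨ cong₂ _⊕_ (Z-zero n κ (suc h) (ℕₚ.≤-reflexive (trans en (cong (_+ suc h) (ℕₚ.+-identityʳ κ)))))
                     (IH κ 0 h (predecessor (κ + 0) h en)) ⟩
      0ℤ ⊕ path 0 h (λ v → binom (n + v) h)
        ≡⟨ ℤₚ.+-identityˡ _ ⟩
      pathD 0 h (λ v → binom (n + v) h)
        ≡⟨ cong (λ x → pathD 0 h (λ v → binom (n + v) x)) (ℕₚ.suc-injective eℓ) ⟨
      pathD 0 h (λ v → binom (n + v) ℓ) ∎
    split (suc u) eℓ en = begin
      Z n κ (suc h) ⊕ Z n κ h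
        ≡⟨ cong₂ _⊕_ (IH κ u (suc h) (predecessor (κ + u) (suc h) (trans en (arith₁ κ u h))))
                     (IH κ (suc u) h (predecessor (κ + suc u) h en)) ⟩
      path u (suc h) (λ v → binom (n + v) (u + u + suc h)) ⊕ path (suc u) h (λ v → binom (n + v) (suc ℓ′))
        ≡⟨ ℤₚ.+-comm _ (path (suc u) h (λ v → binom (n + v) (suc ℓ′))) ⟩
      path (suc u) h (λ v → binom (n + v) (suc ℓ′)) ⊕ path u (suc h) (λ v → binom (n + v) (u + u + suc h))
        ≡⟨ cong (λ x → path (suc u) h (λ v → binom (n + v) (suc ℓ′)) ⊕ path u (suc h) (λ v → binom (n + v) x)) (arith₂ u h) ⟩
      path (suc u) h (λ v → binom (n + v) (suc ℓ′)) ⊕ path u (suc h) (λ v → binom (n + v) ℓ′)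
        ≡⟨ pathD-path (suc u) h Pascal ⟨
      pathD (suc u) h (λ v → binom (n + v) (suc ℓ′))
        ≡⟨ cong (λ x → pathD (suc u) h (λ v → binom (n + v) x)) (predecessor (suc u + suc u) h eℓ) ⟨
      pathD (suc u) h (λ v → binom (n + v) ℓ) ∎
      where
      ℓ′ = u + suc u + h
      arith₁ : ∀ κ u h → κ + suc u + suc h ≡ κ + u + suc (suc h)
      arith₁ = solveℕ-∀
      arith₂ : ∀ u h → u + u + suc h ≡ u + suc u + h
      arith₂ = solveℕ-∀
      Pascal : ∀ v → binom (n + suc v) (suc ℓ′) ≡ binom (n + v) (suc ℓ′) ⊕ binom (n + v) ℓ′
      Pascal v = trans (cong (λ x → binom x (suc ℓ′)) (ℕₚ.+-suc n v))
                   (trans (binom-Pascal (n + v) ℓ′) (ℤₚ.+-comm (binom (n + v) ℓ′) (binom (n + v) (suc ℓ′))))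

  -- An empty first piece keeps the lower index ℓ + 1, a nonempty one lowers it to ℓ at its first
  -- step; Pascal's rule joins the two. The hypothesis on `stop` expresses that at least one step is
  -- left, in a form that holds by computation once u and h are split.
  Z-step : ∀ {n} → Z-claim n → ∀ κ u h ℓ → suc ℓ ≡ u + u + h → suc n ≡ κ + u + h →
           (∀ φ → stop u h φ ≡ 0ℤ) → Z (suc n) κ h ≡ path u h (λ v → binom (suc n + v) (u + u + h))
  Z-step {n} IH κ u h ℓ eℓ en no-stop = begin
    Zopen n κ h ⊕ Znew n κ h ⊕ Zold n κ h
      ≡⟨ ⊕-cong₃ (Zopen-path IH κ u h ℓ eℓ en) (Znew-path IH κ u h ℓ eℓ en) (Zold-path IH κ u h ℓ eℓ en) ⟩
    up u h low ⊕ path u h high ⊕ down u h low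
      ≡⟨ regroup′ (up u h low) (path u h high) (down u h low) ⟩
    (0ℤ ⊕ up u h low ⊕ down u h low) ⊕ path u h high
      ≡⟨ cong (λ x → (x ⊕ up u h low ⊕ down u h low) ⊕ path u h high) (no-stop low) ⟨
    path u h low ⊕ path u h high
      ≡⟨ path-⊕ u h low high ⟨
    path u h (λ v → low v ⊕ high v)
      ≡⟨ path-cong u h (λ v _ → binom-Pascal (n + v) ℓ) ⟨
    path u h (λ v → binom (suc n + v) (suc ℓ))
      ≡⟨ cong (λ x → path u h (λ v → binom (suc n + v) x)) eℓ ⟩
    path u h (λ v → binom (suc n + v) (u + u + h)) ∎
    where
    low high : ℕ → ℤ
    low  v = binom (n + v) ℓ
    high v = binom (n + v) (suc ℓ)
    regroup′ : ∀ x y z → x ⊕ y ⊕ z ≡ (0ℤ ⊕ x ⊕ z) ⊕ y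
    regroup′ = solve-∀

  -- C(n + v, 2u + h) counts the ways to cut a suffix with v valleys into n possibly empty pieces ∅, D, U, DU.
  Z-path : ∀ n → Z-claim n
  Z-path zero    zero    zero    zero    eq = refl
  Z-path zero    zero    zero    (suc h) ()
  Z-path zero    zero    (suc u) h       ()
  Z-path zero    (suc κ) u       h       ()
  Z-path (suc n) κ       zero    zero    eq with trans eq (trans (ℕₚ.+-identityʳ _) (ℕₚ.+-identityʳ κ))
  ... | refl = cong₂ (λ x y → x ⊕ y ⊕ 0ℤ) (Z-zero n n 1 (ℕₚ.≤-reflexive (ℕₚ.+-comm 1 n)))
                 (Z-path n n zero zero (sym (trans (ℕₚ.+-identityʳ _) (ℕₚ.+-identityʳ n))))
  Z-path (suc n) κ       zero    (suc h) eq = Z-step (Z-path n) κ zero (suc h) h refl eq (λ _ → refl)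
  Z-path (suc n) κ       (suc u) h       eq = Z-step (Z-path n) κ (suc u) h (u + suc u + h) refl eq (λ _ → refl)

  -- The reading of a permutation from right to left after j records, when h values below the last record and
  -- e values above it are left and k records are wanted. In Xrec the next value is a
  -- record, and the values that it skips are moved below it one at a time.
  module Records (k : ℕ) where

    Xstop X Xrec Xdown : ℕ → ℕ → ℕ → ℤ
    Xstop j zero    zero    = if j ≡ᵇ k then 1ℤ else 0ℤ
    Xstop j zero    (suc h) = 0ℤ
    Xstop j (suc e) h       = 0ℤ
    X j e h = Xstop j e h ⊕ Xrec (suc j) e h ⊕ Xdown j e h
    Xrec j zero    h = 0ℤ
    Xrec j (suc e) h = X j e h ⊕ Xrec j e (suc h)
    Xdown j e zero    = 0ℤ
    Xdown j e (suc h) = a (suc h) ⊗ X j e h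

    -- The final number of records lies between j and j + e. In `Xrec` the coming record is counted
    -- in j while its value is still counted in e, hence the weak inequality there.
    X-zero    : ∀ j e h → e + j < k ⊎ k < j → X j e h ≡ 0ℤ
    Xrec-zero : ∀ j e h → e + j ≤ k ⊎ k < j → Xrec j e h ≡ 0ℤ
    Xdown-zero : ∀ j e h → e + j < k ⊎ k < j → Xdown j e h ≡ 0ℤ
    X-zero j e h c = ⊕-cong₃ (stop-zero e h c) (Xrec-zero (suc j) e h (weaken c)) (Xdown-zero j e h c)
      where
      stop-zero : ∀ e h → e + j < k ⊎ k < j → Xstop j e h ≡ 0ℤ
      stop-zero zero    zero    c = cong (λ b → if b then 1ℤ else 0ℤ) (≢⇒≡ᵇ-false (apart c))
        where
        apart : j < k ⊎ k < j → j ≢ k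
        apart (inj₁ j<k) = ℕₚ.<⇒≢ j<k
        apart (inj₂ k<j) = ℕₚ.<⇒≢ k<j ∘ sym
      stop-zero zero    (suc h) c = refl
      stop-zero (suc e) h       c = refl
      weaken : e + j < k ⊎ k < j → e + suc j ≤ k ⊎ k < suc j
      weaken (inj₁ lt) = inj₁ (subst (_≤ k) (sym (ℕₚ.+-suc e j)) lt)
      weaken (inj₂ lt) = inj₂ (ℕₚ.<-trans lt (ℕₚ.n<1+n j))
    Xrec-zero j zero    h c         = refl
    Xrec-zero j (suc e) h (inj₁ lt) = cong₂ _⊕_ (X-zero j e h (inj₁ lt)) (Xrec-zero j e (suc h) (inj₁ (ℕₚ.<⇒≤ lt)))
    Xrec-zero j (suc e) h (inj₂ lt) = cong₂ _⊕_ (X-zero j e h (inj₂ lt)) (Xrec-zero j e (suc h) (inj₂ lt))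
    Xdown-zero j e zero    c = refl
    Xdown-zero j e (suc h) c = trans (cong (a (suc h) ⊗_) (X-zero j e h c)) (ℤₚ.*-zeroʳ (a (suc h)))

    -- multichoose κ ρ (2u + h) counts the ways to place κ records among the steps of a suffix so that one
    -- precedes each of its ρ maximal runs of up steps.
    X-path     : ∀ κ u h j → j + κ ≡ k → X j (κ + u) h ≡ pathD u h (λ ρ → multichoose κ ρ (u + u + h))
    Xrec-path  : ∀ κ u h j → j + κ ≡ k → Xrec j (suc (κ + u)) h ≡ path u h (λ ρ → multichoose κ ρ (u + u + h))
    Xdown-path : ∀ κ u h j ℓ → j + κ ≡ k → suc ℓ ≡ u + u + h → Xdown j (κ + u) h ≡ down u h (λ ρ → multichoose κ ρ ℓ)

    Xdown-path κ u zero    j ℓ eq eℓ = refl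
    Xdown-path κ u (suc h) j ℓ eq eℓ = cong (a (suc h) ⊗_) (trans (X-path κ u h j eq)
      (cong (λ x → pathD u h (λ ρ → multichoose κ ρ x)) (ℕₚ.suc-injective (trans (sym (ℕₚ.+-suc (u + u) h)) (sym eℓ)))))

    X-path zero u h j eq = ⊕-cong₃ (stopped u h) (trans no-record (sym (up-zero u h (λ _ _ → refl)))) (descended h)
      where
      j≡k : j ≡ k
      j≡k = trans (sym (ℕₚ.+-identityʳ j)) eq
      stopped : ∀ u h → Xstop j u h ≡ stop u h (λ ρ → multichoose 0 ρ (u + u + h))
      stopped zero    zero    = cong (λ b → if b then 1ℤ else 0ℤ) (trans (cong (_≡ᵇ k) j≡k) (≡ᵇ-refl k))
      stopped zero    (suc h) = refl
      stopped (suc u) h       = refl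
      no-record : Xrec (suc j) u h ≡ 0ℤ
      no-record = Xrec-zero (suc j) u h (inj₂ (ℕₚ.≤-reflexive (cong suc (sym j≡k))))
      -- With no record left to place only the empty multiset remains, so the change of ℓ caused by
      -- a down step has no effect.
      no-choice : ∀ ρ ℓ ℓ′ → multichoose 0 ρ ℓ ≡ multichoose 0 ρ ℓ′
      no-choice zero    ℓ ℓ′ = cong ℤ.+_ (trans (nCn≡1 ℓ) (sym (nCn≡1 ℓ′)))
      no-choice (suc ρ) ℓ ℓ′ = refl
      descended : ∀ h → Xdown j u h ≡ down u h (λ ρ → multichoose 0 ρ (u + u + h))
      descended zero    = refl
      descended (suc h) = cong (a (suc h) ⊗_)
        (trans (X-path zero u h j eq) (pathD-cong u h (λ ρ _ → no-choice ρ (u + u + h) (u + u + suc h))))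
    X-path (suc κ) u h j eq = trans
      (cong (λ x → 0ℤ ⊕ x ⊕ Xdown j (suc κ + u) h) (Xrec-path κ u h (suc j) (trans (sym (ℕₚ.+-suc j κ)) eq)))
      (finish u h (Xdown-path (suc κ) u h j))
      where
      shape : ∀ u h ℓ → suc ℓ ≡ u + u + h → (∀ φ → stop u h φ ≡ 0ℤ) →
              0ℤ ⊕ path u h (λ ρ → multichoose κ ρ (u + u + h)) ⊕ down u h (λ ρ → multichoose (suc κ) ρ ℓ)
              ≡ pathD u h (λ ρ → multichoose (suc κ) ρ (u + u + h))
      shape u h ℓ eℓ no-stop = begin
        0ℤ ⊕ path u h (φ κ (u + u + h)) ⊕ down u h (φ (suc κ) ℓ)
          ≡⟨ cong (λ x → 0ℤ ⊕ path u h (φ κ x) ⊕ down u h (φ (suc κ) ℓ)) eℓ ⟨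
        0ℤ ⊕ path u h (φ κ (suc ℓ)) ⊕ down u h (φ (suc κ) ℓ)
          -- The record just placed serves an initial run of up steps, which is why `path` stands
          -- here. Since `φ (suc κ) ℓ (suc ρ)` computes to `φ κ ℓ ρ`, the correction
          -- `up u h (φ κ ℓ)` is at the same time the up part of `pathD u h (φ (suc κ) ℓ)`.
          ≡⟨ cong (λ x → 0ℤ ⊕ x ⊕ down u h (φ (suc κ) ℓ)) (path-pathD u h (λ ρ → multichoose-Pascal κ (suc ρ) ℓ)) ⟩
        0ℤ ⊕ (pathD u h (φ κ (suc ℓ)) ⊕ up u h (φ κ ℓ)) ⊕ down u h (φ (suc κ) ℓ)
          ≡⟨ regroup′ (pathD u h (φ κ (suc ℓ))) (up u h (φ κ ℓ)) (down u h (φ (suc κ) ℓ)) ⟩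
        pathD u h (φ κ (suc ℓ)) ⊕ (0ℤ ⊕ up u h (φ κ ℓ) ⊕ down u h (φ (suc κ) ℓ))
          ≡⟨ cong (λ x → pathD u h (φ κ (suc ℓ)) ⊕ (x ⊕ up u h (φ κ ℓ) ⊕ down u h (φ (suc κ) ℓ))) (no-stop (φ (suc κ) ℓ)) ⟨
        pathD u h (φ κ (suc ℓ)) ⊕ pathD u h (φ (suc κ) ℓ)
          ≡⟨ pathD-⊕ u h (φ κ (suc ℓ)) (φ (suc κ) ℓ) ⟨
        pathD u h (λ ρ → φ κ (suc ℓ) ρ ⊕ φ (suc κ) ℓ ρ)
          ≡⟨ pathD-cong u h (λ ρ _ → multichoose-Pascal κ ρ ℓ) ⟨
        pathD u h (φ (suc κ) (suc ℓ))
          ≡⟨ cong (λ x → pathD u h (φ (suc κ) x)) eℓ ⟩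
        pathD u h (φ (suc κ) (u + u + h)) ∎
        where
        φ : ℕ → ℕ → ℕ → ℤ
        φ κ ℓ ρ = multichoose κ ρ ℓ
        regroup′ : ∀ x y z → 0ℤ ⊕ (x ⊕ y) ⊕ z ≡ x ⊕ (0ℤ ⊕ y ⊕ z)
        regroup′ = solve-∀
      finish : ∀ u h → (∀ ℓ → j + suc κ ≡ k → suc ℓ ≡ u + u + h → Xdown j (suc κ + u) h ≡ down u h (λ ρ → multichoose (suc κ) ρ ℓ)) →
               0ℤ ⊕ path u h (λ ρ → multichoose κ ρ (u + u + h)) ⊕ Xdown j (suc κ + u) h
               ≡ pathD u h (λ ρ → multichoose (suc κ) ρ (u + u + h))
      finish zero    zero    d = refl
      finish zero    (suc h) d = trans (cong (0ℤ ⊕ path 0 (suc h) (λ ρ → multichoose κ ρ (suc h)) ⊕_) (d h eq refl))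
                                       (shape zero (suc h) h refl (λ _ → refl))
      finish (suc u) h       d = trans (cong (0ℤ ⊕ path (suc u) h (λ ρ → multichoose κ ρ (suc u + suc u + h)) ⊕_) (d (u + suc u + h) eq refl))
                                       (shape (suc u) h (u + suc u + h) refl (λ _ → refl))

    Xrec-path κ zero    h j eq = begin
      X j (κ + 0) h ⊕ Xrec j (κ + 0) (suc h)
        ≡⟨ cong₂ _⊕_ (X-path κ zero h j eq) (Xrec-zero j (κ + 0) (suc h) (inj₁ (ℕₚ.≤-reflexive (trans (cong (_+ j) (ℕₚ.+-identityʳ κ)) (trans (ℕₚ.+-comm κ j) eq))))) ⟩
      pathD 0 h (λ ρ → multichoose κ ρ h) ⊕ 0ℤ
        ≡⟨ ℤₚ.+-identityʳ _ ⟩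
      path 0 h (λ ρ → multichoose κ ρ h) ∎
    Xrec-path κ (suc u) h j eq = begin
      X j (κ + suc u) h ⊕ Xrec j (κ + suc u) (suc h)
        ≡⟨ cong₂ _⊕_ (X-path κ (suc u) h j eq) (trans (cong (λ x → Xrec j x (suc h)) (ℕₚ.+-suc κ u)) (Xrec-path κ u (suc h) j eq)) ⟩
      pathD (suc u) h (λ ρ → multichoose κ ρ (suc ℓ)) ⊕ path u (suc h) (λ ρ → multichoose κ ρ (u + u + suc h))
        ≡⟨ cong (λ x → pathD (suc u) h (λ ρ → multichoose κ ρ (suc ℓ)) ⊕ path u (suc h) (λ ρ → multichoose κ ρ x)) (arith u h) ⟩
      pathD (suc u) h (λ ρ → multichoose κ ρ (suc ℓ)) ⊕ up (suc u) h (λ ρ → multichoose κ ρ ℓ)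
        ≡⟨ path-pathD (suc u) h (λ ρ → multichoose-Pascal κ (suc ρ) ℓ) ⟨
      path (suc u) h (λ ρ → multichoose κ ρ (suc ℓ)) ∎
      where
      ℓ = u + suc u + h
      arith : ∀ u h → u + u + suc h ≡ u + suc u + h
      arith = solveℕ-∀

  open Records

  private
    ground : ∀ x → 0ℤ ⊕ x ⊕ 0ℤ ≡ x
    ground = solve-∀

  -- At height 0 only an up step is possible. Removing it sharpens the bound on the valleys to v ≤ u
  -- for semilength u + 1, as the interpolation requires.
  path-ground : ∀ u φ → path (suc u) 0 φ ≡ path u 1 φ
  path-ground u φ = ground (path u 1 φ)

  -- By linearity of `path` the identity is needed only for a fixed number of valleys, where it is
  -- the interpolation formula. That formula has k = κ + 1 and m ≥ 1. For k = 0 < m the left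
  -- binomial coefficients have too small a top because v < m, and so does the first coefficient of
  -- each term on the right.
  duality : ∀ k m → Z (k + m) k 0 ≡ sgn m ⊗ ∑ (upTo (suc m)) (λ j →
    sgn j ⊗ binom (k + m ∸ 1 + j) (m + j) ⊗ binom (2 * (k + m) ∸ k) (m ∸ j) ⊗ X j 0 (m + j) 0)
  duality k       zero    = trans (Z-path (k + 0) k 0 0 (sym (ℕₚ.+-identityʳ (k + 0)))) refl
  duality zero    (suc m) = begin
    Z (suc m) 0 0
      ≡⟨ trans (Z-path (suc m) 0 (suc m) 0 (sym (ℕₚ.+-identityʳ (suc m)))) (path-ground m (λ v → binom (suc m + v) (suc m + suc m + 0))) ⟩
    path m 1 (λ v → binom (suc m + v) (suc m + suc m + 0))
      ≡⟨ path-zero m 1 (λ v v≤m → binom-> (subst (suc m + v <_) (sym (ℕₚ.+-identityʳ (suc m + suc m))) (ℕₚ.+-monoʳ-< (suc m) (s≤s v≤m)))) ⟩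
    0ℤ
      ≡⟨ ℤₚ.*-zeroʳ (sgn (suc m)) ⟨
    sgn (suc m) ⊗ 0ℤ
      ≡⟨ cong (sgn (suc m) ⊗_) (∑-zero (upTo (2 + m)) no-term) ⟨
    _ ∎
    where
    no-term : ∀ j → sgn j ⊗ binom (m + j) (suc m + j) ⊗ binom (2 * suc m) (suc m ∸ j) ⊗ X j 0 (suc m + j) 0 ≡ 0ℤ
    no-term j = begin
      sgn j ⊗ binom (m + j) (suc m + j) ⊗ b ⊗ x  ≡⟨ cong (λ c → sgn j ⊗ c ⊗ b ⊗ x) (binom-> (ℕₚ.n<1+n (m + j))) ⟩
      sgn j ⊗ 0ℤ ⊗ b ⊗ x                         ≡⟨ annihilate (sgn j) b x ⟩
      0ℤ                                         ∎
      where
      b = binom (2 * suc m) (suc m ∸ j)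
      x = X j 0 (suc m + j) 0
      annihilate : ∀ s b x → s ⊗ 0ℤ ⊗ b ⊗ x ≡ 0ℤ
      annihilate = solve-∀
  duality (suc κ) (suc m) = begin
    Z (suc κ + suc m) (suc κ) 0
      ≡⟨ trans (Z-path (suc κ + suc m) (suc κ) (suc m) 0 (sym (ℕₚ.+-identityʳ (suc κ + suc m)))) (path-ground m (λ v → binom (suc κ + suc m + v) (suc m + suc m + 0))) ⟩
    path m 1 (λ v → binom (suc κ + suc m + v) (suc m + suc m + 0))
      ≡⟨ path-cong m 1 interpolate ⟩
    path m 1 (λ v → sgn (suc m) ⊗ ∑ (upTo (2 + m)) (λ j → coefficient j ⊗ multichoose j (suc v) ℓ))
      ≡⟨ path-⊗ m 1 (sgn (suc m)) (λ v → ∑ (upTo (2 + m)) (λ j → coefficient j ⊗ multichoose j (suc v) ℓ)) ⟩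
    sgn (suc m) ⊗ path m 1 (λ v → ∑ (upTo (2 + m)) (λ j → coefficient j ⊗ multichoose j (suc v) ℓ))
      ≡⟨ cong (sgn (suc m) ⊗_) (path-∑ m 1 (upTo (2 + m)) (λ j v → coefficient j ⊗ multichoose j (suc v) ℓ)) ⟩
    sgn (suc m) ⊗ ∑ (upTo (2 + m)) (λ j → path m 1 (λ v → coefficient j ⊗ multichoose j (suc v) ℓ))
      ≡⟨ cong (sgn (suc m) ⊗_) (∑-cong (upTo (2 + m)) each) ⟩
    sgn (suc m) ⊗ ∑ (upTo (2 + m)) (λ j → coefficient j ⊗ X j 0 (suc m + j) 0) ∎
    where
    ℓ = suc m + suc m
    coefficient : ℕ → ℤ
    coefficient j = sgn j ⊗ binom (κ + suc m + j) (suc m + j) ⊗ binom (2 * (suc κ + suc m) ∸ suc κ) (suc m ∸ j)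
    top : 2 * (suc κ + suc m) ∸ suc κ ≡ suc (suc m + suc m + κ)
    top = trans (cong (_∸ suc κ) (arith κ m)) (ℕₚ.m+n∸n≡m (suc (suc m + suc m + κ)) (suc κ))
      where
      arith : ∀ κ m → 2 * (suc κ + suc m) ≡ suc (suc m + suc m + κ) + suc κ
      arith = solveℕ-∀
    interpolate : ∀ v → v ≤ m → binom (suc κ + suc m + v) (suc m + suc m + 0)
                                ≡ sgn (suc m) ⊗ ∑ (upTo (2 + m)) (λ j → coefficient j ⊗ multichoose j (suc v) ℓ)
    interpolate v v≤m = begin
      binom (suc κ + suc m + v) (suc m + suc m + 0)
        ≡⟨ cong₂ binom (sym (ℕₚ.+-suc (κ + suc m) v)) (ℕₚ.+-identityʳ ℓ) ⟩
      binom (κ + suc m + suc v) ℓ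
        -- The interpolation is taken with w = m ∸ v, and its semilength suc v + w is transported to
        -- suc m.
        ≡⟨ subst (λ x → binom (κ + suc x + suc v) (suc x + suc x) ≡ sgn (suc x) ⊗ ∑ (upTo (2 + x)) (λ j →
                   sgn j ⊗ binom (κ + suc x + j) (suc x + j) ⊗ binom (suc (suc x + suc x + κ)) (suc x ∸ j) ⊗ multichoose j (suc v) (suc x + suc x)))
                 (ℕₚ.m+[n∸m]≡n v≤m) (Interpolation.interpolation κ v (m ∸ v)) ⟩
      sgn (suc m) ⊗ ∑ (upTo (2 + m)) (λ j → sgn j ⊗ binom (κ + suc m + j) (suc m + j) ⊗ binom (suc (suc m + suc m + κ)) (suc m ∸ j) ⊗ multichoose j (suc v) ℓ)
        ≡⟨ cong (λ t → sgn (suc m) ⊗ ∑ (upTo (2 + m)) (λ j → sgn j ⊗ binom (κ + suc m + j) (suc m + j) ⊗ binom t (suc m ∸ j) ⊗ multichoose j (suc v) ℓ)) top ⟨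
      sgn (suc m) ⊗ ∑ (upTo (2 + m)) (λ j → coefficient j ⊗ multichoose j (suc v) ℓ) ∎
    each : ∀ j → path m 1 (λ v → coefficient j ⊗ multichoose j (suc v) ℓ) ≡ coefficient j ⊗ X j 0 (suc m + j) 0
    each j = begin
      path m 1 (λ v → coefficient j ⊗ multichoose j (suc v) ℓ)
        ≡⟨ path-⊗ m 1 (coefficient j) (λ v → multichoose j (suc v) ℓ) ⟩
      coefficient j ⊗ path m 1 (λ v → multichoose j (suc v) ℓ)
        ≡⟨ cong (λ t → coefficient j ⊗ path m 1 (λ v → multichoose j (suc v) t)) (ℕₚ.+-identityʳ ℓ) ⟨
      coefficient j ⊗ path m 1 (λ v → multichoose j (suc v) (ℓ + 0))
        ≡⟨ cong (coefficient j ⊗_) (ground (path m 1 (λ v → multichoose j (suc v) (ℓ + 0)))) ⟨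
      coefficient j ⊗ pathD (suc m) 0 (λ ρ → multichoose j ρ (ℓ + 0))
        ≡⟨ cong (coefficient j ⊗_) (trans (cong (λ e → X j 0 e 0) (ℕₚ.+-comm (suc m) j)) (X-path j j (suc m) 0 0 refl)) ⟨
      coefficient j ⊗ X j 0 (suc m + j) 0 ∎

-- Permutations

∑-words-suc : ∀ n m (f : List ℕ → ℤ) →
              ∑ (words (suc n) m) f ≡ ∑ (words n m) (λ w → ∑ (upTo m) (λ x → f (x ∷ w)))
∑-words-suc n m f = trans (∑-concatMap _ (words n m) f) (∑-cong (words n m) (λ w → ∑-map (_∷ w) (upTo m) f))

∑-words-cong : ∀ n m {f g : List ℕ → ℤ} → (∀ w → length w ≡ n → All (_< m) w → f w ≡ g w) →
               ∑ (words n m) f ≡ ∑ (words n m) g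
∑-words-cong zero    m e = cong (_⊕ 0ℤ) (e [] refl [])
∑-words-cong (suc n) m {f} {g} e = begin
  ∑ (words (suc n) m) f
    ≡⟨ ∑-words-suc n m f ⟩
  ∑ (words n m) (λ w → ∑ (upTo m) (λ x → f (x ∷ w)))
    ≡⟨ ∑-words-cong n m (λ w len bound → ∑-upTo-cong m (λ x x<m → e (x ∷ w) (cong suc len) (x<m ∷ bound))) ⟩
  ∑ (words n m) (λ w → ∑ (upTo m) (λ x → g (x ∷ w)))
    ≡⟨ ∑-words-suc n m g ⟨
  ∑ (words (suc n) m) g ∎

any<-suc : ∀ n p → any< (suc n) p ≡ p 0 ∨ any< n (p ∘ suc)
any<-suc n p = trans (cong (any p) (upTo-suc n)) (cong (λ xs → p 0 ∨ or xs) (sym (Listₚ.map-∘ (upTo n))))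

all<-suc : ∀ n p → all< (suc n) p ≡ p 0 ∧ all< n (p ∘ suc)
all<-suc n p = trans (cong (all p) (upTo-suc n)) (cong (λ xs → p 0 ∧ and xs) (sym (Listₚ.map-∘ (upTo n))))

all<-cong : ∀ n {p p′ : ℕ → Bool} → (∀ i → p i ≡ p′ i) → all< n p ≡ all< n p′
all<-cong n e = cong and (Listₚ.map-cong e (upTo n))

any<-at : ∀ w (p : ℕ → Bool) → any< (length w) (p ∘ at w) ≡ any p w
any<-at []      p = refl
any<-at (x ∷ w) p = trans (any<-suc (length w) (p ∘ at (x ∷ w))) (cong (p x ∨_) (any<-at w p))

all<-at : ∀ w (p : ℕ → Bool) → all< (length w) (p ∘ at w) ≡ all p w
all<-at []      p = refl
all<-at (x ∷ w) p = trans (all<-suc (length w) (p ∘ at (x ∷ w))) (cong (p x ∧_) (all<-at w p))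

sum< : ℕ → (ℕ → ℕ) → ℕ
sum< n f = foldr _+_ 0 (map f (upTo n))

sum<-suc : ∀ n f → sum< (suc n) f ≡ f 0 + sum< n (f ∘ suc)
sum<-suc n f = trans (cong (λ xs → foldr _+_ 0 (map f xs)) (upTo-suc n))
                     (cong (λ xs → f 0 + foldr _+_ 0 xs) (sym (Listₚ.map-∘ (upTo n))))

sum<-cong : ∀ n {f g : ℕ → ℕ} → (∀ i → f i ≡ g i) → sum< n f ≡ sum< n g
sum<-cong n e = cong (foldr _+_ 0) (Listₚ.map-cong e (upTo n))

sum<-zero : ∀ n {f : ℕ → ℕ} → (∀ i → f i ≡ 0) → sum< n f ≡ 0
sum<-zero zero    e = refl
sum<-zero (suc n) {f} e = trans (sum<-suc n f) (cong₂ _+_ (e 0) (sum<-zero n (e ∘ suc)))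

+-interchange : ∀ a b c d → (a + b) + (c + d) ≡ (a + c) + (b + d)
+-interchange = solveℕ-∀

sum<-+ : ∀ n f g → sum< n (λ i → f i + g i) ≡ sum< n f + sum< n g
sum<-+ zero    f g = refl
sum<-+ (suc n) f g = begin
  sum< (suc n) (λ i → f i + g i)                                     ≡⟨ sum<-suc n (λ i → f i + g i) ⟩
  f 0 + g 0 + sum< n (λ i → f (suc i) + g (suc i))                   ≡⟨ cong ((f 0 + g 0) +_) (sum<-+ n (f ∘ suc) (g ∘ suc)) ⟩
  f 0 + g 0 + (sum< n (f ∘ suc) + sum< n (g ∘ suc))                  ≡⟨ +-interchange (f 0) (g 0) _ _ ⟩
  (f 0 + sum< n (f ∘ suc)) + (g 0 + sum< n (g ∘ suc))                ≡⟨ cong₂ _+_ (sum<-suc n f) (sum<-suc n g) ⟨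
  sum< (suc n) f + sum< (suc n) g                                    ∎

𝟙 : Bool → ℕ
𝟙 b = if b then 1 else 0

length-filterᵇ : ∀ (p : A → Bool) xs → length (filterᵇ p xs) ≡ foldr _+_ 0 (map (𝟙 ∘ p) xs)
length-filterᵇ p []       = refl
length-filterᵇ p (x ∷ xs) with p x
... | true  = cong suc (length-filterᵇ p xs)
... | false = length-filterᵇ p xs

count<-sum< : ∀ n p → count< n p ≡ sum< n (𝟙 ∘ p)
count<-sum< n p = length-filterᵇ p (upTo n)

count<-suc : ∀ n p → count< (suc n) p ≡ 𝟙 (p 0) + count< n (p ∘ suc)
count<-suc n p = trans (count<-sum< (suc n) p)
  (trans (sum<-suc n (𝟙 ∘ p)) (cong (𝟙 (p 0) +_) (sym (count<-sum< n (p ∘ suc)))))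

count<-cong : ∀ n {p p′ : ℕ → Bool} → (∀ i → p i ≡ p′ i) → count< n p ≡ count< n p′
count<-cong n {p} {p′} e = trans (count<-sum< n p)
  (trans (sum<-cong n (λ i → cong 𝟙 (e i))) (sym (count<-sum< n p′)))

count<-zero : ∀ n {p : ℕ → Bool} → (∀ i → p i ≡ false) → count< n p ≡ 0
count<-zero n {p} e = trans (count<-sum< n p) (sum<-zero n (λ i → cong 𝟙 (e i)))

count<-all : ∀ n {p : ℕ → Bool} → (∀ i → p i ≡ true) → count< n p ≡ n
count<-all zero    e = refl
count<-all (suc n) {p} e = trans (count<-suc n p) (cong₂ _+_ (cong 𝟙 (e 0)) (count<-all n (e ∘ suc)))

count<-split : ∀ n {p p₁ p₂ : ℕ → Bool} → (∀ i → 𝟙 (p i) ≡ 𝟙 (p₁ i) + 𝟙 (p₂ i)) →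
               count< n p ≡ count< n p₁ + count< n p₂
count<-split n {p} {p₁} {p₂} e = begin
  count< n p                               ≡⟨ count<-sum< n p ⟩
  sum< n (𝟙 ∘ p)                           ≡⟨ sum<-cong n e ⟩
  sum< n (λ i → 𝟙 (p₁ i) + 𝟙 (p₂ i))       ≡⟨ sum<-+ n (𝟙 ∘ p₁) (𝟙 ∘ p₂) ⟩
  sum< n (𝟙 ∘ p₁) + sum< n (𝟙 ∘ p₂)        ≡⟨ cong₂ _+_ (count<-sum< n p₁) (count<-sum< n p₂) ⟨
  count< n p₁ + count< n p₂                ∎

sum<-single : ∀ n x (f : ℕ → ℕ) → x < n → sum< n (λ i → if i ≡ᵇ x then f i else 0) ≡ f x
sum<-single (suc n) zero    f _         = trans (sum<-suc n (λ i → if i ≡ᵇ 0 then f i else 0))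
  (trans (cong (f 0 +_) (sum<-zero n (λ _ → refl))) (ℕₚ.+-identityʳ (f 0)))
sum<-single (suc n) (suc x) f (s≤s x<n) = trans (sum<-suc n (λ i → if i ≡ᵇ suc x then f i else 0)) (sum<-single n x (f ∘ suc) x<n)

count<-single : ∀ n x → x < n → count< n (_≡ᵇ x) ≡ 1
count<-single n x x<n = trans (count<-sum< n (_≡ᵇ x)) (sum<-single n x (λ _ → 1) x<n)

-- The Boolean tests are indices, so that one match on `order` evaluates all four comparisons of x
-- and y in the goal at once and supplies the propositional fact.
data Order (x y : ℕ) : Bool → Bool → Bool → Bool → Set where
  less    : x < y → Order x y true  false false false
  equal   : x ≡ y → Order x y false false true  true
  greater : y < x → Order x y false true  false false

order : ∀ x y → Order x y (x <ᵇ y) (y <ᵇ x) (x ≡ᵇ y) (y ≡ᵇ x)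
order zero    zero    = equal refl
order zero    (suc y) = less (s≤s z≤n)
order (suc x) zero    = greater (s≤s z≤n)
order (suc x) (suc y) with x <ᵇ y | y <ᵇ x | x ≡ᵇ y | y ≡ᵇ x | order x y
... | _ | _ | _ | _ | less lt    = less (s≤s lt)
... | _ | _ | _ | _ | equal eq   = equal (cong suc eq)
... | _ | _ | _ | _ | greater gt = greater (s≤s gt)

-- A sum over the elements x of a subset p of {0,…,n-1}, depending only on the numbers of elements
-- of p below and above x.
splits : ℕ → (ℕ → ℕ → ℤ) → ℤ
splits zero    g = 0ℤ
splits (suc e) g = g 0 e ⊕ splits e (g ∘ suc)

∑-splits : ∀ n (p : ℕ → Bool) (g : ℕ → ℕ → ℤ) →
  ∑ (upTo n) (λ x → if p x then g (count< n (λ v → (v <ᵇ x) ∧ p v)) (count< n (λ v → (x <ᵇ v) ∧ p v)) else 0ℤ)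
  ≡ splits (count< n p) g
∑-splits zero    p g = refl
∑-splits (suc n) p g = begin
  ∑ (upTo (suc n)) (F (suc n) p g)
    ≡⟨ ∑-upTo-suc n (F (suc n) p g) ⟩
  F (suc n) p g 0 ⊕ ∑ (upTo n) (λ x → F (suc n) p g (suc x))
    ≡⟨ cong₂ _⊕_ (cong₂ (λ b a → if p 0 then g b a else 0ℤ) below above) (∑-cong (upTo n) rest) ⟩
  (if p 0 then g 0 (count< n (p ∘ suc)) else 0ℤ) ⊕ ∑ (upTo n) (F n (p ∘ suc) (λ b → g (𝟙 (p 0) + b)))
    ≡⟨ cong ((if p 0 then g 0 (count< n (p ∘ suc)) else 0ℤ) ⊕_) (∑-splits n (p ∘ suc) (λ b → g (𝟙 (p 0) + b))) ⟩
  (if p 0 then g 0 (count< n (p ∘ suc)) else 0ℤ) ⊕ splits (count< n (p ∘ suc)) (λ b → g (𝟙 (p 0) + b))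
    ≡⟨ head (p 0) (count< n (p ∘ suc)) ⟩
  splits (𝟙 (p 0) + count< n (p ∘ suc)) g
    ≡⟨ cong (λ e → splits e g) (count<-suc n p) ⟨
  splits (count< (suc n) p) g ∎
  where
  F : ℕ → (ℕ → Bool) → (ℕ → ℕ → ℤ) → ℕ → ℤ
  F n p g x = if p x then g (count< n (λ v → (v <ᵇ x) ∧ p v)) (count< n (λ v → (x <ᵇ v) ∧ p v)) else 0ℤ
  below : count< (suc n) (λ v → (v <ᵇ 0) ∧ p v) ≡ 0
  below = count<-zero (suc n) (λ _ → refl)
  above : count< (suc n) (λ v → (0 <ᵇ v) ∧ p v) ≡ count< n (p ∘ suc)
  above = count<-suc n (λ v → (0 <ᵇ v) ∧ p v)
  rest : ∀ x → F (suc n) p g (suc x) ≡ F n (p ∘ suc) (λ b → g (𝟙 (p 0) + b)) x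
  rest x = cong₂ (λ b a → if p (suc x) then g b a else 0ℤ)
                 (count<-suc n (λ v → (v <ᵇ suc x) ∧ p v)) (count<-suc n (λ v → (suc x <ᵇ v) ∧ p v))
  head : ∀ b e → (if b then g 0 e else 0ℤ) ⊕ splits e (λ c → g (𝟙 b + c)) ≡ splits (𝟙 b + e) g
  head true  e = refl
  head false e = ℤₚ.+-identityˡ _

∧-true : ∀ {a b} → a ∧ b ≡ true → a ≡ true × b ≡ true
∧-true {true} {true} refl = refl , refl

-- Records and special inversions by recursion on the word

fresh exceeded : List ℕ → ℕ → Bool
fresh    w v = all (v ≠ᵇ_) w
exceeded w v = any (v <ᵇ_) w

distinct : List ℕ → Bool
distinct []      = true
distinct (x ∷ w) = fresh w x ∧ distinct w

records : List ℕ → ℕ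
records []      = 0
records (x ∷ w) = 𝟙 (all (_<ᵇ x) w) + records w

specials : ℕ → List ℕ → ℕ
specials v []      = 0
specials v (x ∷ w) = 𝟙 ((x <ᵇ v) ∧ exceeded w v) + specials v w

invᵣ : List ℕ → ℕ
invᵣ []      = 0
invᵣ (x ∷ w) = specials x w + invᵣ w

isPerm-distinct : ∀ w → isPerm (length w) w ≡ distinct w
isPerm-distinct []      = refl
isPerm-distinct (x ∷ w) = begin
  isPerm (suc n) (x ∷ w)
    ≡⟨ all<-suc n (λ i → all< (suc n) (λ j → (i <ᵇ j) ⇒ᵇ (at (x ∷ w) i ≠ᵇ at (x ∷ w) j))) ⟩
  all< (suc n) (λ j → (0 <ᵇ j) ⇒ᵇ (x ≠ᵇ at (x ∷ w) j)) ∧ all< n (λ i → all< (suc n) (λ j → (suc i <ᵇ j) ⇒ᵇ (at w i ≠ᵇ at (x ∷ w) j)))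
    ≡⟨ cong₂ _∧_ (trans (all<-suc n (λ j → (0 <ᵇ j) ⇒ᵇ (x ≠ᵇ at (x ∷ w) j))) (all<-at w (x ≠ᵇ_)))
                 (all<-cong n (λ i → all<-suc n (λ j → (suc i <ᵇ j) ⇒ᵇ (at w i ≠ᵇ at (x ∷ w) j)))) ⟩
  fresh w x ∧ isPerm n w
    ≡⟨ cong (fresh w x ∧_) (isPerm-distinct w) ⟩
  distinct (x ∷ w) ∎
  where
  n = length w

rlm-records : ∀ w → rlm (length w) w ≡ records w
rlm-records []      = refl
rlm-records (x ∷ w) = begin
  rlm (suc n) (x ∷ w)
    ≡⟨ count<-suc n (λ i → all< (suc n) (λ j → (i <ᵇ j) ⇒ᵇ (at (x ∷ w) j <ᵇ at (x ∷ w) i))) ⟩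
  𝟙 (all< (suc n) (λ j → (0 <ᵇ j) ⇒ᵇ (at (x ∷ w) j <ᵇ x))) + count< n (λ i → all< (suc n) (λ j → (suc i <ᵇ j) ⇒ᵇ (at (x ∷ w) j <ᵇ at w i)))
    ≡⟨ cong₂ (λ b c → 𝟙 b + c) (trans (all<-suc n (λ j → (0 <ᵇ j) ⇒ᵇ (at (x ∷ w) j <ᵇ x))) (all<-at w (_<ᵇ x)))
                             (count<-cong n (λ i → all<-suc n (λ j → (suc i <ᵇ j) ⇒ᵇ (at (x ∷ w) j <ᵇ at w i)))) ⟩
  𝟙 (all (_<ᵇ x) w) + rlm n w
    ≡⟨ cong (𝟙 (all (_<ᵇ x) w) +_) (rlm-records w) ⟩
  records (x ∷ w) ∎
  where
  n = length w

count-specials : ∀ v w → count< (length w) (λ j → (at w j <ᵇ v) ∧ any< (length w) (λ k → (j <ᵇ k) ∧ (v <ᵇ at w k))) ≡ specials v w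
count-specials v []      = refl
count-specials v (x ∷ w) = begin
  count< (suc n) (λ j → (at (x ∷ w) j <ᵇ v) ∧ any< (suc n) (λ k → (j <ᵇ k) ∧ (v <ᵇ at (x ∷ w) k)))
    ≡⟨ count<-suc n (λ j → (at (x ∷ w) j <ᵇ v) ∧ any< (suc n) (λ k → (j <ᵇ k) ∧ (v <ᵇ at (x ∷ w) k))) ⟩
  𝟙 ((x <ᵇ v) ∧ any< (suc n) (λ k → (0 <ᵇ k) ∧ (v <ᵇ at (x ∷ w) k))) +
  count< n (λ j → (at w j <ᵇ v) ∧ any< (suc n) (λ k → (suc j <ᵇ k) ∧ (v <ᵇ at (x ∷ w) k)))
    ≡⟨ cong₂ _+_ (cong (λ b → 𝟙 ((x <ᵇ v) ∧ b)) (trans (any<-suc n (λ k → (0 <ᵇ k) ∧ (v <ᵇ at (x ∷ w) k))) (any<-at w (v <ᵇ_))))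
                 (count<-cong n (λ j → cong ((at w j <ᵇ v) ∧_) (any<-suc n (λ k → (suc j <ᵇ k) ∧ (v <ᵇ at (x ∷ w) k))))) ⟩
  𝟙 ((x <ᵇ v) ∧ exceeded w v) + count< n (λ j → (at w j <ᵇ v) ∧ any< n (λ k → (j <ᵇ k) ∧ (v <ᵇ at w k)))
    ≡⟨ cong (𝟙 ((x <ᵇ v) ∧ exceeded w v) +_) (count-specials v w) ⟩
  specials v (x ∷ w) ∎
  where
  n = length w

inv′-invᵣ : ∀ w → inv′ (length w) w ≡ invᵣ w
inv′-invᵣ []      = refl
inv′-invᵣ (x ∷ w) = begin
  inv′ (suc n) (x ∷ w)
    ≡⟨ sum<-suc n (λ i → count< (suc n) (isSpecialInv (suc n) (x ∷ w) i)) ⟩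
  count< (suc n) (isSpecialInv (suc n) (x ∷ w) 0) + sum< n (λ i → count< (suc n) (isSpecialInv (suc n) (x ∷ w) (suc i)))
    ≡⟨ cong₂ _+_ (trans (count<-suc n (isSpecialInv (suc n) (x ∷ w) 0)) (count<-cong n (λ j → cong ((at w j <ᵇ x) ∧_)
                   (any<-suc n (λ k → (suc j <ᵇ k) ∧ (x <ᵇ at (x ∷ w) k))))))
                 (sum<-cong n (λ i → trans (count<-suc n (isSpecialInv (suc n) (x ∷ w) (suc i))) (count<-cong n (λ j →
                   cong (λ b → (i <ᵇ j) ∧ (at w j <ᵇ at w i) ∧ b) (any<-suc n (λ k → (suc j <ᵇ k) ∧ (at w i <ᵇ at (x ∷ w) k))))))) ⟩
  count< n (λ j → (at w j <ᵇ x) ∧ any< n (λ k → (j <ᵇ k) ∧ (x <ᵇ at w k))) + inv′ n w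
    ≡⟨ cong₂ _+_ (count-specials x w) (inv′-invᵣ w) ⟩
  invᵣ (x ∷ w) ∎
  where
  n = length w

bracket : ℤ → ℕ → ℤ
bracket q zero    = 0ℤ
bracket q (suc h) = q ^ h ⊕ bracket q h

<ᵇ-trans : ∀ {x y z} → x < y → (y <ᵇ z) ≡ true → (x <ᵇ z) ≡ true
<ᵇ-trans {zero}  {suc y} {suc z} lt       e = refl
<ᵇ-trans {suc x} {suc y} {suc z} (s≤s lt) e = <ᵇ-trans {z = z} lt e

exceeded-mono : ∀ w {v x} → v < x → exceeded w x ≡ true → exceeded w v ≡ true
exceeded-mono (y ∷ w) {v} {x} lt e with x <ᵇ y in eq
... | true  rewrite <ᵇ-trans {v} {x} {y} lt eq = refl
... | false = trans (cong ((v <ᵇ y) ∨_) (exceeded-mono w lt e)) (𝔹ₚ.∨-zeroʳ (v <ᵇ y))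

record-exceeded : ∀ w x → fresh w x ≡ true → all (_<ᵇ x) w ≡ not (exceeded w x)
record-exceeded []      x f = refl
record-exceeded (y ∷ w) x f with x <ᵇ y | y <ᵇ x | x ≡ᵇ y | y ≡ᵇ x | order x y
... | _ | _ | _ | _ | less _    = refl
... | _ | _ | _ | _ | greater _ = record-exceeded w x f
record-exceeded (y ∷ w) x () | _ | _ | _ | _ | equal _

-- The missing values below and above the largest letter of w. When w is read from its end, that
-- letter is the last record.
pending available : List ℕ → ℕ → Bool
pending   w v = fresh w v ∧ exceeded w v
available w v = fresh w v ∧ not (exceeded w v)

fresh-pending-available : ∀ w v → 𝟙 (fresh w v) ≡ 𝟙 (available w v) + 𝟙 (pending w v)
fresh-pending-available w v with fresh w v | exceeded w v
... | true  | true  = refl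
... | true  | false = refl
... | false | _     = refl

module _ {w x} (f : fresh w x ≡ true) where

  fresh-∷ : ∀ v → 𝟙 (fresh w v) ≡ 𝟙 (fresh (x ∷ w) v) + 𝟙 (v ≡ᵇ x)
  fresh-∷ v with x <ᵇ v | v <ᵇ x | x ≡ᵇ v | v ≡ᵇ x | order x v
  ... | _ | _ | _ | _ | less _     = sym (ℕₚ.+-identityʳ _)
  ... | _ | _ | _ | _ | equal refl = cong 𝟙 f
  ... | _ | _ | _ | _ | greater _  = sym (ℕₚ.+-identityʳ _)

  -- When x is put in front of w, the value x ceases to be missing and takes its term along, while
  -- each larger pending value gains one special inversion, with x as its smaller entry.
  specials-∷ : ∀ v →
    (if fresh (x ∷ w) v then specials v (x ∷ w) else 0) + (if v ≡ᵇ x then specials v w else 0)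
    ≡ (if fresh w v then specials v w else 0) + 𝟙 ((x <ᵇ v) ∧ pending w v)
  specials-∷ v with x <ᵇ v | v <ᵇ x | x ≡ᵇ v | v ≡ᵇ x | order x v
  specials-∷ v | _ | _ | _ | _ | less _ with fresh w v
  ... | true  = trans (ℕₚ.+-identityʳ _) (ℕₚ.+-comm (𝟙 (exceeded w v)) (specials v w))
  ... | false = refl
  specials-∷ v | _ | _ | _ | _ | equal refl rewrite f = sym (ℕₚ.+-identityʳ _)
  specials-∷ v | _ | _ | _ | _ | greater _  = refl

  module _ (e : exceeded w x ≡ true) where

    pending-∷-pending : ∀ v → 𝟙 (pending w v) ≡ 𝟙 (pending (x ∷ w) v) + 𝟙 (v ≡ᵇ x)
    pending-∷-pending v with x <ᵇ v | v <ᵇ x | x ≡ᵇ v | v ≡ᵇ x | order x v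
    ... | _ | _ | _ | _ | less _     = sym (ℕₚ.+-identityʳ _)
    ... | _ | _ | _ | _ | equal refl rewrite f | e = refl
    ... | _ | _ | _ | _ | greater lt rewrite exceeded-mono w lt e = sym (ℕₚ.+-identityʳ _)

    available-∷-pending : ∀ v → available (x ∷ w) v ≡ available w v
    available-∷-pending v with x <ᵇ v | v <ᵇ x | x ≡ᵇ v | v ≡ᵇ x | order x v
    ... | _ | _ | _ | _ | less _     = refl
    ... | _ | _ | _ | _ | equal refl rewrite f | e = refl
    ... | _ | _ | _ | _ | greater lt rewrite exceeded-mono w lt e = refl

  module _ (e : exceeded w x ≡ false) where

    pending-∷-record : ∀ v → 𝟙 (pending (x ∷ w) v) ≡ 𝟙 (pending w v) + 𝟙 ((v <ᵇ x) ∧ available w v)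
    pending-∷-record v with x <ᵇ v | v <ᵇ x | x ≡ᵇ v | v ≡ᵇ x | order x v
    pending-∷-record v | _ | _ | _ | _ | less _     = sym (ℕₚ.+-identityʳ _)
    pending-∷-record v | _ | _ | _ | _ | equal refl rewrite f | e = refl
    pending-∷-record v | _ | _ | _ | _ | greater lt with fresh w v | exceeded w v
    ... | true  | true  = refl
    ... | true  | false = refl
    ... | false | _     = refl

    available-∷-record : ∀ v → available (x ∷ w) v ≡ (x <ᵇ v) ∧ available w v
    available-∷-record v with x <ᵇ v | v <ᵇ x | x ≡ᵇ v | v ≡ᵇ x | order x v
    ... | _ | _ | _ | _ | less _     = refl
    ... | _ | _ | _ | _ | equal refl = refl
    ... | _ | _ | _ | _ | greater lt = 𝔹ₚ.∧-zeroʳ (fresh w v)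

    no-pending-above : ∀ v → (x <ᵇ v) ∧ pending w v ≡ false
    no-pending-above v with x <ᵇ v | v <ᵇ x | x ≡ᵇ v | v ≡ᵇ x | order x v
    ... | _ | _ | _ | _ | equal _   = refl
    ... | _ | _ | _ | _ | greater _ = refl
    ... | _ | _ | _ | _ | less lt with exceeded w v in eq
    ...   | false = 𝔹ₚ.∧-zeroʳ (fresh w v)
    ...   | true  = contradiction (trans (sym e) (exceeded-mono w lt eq)) λ ()

count-fresh : ∀ n w → distinct w ≡ true → All (_< n) w → count< n (fresh w) + length w ≡ n
count-fresh n []      d bound = trans (ℕₚ.+-identityʳ _) (count<-all n (λ _ → refl))
count-fresh n (x ∷ w) d (x<n ∷ bound) = begin
  count< n (fresh (x ∷ w)) + suc (length w)
    ≡⟨ ℕₚ.+-assoc (count< n (fresh (x ∷ w))) 1 (length w) ⟨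
  count< n (fresh (x ∷ w)) + 1 + length w
    ≡⟨ cong (λ c → count< n (fresh (x ∷ w)) + c + length w) (count<-single n x x<n) ⟨
  count< n (fresh (x ∷ w)) + count< n (_≡ᵇ x) + length w
    ≡⟨ cong (_+ length w) (count<-split n (fresh-∷ {w} (proj₁ (∧-true d)))) ⟨
  count< n (fresh w) + length w
    ≡⟨ count-fresh n w (proj₂ (∧-true {fresh w x} d)) bound ⟩
  n ∎

sum<-none : ∀ n {p} {f : ℕ → ℕ} → count< n p ≡ 0 → sum< n (λ v → if p v then f v else 0) ≡ 0
sum<-none zero    e = refl
sum<-none (suc n) {p} {f} e = trans (sum<-suc n (λ v → if p v then f v else 0)) (split (p 0) (trans (sym (count<-suc n p)) e))
  where
  split : ∀ b → 𝟙 b + count< n (p ∘ suc) ≡ 0 → (if b then f 0 else 0) + sum< n (λ v → if p (suc v) then f (suc v) else 0) ≡ 0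
  split false e = sum<-none n {p ∘ suc} {f ∘ suc} e

module Permutations (q : ℤ) (n k : ℕ) where
  open Paths (bracket q)
  open Records k

  -- The second summand anticipates the special inversions that the missing values will form with
  -- letters of w. Each is determined as soon as its smaller entry is read, wherever the larger one
  -- is placed later.
  statistic : List ℕ → ℕ
  statistic w = invᵣ w + sum< n (λ v → if fresh w v then specials v w else 0)

  statistic-∷ : ∀ w x → x < n → fresh w x ≡ true →
                statistic (x ∷ w) ≡ statistic w + count< n (λ v → (x <ᵇ v) ∧ pending w v)
  statistic-∷ w x x<n f = begin
    specials x w + invᵣ w + sum< n new
      ≡⟨ arith (specials x w) (invᵣ w) (sum< n new) ⟩
    invᵣ w + (sum< n new + specials x w)
      ≡⟨ cong (λ s → invᵣ w + (sum< n new + s)) (sum<-single n x (λ v → specials v w) x<n) ⟨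
    invᵣ w + (sum< n new + sum< n (λ v → if v ≡ᵇ x then specials v w else 0))
      ≡⟨ cong (invᵣ w +_) (sum<-+ n new (λ v → if v ≡ᵇ x then specials v w else 0)) ⟨
    invᵣ w + sum< n (λ v → new v + (if v ≡ᵇ x then specials v w else 0))
      ≡⟨ cong (invᵣ w +_) (sum<-cong n (specials-∷ {w} f)) ⟩
    invᵣ w + sum< n (λ v → old v + 𝟙 ((x <ᵇ v) ∧ pending w v))
      ≡⟨ cong (invᵣ w +_) (sum<-+ n old (λ v → 𝟙 ((x <ᵇ v) ∧ pending w v))) ⟩
    invᵣ w + (sum< n old + sum< n (λ v → 𝟙 ((x <ᵇ v) ∧ pending w v)))
      ≡⟨ ℕₚ.+-assoc (invᵣ w) (sum< n old) _ ⟨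
    statistic w + sum< n (λ v → 𝟙 ((x <ᵇ v) ∧ pending w v))
      ≡⟨ cong (statistic w +_) (count<-sum< n (λ v → (x <ᵇ v) ∧ pending w v)) ⟨
    statistic w + count< n (λ v → (x <ᵇ v) ∧ pending w v) ∎
    where
    new old : ℕ → ℕ
    new v = if fresh (x ∷ w) v then specials v (x ∷ w) else 0
    old v = if fresh w v then specials v w else 0
    arith : ∀ s i t → s + i + t ≡ i + (t + s)
    arith = solveℕ-∀

  level free : List ℕ → ℕ
  level w = count< n (pending w)
  free  w = count< n (available w)

  -- `X` accounts for all completions of w, so the sum of `potential` over words of length t does
  -- not depend on t ≤ n. The length n gives the permutations, the length 0 gives `X 0 n 0`.
  weight potential : List ℕ → ℤ
  weight w = q ^ statistic w ⊗ X (records w) (free w) (level w)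
  potential w = if distinct w then weight w else 0ℤ

  splits-down : ∀ c y h → splits h (λ _ above → c ⊗ (q ^ above ⊗ y)) ≡ c ⊗ (bracket q h ⊗ y)
  splits-down c y zero    = sym (ℤₚ.*-zeroʳ c)
  splits-down c y (suc h) = trans (cong (c ⊗ (q ^ h ⊗ y) ⊕_) (splits-down c y h)) (collect c (q ^ h) (bracket q h) y)
    where
    collect : ∀ c a b y → c ⊗ (a ⊗ y) ⊕ c ⊗ (b ⊗ y) ≡ c ⊗ ((a ⊕ b) ⊗ y)
    collect = solve-∀

  -- Unrolling `Xrec` lists the possible next records in increasing order; the values skipped before
  -- a record are the available ones below it, which become pending.
  splits-record : ∀ c j e h → splits e (λ below above → c ⊗ X j above (h + below)) ≡ c ⊗ Xrec j e h
  splits-record c j zero    h = sym (ℤₚ.*-zeroʳ c)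
  splits-record c j (suc e) h = begin
    c ⊗ X j e (h + 0) ⊕ splits e (λ below above → c ⊗ X j above (h + suc below))
      ≡⟨ cong₂ (λ x y → c ⊗ X j e x ⊕ y) (ℕₚ.+-identityʳ h) (splits-cong e (λ below above → cong (λ x → c ⊗ X j above x) (ℕₚ.+-suc h below))) ⟩
    c ⊗ X j e h ⊕ splits e (λ below above → c ⊗ X j above (suc h + below))
      ≡⟨ cong (c ⊗ X j e h ⊕_) (splits-record c j e (suc h)) ⟩
    c ⊗ X j e h ⊕ c ⊗ Xrec j e (suc h)
      ≡⟨ ℤₚ.*-distribˡ-+ c (X j e h) (Xrec j e (suc h)) ⟨
    c ⊗ Xrec j (suc e) h ∎
    where
    splits-cong : ∀ e {g g′ : ℕ → ℕ → ℤ} → (∀ b a → g b a ≡ g′ b a) → splits e g ≡ splits e g′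
    splits-cong zero    p = refl
    splits-cong (suc e) p = cong₂ _⊕_ (p 0 e) (splits-cong e (p ∘ suc))

  -- `pred` makes the statement uniform in h: its default at h = 0 is multiplied by `bracket q 0`,
  -- which is 0.
  Xdown-bracket : ∀ j e h → bracket q h ⊗ X j e (pred h) ≡ Xdown j e h
  Xdown-bracket j e zero    = refl
  Xdown-bracket j e (suc h) = refl

  potential-step : ∀ w → length w < n → All (_< n) w → ∑ (upTo n) (λ x → potential (x ∷ w)) ≡ potential w
  potential-step w len bound with distinct w in d
  ... | false = ∑-zero (upTo n) (λ x → cong (λ b → if b then weight (x ∷ w) else 0ℤ) (𝔹ₚ.∧-zeroʳ (fresh w x)))
  ... | true  = begin
    ∑ (upTo n) (λ x → if fresh w x ∧ true then weight (x ∷ w) else 0ℤ)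
      ≡⟨ ∑-upTo-cong n classify ⟩
    ∑ (upTo n) (λ x → (if pending w x then down-term (below (pending w) x) (above (pending w) x) else 0ℤ)
                    ⊕ (if available w x then record-term (below (available w) x) (above (available w) x) else 0ℤ))
      ≡⟨ ∑-⊕ (upTo n) _ _ ⟩
    ∑ (upTo n) (λ x → if pending w x then down-term (below (pending w) x) (above (pending w) x) else 0ℤ) ⊕
    ∑ (upTo n) (λ x → if available w x then record-term (below (available w) x) (above (available w) x) else 0ℤ)
      ≡⟨ cong₂ _⊕_ (∑-splits n (pending w) down-term) (∑-splits n (available w) record-term) ⟩
    splits h down-term ⊕ splits e record-term
      ≡⟨ cong₂ _⊕_ (trans (splits-down c (X j e (pred h)) h) (cong (c ⊗_) (Xdown-bracket j e h)))
                   (splits-record c (suc j) e h) ⟩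
    c ⊗ Xdown j e h ⊕ c ⊗ Xrec (suc j) e h
      ≡⟨ collect c (Xdown j e h) (Xrec (suc j) e h) ⟩
    c ⊗ (0ℤ ⊕ Xrec (suc j) e h ⊕ Xdown j e h)
      ≡⟨ cong (λ s → c ⊗ (s ⊕ Xrec (suc j) e h ⊕ Xdown j e h)) (no-stop e h nonempty) ⟨
    c ⊗ X j e h ∎
    where
    j = records w
    h = level w
    e = free w
    c = q ^ statistic w
    below above : (ℕ → Bool) → ℕ → ℕ
    below p x = count< n (λ v → (v <ᵇ x) ∧ p v)
    above p x = count< n (λ v → (x <ᵇ v) ∧ p v)
    down-term record-term : ℕ → ℕ → ℤ
    down-term   b a = c ⊗ (q ^ a ⊗ X j e (pred h))
    record-term b a = c ⊗ X (suc j) a (h + b)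
    collect : ∀ c x y → c ⊗ x ⊕ c ⊗ y ≡ c ⊗ (0ℤ ⊕ y ⊕ x)
    collect = solve-∀
    nonempty : e + h ≢ 0
    nonempty eq = ℕₚ.<⇒≢ len (begin
      length w                        ≡⟨ cong (_+ length w) eq ⟨
      e + h + length w                ≡⟨ cong (_+ length w) (count<-split n (fresh-pending-available w)) ⟨
      count< n (fresh w) + length w   ≡⟨ count-fresh n w d bound ⟩
      n                               ∎)
    no-stop : ∀ e h → e + h ≢ 0 → Xstop j e h ≡ 0ℤ
    no-stop zero    zero    ne = contradiction refl ne
    no-stop zero    (suc h) ne = refl
    no-stop (suc e) h       ne = refl
    classify : ∀ x → x < n →
      (if fresh w x ∧ true then weight (x ∷ w) else 0ℤ)
      ≡ (if pending w x then down-term (below (pending w) x) (above (pending w) x) else 0ℤ)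
      ⊕ (if available w x then record-term (below (available w) x) (above (available w) x) else 0ℤ)
    classify x x<n with fresh w x in f
    ... | false = refl
    ... | true with exceeded w x in ex
    ...   | true  = begin
      q ^ statistic (x ∷ w) ⊗ X (records (x ∷ w)) (free (x ∷ w)) (level (x ∷ w))
        ≡⟨ cong (λ s → q ^ s ⊗ X (records (x ∷ w)) (free (x ∷ w)) (level (x ∷ w))) (statistic-∷ w x x<n f) ⟩
      q ^ (statistic w + above (pending w) x) ⊗ X (records (x ∷ w)) (free (x ∷ w)) (level (x ∷ w))
        ≡⟨ cong (_⊗ X (records (x ∷ w)) (free (x ∷ w)) (level (x ∷ w))) (ℤₚ.^-distribˡ-+-* q (statistic w) (above (pending w) x)) ⟩
      c ⊗ q ^ above (pending w) x ⊗ X (records (x ∷ w)) (free (x ∷ w)) (level (x ∷ w))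
        ≡⟨ cong (c ⊗ q ^ above (pending w) x ⊗_) (trans (cong₂ (λ r s → X r s (level (x ∷ w)))
             (cong (λ b → 𝟙 b + j) (trans (record-exceeded w x f) (cong not ex)))
             (count<-cong n (available-∷-pending {w} f ex)))
             (cong (X j e) (sym (cong pred (trans (count<-split n (pending-∷-pending {w} f ex))
               (trans (cong (level (x ∷ w) +_) (count<-single n x x<n)) (ℕₚ.+-comm (level (x ∷ w)) 1))))))) ⟩
      c ⊗ q ^ above (pending w) x ⊗ X j e (pred h)
        ≡⟨ trans (ℤₚ.*-assoc c _ _) (sym (ℤₚ.+-identityʳ _)) ⟩
      down-term (below (pending w) x) (above (pending w) x) ⊕ 0ℤ ∎
    ...   | false = begin
      q ^ statistic (x ∷ w) ⊗ X (records (x ∷ w)) (free (x ∷ w)) (level (x ∷ w))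
        ≡⟨ cong₂ (λ s r → q ^ s ⊗ X r (free (x ∷ w)) (level (x ∷ w)))
             (trans (statistic-∷ w x x<n f) (trans (cong (statistic w +_) (count<-zero n (no-pending-above {w} f ex))) (ℕₚ.+-identityʳ _)))
             (cong (λ b → 𝟙 b + j) (trans (record-exceeded w x f) (cong not ex))) ⟩
      c ⊗ X (suc j) (free (x ∷ w)) (level (x ∷ w))
        ≡⟨ cong₂ (λ r s → c ⊗ X (suc j) r s) (count<-cong n (available-∷-record {w} f ex)) (count<-split n (pending-∷-record {w} f ex)) ⟩
      record-term (below (available w) x) (above (available w) x)
        ≡⟨ ℤₚ.+-identityˡ _ ⟨
      0ℤ ⊕ record-term (below (available w) x) (above (available w) x) ∎

  ∑-potential : ∀ t → t ≤ n → ∑ (words t n) potential ≡ X 0 n 0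
  ∑-potential zero    _   = begin
    1ℤ-part ⊕ 0ℤ                  ≡⟨ ℤₚ.+-identityʳ _ ⟩
    q ^ statistic [] ⊗ X 0 (free []) (level [])
      ≡⟨ cong₂ (λ s x → q ^ s ⊗ x) (sum<-zero n (λ _ → refl)) (cong₂ (X 0) (count<-all n (λ _ → refl)) (count<-zero n (λ _ → refl))) ⟩
    1ℤ ⊗ X 0 n 0                  ≡⟨ ℤₚ.*-identityˡ _ ⟩
    X 0 n 0                       ∎
    where
    1ℤ-part = potential []
  ∑-potential (suc t) t<n = begin
    ∑ (words (suc t) n) potential
      ≡⟨ ∑-words-suc t n potential ⟩
    ∑ (words t n) (λ w → ∑ (upTo n) (λ x → potential (x ∷ w)))
      ≡⟨ ∑-words-cong t n (λ w len bound → potential-step w (subst (_< n) (sym len) t<n) bound) ⟩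
    ∑ (words t n) potential
      ≡⟨ ∑-potential t (ℕₚ.<⇒≤ t<n) ⟩
    X 0 n 0 ∎

  potential-full : ∀ w → length w ≡ n → All (_< n) w →
                   potential w ≡ (if isPerm n w ∧ (rlm n w ≡ᵇ k) then q ^ inv′ n w else 0ℤ)
  potential-full w refl bound rewrite isPerm-distinct w | rlm-records w | inv′-invᵣ w with distinct w in d
  ... | false = refl
  ... | true  = begin
    q ^ statistic w ⊗ X (records w) (free w) (level w)
      ≡⟨ cong₂ (λ s x → q ^ s ⊗ x)
           (trans (cong (invᵣ w +_) (sum<-none n {fresh w} none)) (ℕₚ.+-identityʳ (invᵣ w)))
           (cong₂ (X (records w)) (ℕₚ.m+n≡0⇒m≡0 (free w) none′) (ℕₚ.m+n≡0⇒n≡0 (free w) none′)) ⟩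
    q ^ invᵣ w ⊗ X (records w) 0 0
      ≡⟨ finish (records w ≡ᵇ k) ⟩
    (if records w ≡ᵇ k then q ^ invᵣ w else 0ℤ) ∎
    where
    none : count< n (fresh w) ≡ 0
    none = ℕₚ.+-cancelʳ-≡ (length w) (count< n (fresh w)) 0 (count-fresh n w d bound)
    none′ : free w + level w ≡ 0
    none′ = trans (sym (count<-split n (fresh-pending-available w))) none
    finish : ∀ b → q ^ invᵣ w ⊗ ((if b then 1ℤ else 0ℤ) ⊕ 0ℤ ⊕ 0ℤ) ≡ (if b then q ^ invᵣ w else 0ℤ)
    finish true  = ℤₚ.*-identityʳ (q ^ invᵣ w)
    finish false = ℤₚ.*-zeroʳ (q ^ invᵣ w)

  ∑-permutations : ∑ (words n n) (λ w → if isPerm n w ∧ (rlm n w ≡ᵇ k) then q ^ inv′ n w else 0ℤ) ≡ X 0 n 0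
  ∑-permutations = trans (sym (∑-words-cong n n potential-full)) (∑-potential n ℕₚ.≤-refl)

-- Set partitions

sum₂ : ℕ → (ℕ → ℕ → Bool) → ℕ
sum₂ n P = sum< n (λ c → count< n (P c))

sum₃ : ℕ → (ℕ → ℕ → ℕ → Bool) → ℕ
sum₃ n P = sum< n (λ b → sum₂ n (P b))

sum₄ : ℕ → (ℕ → ℕ → ℕ → ℕ → Bool) → ℕ
sum₄ n P = sum< n (λ a → sum₃ n (P a))

sum₂-cong : ∀ n {P P′} → (∀ c d → P c d ≡ P′ c d) → sum₂ n P ≡ sum₂ n P′
sum₂-cong n e = sum<-cong n (λ c → count<-cong n (e c))

sum₃-cong : ∀ n {P P′} → (∀ b c d → P b c d ≡ P′ b c d) → sum₃ n P ≡ sum₃ n P′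
sum₃-cong n e = sum<-cong n (λ b → sum₂-cong n (e b))

sum₄-cong : ∀ n {P P′} → (∀ a b c d → P a b c d ≡ P′ a b c d) → sum₄ n P ≡ sum₄ n P′
sum₄-cong n e = sum<-cong n (λ a → sum₃-cong n (e a))

sum₂-zero : ∀ n {P} → (∀ c d → P c d ≡ false) → sum₂ n P ≡ 0
sum₂-zero n e = sum<-zero n (λ c → count<-zero n (e c))

sum₃-zero : ∀ n {P} → (∀ b c d → P b c d ≡ false) → sum₃ n P ≡ 0
sum₃-zero n e = sum<-zero n (λ b → sum₂-zero n (e b))

-- The summands of interest require strictly increasing indices, so index 0 can be taken by the
-- outermost variable only. The hypotheses here and in the versions for three and four indices state
-- this.
sum₂-suc : ∀ n P → (∀ c → P (suc c) 0 ≡ false) →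
           sum₂ (suc n) P ≡ count< (suc n) (P 0) + sum₂ n (λ c d → P (suc c) (suc d))
sum₂-suc n P z = trans (sum<-suc n (λ c → count< (suc n) (P c)))
  (cong (count< (suc n) (P 0) +_) (sum<-cong n (λ c →
    trans (count<-suc n (P (suc c))) (cong (λ b → 𝟙 b + count< n (P (suc c) ∘ suc)) (z c)))))

sum₃-suc : ∀ n P → (∀ b d → P (suc b) 0 d ≡ false) → (∀ b c → P (suc b) (suc c) 0 ≡ false) →
           sum₃ (suc n) P ≡ sum₂ (suc n) (P 0) + sum₃ n (λ b c d → P (suc b) (suc c) (suc d))
sum₃-suc n P z₁ z₂ = trans (sum<-suc n (λ b → sum₂ (suc n) (P b)))
  (cong (sum₂ (suc n) (P 0) +_) (sum<-cong n (λ b →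
    trans (sum₂-suc n (P (suc b)) (z₂ b)) (cong (_+ sum₂ n (λ c d → P (suc b) (suc c) (suc d))) (count<-zero (suc n) (z₁ b))))))

sum₄-suc : ∀ n P → (∀ a c d → P (suc a) 0 c d ≡ false) → (∀ a b d → P (suc a) (suc b) 0 d ≡ false) →
           (∀ a b c → P (suc a) (suc b) (suc c) 0 ≡ false) →
           sum₄ (suc n) P ≡ sum₃ (suc n) (P 0) + sum₄ n (λ a b c d → P (suc a) (suc b) (suc c) (suc d))
sum₄-suc n P z₁ z₂ z₃ = trans (sum<-suc n (λ a → sum₃ (suc n) (P a)))
  (cong (sum₃ (suc n) (P 0) +_) (sum<-cong n (λ a →
    trans (sum₃-suc n (P (suc a)) (z₂ a) (z₃ a))
          (cong (_+ sum₃ n (λ b c d → P (suc a) (suc b) (suc c) (suc d))) (sum₂-zero (suc n) (z₁ a))))))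

-- Crossings by recursion on the word

occurs : List ℕ → ℕ → Bool
occurs w x = any (_≡ᵇ x) w

-- For x ≠ y: both labels occur in w, and the first occurrence of x precedes that of y.
before : ℕ → ℕ → List ℕ → Bool
before x y []      = false
before x y (z ∷ w) = if z ≡ᵇ x then occurs w y else (if z ≡ᵇ y then false else before x y w)

-- The crossings of the arc from a preceding x to its first occurrence in w with arcs that start in w.
crossings : ℕ → List ℕ → ℕ
crossings x []      = 0
crossings x (y ∷ w) = if y ≡ᵇ x then 0 else 𝟙 (before x y w) + crossings x w

croᵣ : List ℕ → ℕ
croᵣ []      = 0
croᵣ (x ∷ w) = crossings x w + croᵣ w

firstAt : ℕ → List ℕ → ℕ → Bool
firstAt x w c = (x ≡ᵇ at w c) ∧ all< c (λ b → at w b ≠ᵇ x)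

firstAt-suc : ∀ x y w c → firstAt x (y ∷ w) (suc c) ≡ not (y ≡ᵇ x) ∧ firstAt x w c
firstAt-suc x y w c = trans (cong ((x ≡ᵇ at w c) ∧_) (all<-suc c (λ b → at (y ∷ w) b ≠ᵇ x)))
  (exchange (x ≡ᵇ at w c) (not (y ≡ᵇ x)) (all< c (λ b → at w b ≠ᵇ x)))
  where
  exchange : ∀ a b c → a ∧ b ∧ c ≡ b ∧ a ∧ c
  exchange true  true  c = refl
  exchange true  false c = refl
  exchange false true  c = refl
  exchange false false c = refl

isArc-suc : ∀ n m x w b d → isArc n (x ∷ w) (suc b) (suc d) ≡ isArc m w b d
isArc-suc n m x w b d = cong (λ t → (b <ᵇ d) ∧ (at w b ≡ᵇ at w d) ∧ t)
  (all<-suc d (λ e → (suc b <ᵇ e) ⇒ᵇ (at (x ∷ w) e ≠ᵇ at w b)))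

isArc-zero : ∀ n x w d → isArc n (x ∷ w) 0 (suc d) ≡ firstAt x w d
isArc-zero n x w d = cong ((x ≡ᵇ at w d) ∧_) (all<-suc d (λ e → (0 <ᵇ e) ⇒ᵇ (at (x ∷ w) e ≠ᵇ x)))

count-firstAt : ∀ x w → count< (length w) (firstAt x w) ≡ 𝟙 (occurs w x)
count-firstAt x []      = refl
count-firstAt x (y ∷ w) = begin
  count< (suc n) (firstAt x (y ∷ w))
    ≡⟨ count<-suc n (firstAt x (y ∷ w)) ⟩
  𝟙 ((x ≡ᵇ y) ∧ true) + count< n (λ d → firstAt x (y ∷ w) (suc d))
    ≡⟨ cong (𝟙 ((x ≡ᵇ y) ∧ true) +_) (count<-cong n (firstAt-suc x y w)) ⟩
  𝟙 ((x ≡ᵇ y) ∧ true) + count< n (λ d → not (y ≡ᵇ x) ∧ firstAt x w d)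
    ≡⟨ cases ⟩
  𝟙 ((y ≡ᵇ x) ∨ occurs w x) ∎
  where
  n = length w
  cases : 𝟙 ((x ≡ᵇ y) ∧ true) + count< n (λ d → not (y ≡ᵇ x) ∧ firstAt x w d) ≡ 𝟙 ((y ≡ᵇ x) ∨ occurs w x)
  cases with x <ᵇ y | y <ᵇ x | x ≡ᵇ y | y ≡ᵇ x | order x y
  ... | _ | _ | _ | _ | less _    = count-firstAt x w
  ... | _ | _ | _ | _ | equal _   = cong suc (count<-zero n (λ _ → refl))
  ... | _ | _ | _ | _ | greater _ = count-firstAt x w

sum-before : ∀ {x y} → x ≢ y → ∀ w →
  sum₂ (length w) (λ c d → (c <ᵇ d) ∧ firstAt x w c ∧ firstAt y w d) ≡ 𝟙 (before x y w)
sum-before         x≢y []      = refl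
sum-before {x} {y} x≢y (z ∷ w) = begin
  sum₂ (suc n) (λ c d → (c <ᵇ d) ∧ firstAt x (z ∷ w) c ∧ firstAt y (z ∷ w) d)
    ≡⟨ sum₂-suc n (λ c d → (c <ᵇ d) ∧ firstAt x (z ∷ w) c ∧ firstAt y (z ∷ w) d) (λ _ → refl) ⟩
  count< (suc n) (λ d → (0 <ᵇ d) ∧ ((x ≡ᵇ z) ∧ true) ∧ firstAt y (z ∷ w) d) +
  sum₂ n (λ c d → (c <ᵇ d) ∧ firstAt x (z ∷ w) (suc c) ∧ firstAt y (z ∷ w) (suc d))
    ≡⟨ cong₂ _+_
         (trans (count<-suc n (λ d → (0 <ᵇ d) ∧ ((x ≡ᵇ z) ∧ true) ∧ firstAt y (z ∷ w) d))
                (count<-cong n (λ d → cong (((x ≡ᵇ z) ∧ true) ∧_) (firstAt-suc y z w d))))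
         (sum₂-cong n (λ c d → cong₂ (λ s t → (c <ᵇ d) ∧ s ∧ t) (firstAt-suc x z w c) (firstAt-suc y z w d))) ⟩
  count< n (λ d → ((x ≡ᵇ z) ∧ true) ∧ not (z ≡ᵇ y) ∧ firstAt y w d) +
  sum₂ n (λ c d → (c <ᵇ d) ∧ (not (z ≡ᵇ x) ∧ firstAt x w c) ∧ (not (z ≡ᵇ y) ∧ firstAt y w d))
    ≡⟨ cases ⟩
  𝟙 (before x y (z ∷ w)) ∎
  where
  n = length w
  cases : count< n (λ d → ((x ≡ᵇ z) ∧ true) ∧ not (z ≡ᵇ y) ∧ firstAt y w d) +
          sum₂ n (λ c d → (c <ᵇ d) ∧ (not (z ≡ᵇ x) ∧ firstAt x w c) ∧ (not (z ≡ᵇ y) ∧ firstAt y w d))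
          ≡ 𝟙 (before x y (z ∷ w))
  differ : ∀ b → count< n (λ d → not b ∧ firstAt y w d) ≡ 𝟙 (if b then false else occurs w y)
  differ true  = count<-zero n (λ _ → refl)
  differ false = count-firstAt y w
  later : ∀ b → sum₂ n (λ c d → (c <ᵇ d) ∧ firstAt x w c ∧ (not b ∧ firstAt y w d))
                ≡ 𝟙 (if b then false else before x y w)
  later true  = sum₂-zero n (λ c d → trans (cong ((c <ᵇ d) ∧_) (𝔹ₚ.∧-zeroʳ (firstAt x w c))) (𝔹ₚ.∧-zeroʳ (c <ᵇ d)))
  later false = sum-before x≢y w
  cases with x <ᵇ z | z <ᵇ x | x ≡ᵇ z | z ≡ᵇ x | order x z
  ... | _ | _ | _ | _ | less _    = cong₂ _+_ (count<-zero n (λ _ → refl)) (later (z ≡ᵇ y))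
  ... | _ | _ | _ | _ | greater _ = cong₂ _+_ (count<-zero n (λ _ → refl)) (later (z ≡ᵇ y))
  ... | _ | _ | _ | _ | equal refl with z <ᵇ y | y <ᵇ z | z ≡ᵇ y | y ≡ᵇ z | order z y
  ...   | _ | _ | _ | _ | equal z≡y = contradiction z≡y x≢y
  ...   | _ | _ | _ | _ | less _    = trans (cong₂ _+_ (differ false) (sum₂-zero n (λ c d → 𝔹ₚ.∧-zeroʳ (c <ᵇ d)))) (ℕₚ.+-identityʳ _)
  ...   | _ | _ | _ | _ | greater _ = trans (cong₂ _+_ (differ false) (sum₂-zero n (λ c d → 𝔹ₚ.∧-zeroʳ (c <ᵇ d)))) (ℕₚ.+-identityʳ _)

∧-zero₂ : ∀ a b → a ∧ b ∧ false ≡ false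
∧-zero₂ a b = trans (cong (a ∧_) (𝔹ₚ.∧-zeroʳ b)) (𝔹ₚ.∧-zeroʳ a)

-- An arc leaving the head y ends at the next y in w; it crosses the arc of x exactly if x occurs
-- before that. If y is x, the arc of x ends at the head, and no arc can start strictly inside it.
sum-crossings : ∀ m x w →
  sum₃ (length w) (λ b c d → (b <ᵇ c) ∧ (c <ᵇ d) ∧ firstAt x w c ∧ isArc m w b d) ≡ crossings x w
sum-crossings m x []      = refl
sum-crossings m x (y ∷ w) = begin
  sum₃ (suc n) (P (y ∷ w))
    ≡⟨ sum₃-suc n (P (y ∷ w)) (λ _ _ → refl) (λ b c → 𝔹ₚ.∧-zeroʳ (b <ᵇ c)) ⟩
  sum₂ (suc n) (P (y ∷ w) 0) + sum₃ n (λ b c d → P (y ∷ w) (suc b) (suc c) (suc d))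
    ≡⟨ cong₂ _+_
         (trans (sum₂-suc n (P (y ∷ w) 0) (λ _ → refl))
           (trans (cong (_+ sum₂ n (λ c d → P (y ∷ w) 0 (suc c) (suc d))) (count<-zero (suc n) (λ _ → refl)))
             (sum₂-cong n (λ c d → cong₂ (λ s t → (c <ᵇ d) ∧ s ∧ t) (firstAt-suc x y w c) (isArc-zero m y w d)))))
         (sum₃-cong n (λ b c d → cong₂ (λ s t → (b <ᵇ c) ∧ (c <ᵇ d) ∧ s ∧ t) (firstAt-suc x y w c) (isArc-suc m m y w b d))) ⟩
  sum₂ n (λ c d → (c <ᵇ d) ∧ (not (y ≡ᵇ x) ∧ firstAt x w c) ∧ firstAt y w d) +
  sum₃ n (λ b c d → (b <ᵇ c) ∧ (c <ᵇ d) ∧ (not (y ≡ᵇ x) ∧ firstAt x w c) ∧ isArc m w b d)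
    ≡⟨ cases ⟩
  crossings x (y ∷ w) ∎
  where
  n = length w
  P : List ℕ → ℕ → ℕ → ℕ → Bool
  P w b c d = (b <ᵇ c) ∧ (c <ᵇ d) ∧ firstAt x w c ∧ isArc m w b d
  cases : sum₂ n (λ c d → (c <ᵇ d) ∧ (not (y ≡ᵇ x) ∧ firstAt x w c) ∧ firstAt y w d) +
          sum₃ n (λ b c d → (b <ᵇ c) ∧ (c <ᵇ d) ∧ (not (y ≡ᵇ x) ∧ firstAt x w c) ∧ isArc m w b d)
          ≡ (if y ≡ᵇ x then 0 else 𝟙 (before x y w) + crossings x w)
  cases with y <ᵇ x | x <ᵇ y | y ≡ᵇ x | x ≡ᵇ y | order y x
  ... | _ | _ | _ | _ | less lt    = cong₂ _+_ (sum-before (ℕₚ.<⇒≢ lt ∘ sym) w) (sum-crossings m x w)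
  ... | _ | _ | _ | _ | greater gt = cong₂ _+_ (sum-before (ℕₚ.<⇒≢ gt) w) (sum-crossings m x w)
  ... | _ | _ | _ | _ | equal _    = cong₂ _+_ (sum₂-zero n (λ c d → 𝔹ₚ.∧-zeroʳ (c <ᵇ d))) (sum₃-zero n (λ b c d → ∧-zero₂ (b <ᵇ c) (c <ᵇ d)))

cro-croᵣ : ∀ w → cro (length w) w ≡ croᵣ w
cro-croᵣ []      = refl
cro-croᵣ (x ∷ w) = begin
  sum₄ (suc n) (P (suc n) (x ∷ w))
    ≡⟨ sum₄-suc n (P (suc n) (x ∷ w)) (λ _ _ _ → refl) (λ a b d → 𝔹ₚ.∧-zeroʳ (a <ᵇ b)) (λ a b c → ∧-zero₂ (a <ᵇ b) (b <ᵇ c)) ⟩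
  sum₃ (suc n) (P (suc n) (x ∷ w) 0) + sum₄ n (λ a b c d → P (suc n) (x ∷ w) (suc a) (suc b) (suc c) (suc d))
    ≡⟨ cong₂ _+_
         (trans (sum₃-suc n (P (suc n) (x ∷ w) 0) (λ _ _ → refl) (λ b c → 𝔹ₚ.∧-zeroʳ (b <ᵇ c)))
           (trans (cong (_+ sum₃ n (λ b c d → P (suc n) (x ∷ w) 0 (suc b) (suc c) (suc d))) (sum₂-zero (suc n) (λ _ _ → refl)))
             (sum₃-cong n (λ b c d → cong₂ (λ s t → (b <ᵇ c) ∧ (c <ᵇ d) ∧ s ∧ t) (isArc-zero (suc n) x w c) (isArc-suc (suc n) n x w b d)))))
         (sum₄-cong n (λ a b c d → cong₂ (λ s t → (a <ᵇ b) ∧ (b <ᵇ c) ∧ (c <ᵇ d) ∧ s ∧ t) (isArc-suc (suc n) n x w a c) (isArc-suc (suc n) n x w b d))) ⟩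
  sum₃ n (λ b c d → (b <ᵇ c) ∧ (c <ᵇ d) ∧ firstAt x w c ∧ isArc n w b d) + cro n w
    ≡⟨ cong₂ _+_ (sum-crossings n x w) (cro-croᵣ w) ⟩
  croᵣ (x ∷ w) ∎
  where
  n = length w
  P : ℕ → List ℕ → ℕ → ℕ → ℕ → ℕ → Bool
  P n w a b c d = (a <ᵇ b) ∧ (b <ᵇ c) ∧ (c <ᵇ d) ∧ isArc n w a c ∧ isArc n w b d

-- The definition splits off the highest power; here it is the constant term, as suits a sum over a
-- list of open blocks that begins with index 0.
bracket-suc : ∀ q h → bracket q (suc h) ≡ 1ℤ ⊕ q ⊗ bracket q h
bracket-suc q zero    = sym (cong (1ℤ ⊕_) (ℤₚ.*-zeroʳ q))
bracket-suc q (suc h) = trans (cong (q ^ suc h ⊕_) (bracket-suc q h)) (collect q (q ^ h) (bracket q h))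
  where
  collect : ∀ q x b → q ⊗ x ⊕ (1ℤ ⊕ q ⊗ b) ≡ 1ℤ ⊕ q ⊗ (x ⊕ b)
  collect = solve-∀

∑-single : ∀ n y c → y < n → ∑ (upTo n) (λ x → if y ≡ᵇ x then c else 0ℤ) ≡ c
∑-single (suc n) zero    c _         = trans (∑-upTo-suc n (λ x → if 0 ≡ᵇ x then c else 0ℤ))
  (trans (cong (c ⊕_) (∑-zero (upTo n) (λ _ → refl))) (ℤₚ.+-identityʳ c))
∑-single (suc n) (suc y) c (s≤s y<n) = trans (∑-upTo-suc n (λ x → if suc y ≡ᵇ x then c else 0ℤ))
  (trans (ℤₚ.+-identityˡ _) (∑-single n y c y<n))

-- Open blocks and the crossings that they cause

index : ℕ → List ℕ → ℕ
index x []      = 0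
index x (y ∷ L) = if y ≡ᵇ x then 0 else suc (index x L)

delete : ℕ → List ℕ → List ℕ
delete x []      = []
delete x (y ∷ L) = if y ≡ᵇ x then L else y ∷ delete x L

absent⇒≢ : ∀ L {x} → occurs L x ≡ false → All (x ≢_) L
absent⇒≢ []      e = []
absent⇒≢ (y ∷ L) {x} e with y <ᵇ x | x <ᵇ y | y ≡ᵇ x | x ≡ᵇ y | order y x
... | _ | _ | _ | _ | less lt    = (ℕₚ.<⇒≢ lt ∘ sym) ∷ absent⇒≢ L e
... | _ | _ | _ | _ | greater gt = ℕₚ.<⇒≢ gt ∷ absent⇒≢ L e
absent⇒≢ (y ∷ L) {x} () | _ | _ | _ | _ | equal _

≢⇒absent : ∀ {L x} → All (x ≢_) L → occurs L x ≡ false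
≢⇒absent []        = refl
≢⇒absent {y ∷ L} {x} (x≢y ∷ a) = cong₂ _∨_ (≢⇒≡ᵇ-false (x≢y ∘ sym)) (≢⇒absent a)

delete-All : ∀ {P : ℕ → Set} x {L} → All P L → All P (delete x L)
delete-All x []              = []
delete-All x {y ∷ L} (p ∷ a) with y ≡ᵇ x
... | true  = a
... | false = p ∷ delete-All x a

delete-Unique : ∀ x {L} → Unique L → Unique (delete x L)
delete-Unique x []              = []
delete-Unique x {y ∷ L} (a ∷ u) with y ≡ᵇ x
... | true  = u
... | false = delete-All x a ∷ delete-Unique x u

delete-≢ : ∀ x {L} → Unique L → All (x ≢_) (delete x L)
delete-≢ x []              = []
delete-≢ x {y ∷ L} (a ∷ u) with y <ᵇ x | x <ᵇ y | y ≡ᵇ x | x ≡ᵇ y | order y x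
... | _ | _ | _ | _ | less lt    = (ℕₚ.<⇒≢ lt ∘ sym) ∷ delete-≢ x u
... | _ | _ | _ | _ | greater gt = ℕₚ.<⇒≢ gt ∷ delete-≢ x u
... | _ | _ | _ | _ | equal refl = a

delete-length : ∀ x L → occurs L x ≡ true → length L ≡ suc (length (delete x L))
delete-length x (y ∷ L) e with y ≡ᵇ x
... | true  = refl
... | false = cong suc (delete-length x L e)

delete-occurs : ∀ {x y} L → y ≢ x → occurs (delete x L) y ≡ occurs L y
delete-occurs         []      y≢x = refl
delete-occurs {x} {y} (z ∷ L) y≢x with z <ᵇ x | x <ᵇ z | z ≡ᵇ x | x ≡ᵇ z | order z x
... | _ | _ | _ | _ | less _     = cong ((z ≡ᵇ y) ∨_) (delete-occurs L y≢x)
... | _ | _ | _ | _ | greater _  = cong ((z ≡ᵇ y) ∨_) (delete-occurs L y≢x)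
... | _ | _ | _ | _ | equal refl = cong (_∨ occurs L y) (sym (≢⇒≡ᵇ-false (y≢x ∘ sym)))

-- The labels of L, most recent first, are those of the open blocks before w is read; entangled counts the
-- crossings whose second arc ends in w.
crossings* : List ℕ → List ℕ → ℕ
crossings* []      w = 0
crossings* (x ∷ L) w = crossings x w + crossings* L w

befores : ℕ → List ℕ → List ℕ → ℕ
befores x []      w = 0
befores x (y ∷ L) w = 𝟙 (before y x w) + befores x L w

befores* : List ℕ → List ℕ → ℕ
befores* []      w = 0
befores* (x ∷ L) w = befores x L w + befores* L w

entangled : List ℕ → List ℕ → ℕ
entangled L w = croᵣ w + (crossings* L w + befores* L w)

before-≢ : ∀ {x y z} w → z ≢ x → z ≢ y → before x y (z ∷ w) ≡ before x y w
before-≢ {x} {y} {z} w z≢x z≢y rewrite ≢⇒≡ᵇ-false z≢x | ≢⇒≡ᵇ-false z≢y = refl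

before-second : ∀ {x y} w → x ≢ y → before x y (y ∷ w) ≡ false
before-second {x} {y} w x≢y rewrite ≢⇒≡ᵇ-false (x≢y ∘ sym) | ≡ᵇ-refl y = refl

before-absentˡ : ∀ x y w → occurs w x ≡ false → before x y w ≡ false
before-absentˡ x y []      e = refl
before-absentˡ x y (z ∷ w) e with z ≡ᵇ x | z ≡ᵇ y
before-absentˡ x y (z ∷ w) () | true  | _
before-absentˡ x y (z ∷ w) e  | false | true  = refl
before-absentˡ x y (z ∷ w) e  | false | false = before-absentˡ x y w e

before-absentʳ : ∀ x y w → occurs w y ≡ false → before x y w ≡ false
before-absentʳ x y []      e = refl
before-absentʳ x y (z ∷ w) e with z ≡ᵇ x | z ≡ᵇ y
before-absentʳ x y (z ∷ w) () | _     | true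
before-absentʳ x y (z ∷ w) e  | true  | false = e
before-absentʳ x y (z ∷ w) e  | false | false = before-absentʳ x y w e

crossings-absent : ∀ x w → occurs w x ≡ false → crossings x w ≡ 0
crossings-absent x []      e = refl
crossings-absent x (y ∷ w) e with y ≡ᵇ x
crossings-absent x (y ∷ w) () | true
crossings-absent x (y ∷ w) e  | false = cong₂ _+_ (cong 𝟙 (before-absentˡ x y w e)) (crossings-absent x w e)

befores-absent : ∀ x L w → occurs w x ≡ false → befores x L w ≡ 0
befores-absent x []      w e = refl
befores-absent x (y ∷ L) w e = cong₂ _+_ (cong 𝟙 (before-absentʳ y x w e)) (befores-absent x L w e)

entangled-absent : ∀ x L w → occurs w x ≡ false → entangled (x ∷ L) w ≡ entangled L w
entangled-absent x L w e = cong₂ (λ s t → croᵣ w + (s + crossings* L w + (t + befores* L w)))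
  (crossings-absent x w e) (befores-absent x L w e)

crossings-≢ : ∀ {x y} w → x ≢ y → crossings y (x ∷ w) ≡ 𝟙 (before y x w) + crossings y w
crossings-≢ {x} {y} w x≢y rewrite ≢⇒≡ᵇ-false x≢y = refl

crossings*-∉ : ∀ {x L} w → All (x ≢_) L → crossings* L (x ∷ w) ≡ befores x L w + crossings* L w
crossings*-∉             w []        = refl
crossings*-∉ {x} {y ∷ L} w (x≢y ∷ a) = trans (cong₂ _+_ (crossings-≢ w x≢y) (crossings*-∉ w a))
  (+-interchange (𝟙 (before y x w)) (crossings y w) (befores x L w) (crossings* L w))

befores-∉ : ∀ {x z L} w → x ≢ z → All (x ≢_) L → befores z L (x ∷ w) ≡ befores z L w
befores-∉ w x≢z []        = refl
befores-∉ w x≢z (x≢y ∷ a) = cong₂ _+_ (cong 𝟙 (before-≢ w x≢y x≢z)) (befores-∉ w x≢z a)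

befores-self : ∀ {x L} w → All (x ≢_) L → befores x L (x ∷ w) ≡ 0
befores-self w []        = refl
befores-self w (x≢y ∷ a) = cong₂ _+_ (cong 𝟙 (before-second w (x≢y ∘ sym))) (befores-self w a)

befores*-∉ : ∀ {x L} w → All (x ≢_) L → befores* L (x ∷ w) ≡ befores* L w
befores*-∉ w []        = refl
befores*-∉ w (x≢y ∷ a) = cong₂ _+_ (befores-∉ w x≢y a) (befores*-∉ w a)

entangled-new : ∀ {x L} w → All (x ≢_) L → entangled L (x ∷ w) ≡ entangled (x ∷ L) w
entangled-new {x} {L} w a = trans
  (cong₂ (λ s t → crossings x w + croᵣ w + (s + t)) (crossings*-∉ w a) (befores*-∉ w a))
  (arith (crossings x w) (croᵣ w) (befores x L w) (crossings* L w) (befores* L w))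
  where
  arith : ∀ n c b m p → n + c + (b + m + p) ≡ c + (n + m + (b + p))
  arith = solveℕ-∀

crossings*-∈ : ∀ x L w → Unique L → occurs L x ≡ true →
               crossings* L (x ∷ w) ≡ befores x (delete x L) w + crossings* (delete x L) w
crossings*-∈ x (y ∷ L) w (a ∷ u) e with y <ᵇ x | x <ᵇ y | y ≡ᵇ x | x ≡ᵇ y | order y x
... | _ | _ | _ | _ | less lt    = trans (cong (𝟙 (before y x w) + crossings y w +_) (crossings*-∈ x L w u e))
  (+-interchange (𝟙 (before y x w)) (crossings y w) _ _)
... | _ | _ | _ | _ | greater gt = trans (cong (𝟙 (before y x w) + crossings y w +_) (crossings*-∈ x L w u e))
  (+-interchange (𝟙 (before y x w)) (crossings y w) _ _)
... | _ | _ | _ | _ | equal refl = crossings*-∉ w a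

-- The head x precedes the next z, which exists by the last hypothesis, and this pair gives the 1.
-- Comparisons of z with other labels of L ignore the head.
befores-∈ : ∀ x z L w → Unique L → occurs L x ≡ true → x ≢ z → occurs w z ≡ true →
            befores z L (x ∷ w) ≡ suc (befores z (delete x L) w)
befores-∈ x z (y ∷ L) w (a ∷ u) e x≢z o = cases
  where
  later : y ≢ x → occurs L x ≡ true → befores z (y ∷ L) (x ∷ w) ≡ suc (𝟙 (before y z w) + befores z (delete x L) w)
  later y≢x e = trans
    (cong₂ _+_ (cong 𝟙 (before-≢ w (y≢x ∘ sym) x≢z)) (befores-∈ x z L w u e x≢z o))
    (ℕₚ.+-suc (𝟙 (before y z w)) (befores z (delete x L) w))
  cases : befores z (y ∷ L) (x ∷ w) ≡ suc (befores z (delete x (y ∷ L)) w)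
  cases with y ≟ x
  ... | yes refl rewrite ≡ᵇ-refl y = cong₂ _+_ (cong 𝟙 o) (befores-∉ w x≢z a)
  ... | no y≢x = trans (later y≢x (trans (sym (cong (_∨ occurs L x) (≢⇒≡ᵇ-false y≢x))) e))
                       (cong (λ b → suc (befores z (if b then L else y ∷ delete x L) w)) (sym (≢⇒≡ᵇ-false y≢x)))

befores*-∈ : ∀ x L w → Unique L → occurs L x ≡ true → All (λ y → y ≢ x → occurs w y ≡ true) L →
             befores* L (x ∷ w) ≡ index x L + befores* (delete x L) w
befores*-∈ x (y ∷ L) w (a ∷ u) e (o ∷ os) = cases
  where
  arith : ∀ b i p → suc b + (i + p) ≡ suc i + (b + p)
  arith = solveℕ-∀
  later : y ≢ x → occurs L x ≡ true → befores y L (x ∷ w) + befores* L (x ∷ w)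
                  ≡ suc (index x L) + (befores y (delete x L) w + befores* (delete x L) w)
  later y≢x e = trans
    (cong₂ _+_ (befores-∈ x y L w u e (y≢x ∘ sym) (o y≢x)) (befores*-∈ x L w u e os))
    (arith (befores y (delete x L) w) (index x L) (befores* (delete x L) w))
  cases : befores* (y ∷ L) (x ∷ w) ≡ index x (y ∷ L) + befores* (delete x (y ∷ L)) w
  cases with y ≟ x
  ... | yes refl rewrite ≡ᵇ-refl y = cong₂ _+_ (befores-self w a) (befores*-∉ w a)
  ... | no y≢x = trans (later y≢x (trans (sym (cong (_∨ occurs L x) (≢⇒≡ᵇ-false y≢x))) e))
    (cong (λ b → (if b then 0 else suc (index x L)) + befores* (if b then L else y ∷ delete x L) w) (sym (≢⇒≡ᵇ-false y≢x)))

-- The arc that ends at x is crossed by the next arc of every block ahead of x in L: that arc starts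
-- later, and it ends in w by the last hypothesis. The block of x then becomes the most recent one.
entangled-old : ∀ x L w → Unique L → occurs L x ≡ true → All (λ y → y ≢ x → occurs w y ≡ true) L →
                entangled L (x ∷ w) ≡ index x L + entangled (x ∷ delete x L) w
entangled-old x L w u e os = trans
  (cong₂ (λ s t → crossings x w + croᵣ w + (s + t)) (crossings*-∈ x L w u e) (befores*-∈ x L w u e os))
  (arith (crossings x w) (croᵣ w) (befores x (delete x L) w) (crossings* (delete x L) w) (index x L) (befores* (delete x L) w))
  where
  arith : ∀ n c b m i p → n + c + (b + m + (i + p)) ≡ i + (c + (n + m + (b + p)))
  arith = solveℕ-∀

-- Consistency of the open blocks with the remaining word

all<-cong< : ∀ n {p p′ : ℕ → Bool} → (∀ i → i < n → p i ≡ p′ i) → all< n p ≡ all< n p′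
all<-cong< zero    e = refl
all<-cong< (suc n) {p} {p′} e = trans (all<-suc n p)
  (trans (cong₂ _∧_ (e 0 (s≤s z≤n)) (all<-cong< n (λ i i<n → e (suc i) (s≤s i<n)))) (sym (all<-suc n p′)))

all<-true : ∀ n {p} → all< n p ≡ true → ∀ i → i < n → p i ≡ true
all<-true (suc n) {p} e zero    _         = proj₁ (∧-true (trans (sym (all<-suc n p)) e))
all<-true (suc n) {p} e (suc i) (s≤s i<n) =
  all<-true n {p ∘ suc} (proj₂ (∧-true {p 0} (trans (sym (all<-suc n p)) e))) i i<n

all<-extract : ∀ n x p → x < n → all< n p ≡ all< n (λ y → (x ≡ᵇ y) ∨ p y) ∧ p x
all<-extract (suc n) zero    p _         = trans (all<-suc n p)
  (trans (𝔹ₚ.∧-comm (p 0) (all< n (p ∘ suc))) (cong (_∧ p 0) (sym (all<-suc n (λ y → (0 ≡ᵇ y) ∨ p y)))))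
all<-extract (suc n) (suc x) p (s≤s x<n) = trans (all<-suc n p)
  (trans (cong (p 0 ∧_) (all<-extract n x (p ∘ suc) x<n))
    (trans (sym (𝔹ₚ.∧-assoc (p 0) _ (p (suc x)))) (cong (_∧ p (suc x)) (sym (all<-suc n (λ y → (suc x ≡ᵇ y) ∨ p y))))))

all<-last : ∀ n p → all< (suc n) p ≡ all< n p ∧ p n
all<-last zero    p = 𝔹ₚ.∧-identityʳ (p 0)
all<-last (suc n) p = trans (all<-suc (suc n) p)
  (trans (cong (p 0 ∧_) (all<-last n (p ∘ suc)))
    (trans (sym (𝔹ₚ.∧-assoc (p 0) _ (p (suc n)))) (cong (_∧ p (suc n)) (sym (all<-suc n p)))))

all<-below : ∀ n r → all< n (λ c → (c <ᵇ r) ∨ false) ≡ not (r <ᵇ n)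
all<-below zero    r       = refl
all<-below (suc n) zero    = all<-suc n (λ c → (c <ᵇ 0) ∨ false)
all<-below (suc n) (suc r) = trans (all<-suc n (λ c → (c <ᵇ suc r) ∨ false)) (all<-below n r)

≢⇒∨ : ∀ {x y b b′} → (y ≢ x → b ≡ b′) → (x ≡ᵇ y) ∨ b ≡ (x ≡ᵇ y) ∨ b′
≢⇒∨ {x} {y} e with x <ᵇ y | y <ᵇ x | x ≡ᵇ y | y ≡ᵇ x | order x y
... | _ | _ | _ | _ | less lt    = e (ℕₚ.<⇒≢ lt ∘ sym)
... | _ | _ | _ | _ | greater gt = e (ℕₚ.<⇒≢ gt)
... | _ | _ | _ | _ | equal _    = refl

agree : Bool → Bool → Bool
agree a b = if b then a else not a

active : ℕ → List ℕ → List ℕ → Bool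
active r L w = all< r (λ y → agree (occurs w y) (occurs L y))

activeExcept : ℕ → ℕ → List ℕ → List ℕ → Bool
activeExcept x r L w = all< r (λ y → (x ≡ᵇ y) ∨ agree (occurs w y) (occurs L y))

-- Reading x changes the list and the word at the label x only. All situations compared below
-- therefore share `activeExcept x`, and the condition at x alone distinguishes a block kept open
-- from a closed one.
active-extract : ∀ {x r} L L′ w w′ → x < r → (∀ {y} → y ≢ x → occurs L′ y ≡ occurs L y) →
                 (∀ {y} → y ≢ x → occurs w′ y ≡ occurs w y) →
                 active r L′ w′ ≡ activeExcept x r L w ∧ agree (occurs w′ x) (occurs L′ x)
active-extract {x} {r} L L′ w w′ x<r eL ew = trans
  (all<-extract r x (λ y → agree (occurs w′ y) (occurs L′ y)) x<r)
  (cong (_∧ agree (occurs w′ x) (occurs L′ x)) (all<-cong r (λ y → ≢⇒∨ (λ y≢x → cong₂ agree (ew y≢x) (eL y≢x)))))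

occurs-∷-≢ : ∀ {x y} w → y ≢ x → occurs (x ∷ w) y ≡ occurs w y
occurs-∷-≢ {x} {y} w y≢x = cong (_∨ occurs w y) (≢⇒≡ᵇ-false (y≢x ∘ sym))

occurs-∷-≡ : ∀ x w → occurs (x ∷ w) x ≡ true
occurs-∷-≡ x w = cong (_∨ occurs w x) (≡ᵇ-refl x)

occurs-self : ∀ L → All (λ y → occurs L y ≡ true) L
occurs-self []      = []
occurs-self (x ∷ L) = occurs-∷-≡ x L ∷ All.map (λ {y} e → trans (cong ((x ≡ᵇ y) ∨_) e) (𝔹ₚ.∨-zeroʳ (x ≡ᵇ y))) (occurs-self L)

occurs-All : ∀ {P : ℕ → Set} {L} x → All P L → occurs L x ≡ true → P x
occurs-All {P} {y ∷ L} x (p ∷ a) e with y <ᵇ x | x <ᵇ y | y ≡ᵇ x | x ≡ᵇ y | order y x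
... | _ | _ | _ | _ | less _     = occurs-All x a e
... | _ | _ | _ | _ | greater _  = occurs-All x a e
... | _ | _ | _ | _ | equal refl = p

activeExcept-all : ∀ x r L w → All (_< r) L → activeExcept x r L w ≡ true → All (λ y → y ≢ x → occurs w y ≡ true) L
activeExcept-all x r L w bound e = All.zipWith (λ {y} → each y) (bound , occurs-self L)
  where
  each : ∀ y → (y < r × occurs L y ≡ true) → y ≢ x → occurs w y ≡ true
  each y (y<r , o) y≢x with all<-true r {λ y → (x ≡ᵇ y) ∨ agree (occurs w y) (occurs L y)} e y y<r
  ... | t rewrite ≢⇒≡ᵇ-false (y≢x ∘ sym) | o = t

-- From canonical labellings to the recursion for `Z`

module Partitions (q : ℤ) (k : ℕ) where
  open Paths (bracket q)

  -- Restricted growth words, continued after r labels have been used.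
  growth : ℕ → List ℕ → Bool
  growth r []      = r ≡ᵇ k
  growth r (x ∷ w) = if x <ᵇ r then growth r w else (if r ≡ᵇ x then growth (suc r) w else false)

  -- Labels below r count as already seen, which makes an induction on the word possible; r = 0 is
  -- the original condition.
  surjective canonical : ℕ → List ℕ → Bool
  surjective r w = all< k (λ c → (c <ᵇ r) ∨ occurs w c)
  canonical  r w = all< (length w) (λ i → all< (at w i) (λ c → (c <ᵇ r) ∨ any< i (λ j → at w j ≡ᵇ c)))

  -- The hypothesis says that x together with the labels below r makes up the labels below r′: an
  -- old label has r′ = r, a new one r′ = `suc r`.
  canonical-∷ : ∀ r r′ x w → (∀ c b → (c <ᵇ r) ∨ ((x ≡ᵇ c) ∨ b) ≡ (c <ᵇ r′) ∨ b) →
                canonical r (x ∷ w) ≡ not (r <ᵇ x) ∧ canonical r′ w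
  canonical-∷ r r′ x w e = trans
    (all<-suc (length w) (λ i → all< (at (x ∷ w) i) (λ c → (c <ᵇ r) ∨ any< i (λ j → at (x ∷ w) j ≡ᵇ c))))
    (cong₂ _∧_ (all<-below x r) (all<-cong (length w) (λ i → all<-cong (at w i) (λ c →
      trans (cong ((c <ᵇ r) ∨_) (any<-suc i (λ j → at (x ∷ w) j ≡ᵇ c))) (e c (any< i (λ j → at w j ≡ᵇ c)))))))

  growth-correct : ∀ w r → r ≤ k → All (_< k) w → surjective r w ∧ canonical r w ≡ growth r w
  growth-correct []      r r≤k bound = trans (𝔹ₚ.∧-identityʳ _) (trans (all<-below k r) cases)
    where
    cases : not (r <ᵇ k) ≡ (r ≡ᵇ k)
    cases with r <ᵇ k | k <ᵇ r | r ≡ᵇ k | k ≡ᵇ r | order r k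
    ... | _ | _ | _ | _ | less _     = refl
    ... | _ | _ | _ | _ | equal _    = refl
    ... | _ | _ | _ | _ | greater gt = contradiction gt (ℕₚ.≤⇒≯ r≤k)
  growth-correct (x ∷ w) r r≤k (x<k ∷ bound) with x <ᵇ r in lt? | r <ᵇ x in gt? | x ≡ᵇ r | r ≡ᵇ x | order x r
  ... | _ | _ | _ | _ | less x<r = trans
    (cong₂ _∧_ (all<-cong k (λ c → absorb c (occurs w c))) (trans (canonical-∷ r r x w absorb) (cong (λ b → not b ∧ canonical r w) gt?)))
    (growth-correct w r r≤k bound)
    where
    absorb : ∀ c b → (c <ᵇ r) ∨ ((x ≡ᵇ c) ∨ b) ≡ (c <ᵇ r) ∨ b
    absorb c b with x <ᵇ c | c <ᵇ x | x ≡ᵇ c | c ≡ᵇ x | order x c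
    ... | _ | _ | _ | _ | less _     = refl
    ... | _ | _ | _ | _ | greater _  = refl
    ... | _ | _ | _ | _ | equal refl rewrite lt? = refl
  ... | _ | _ | _ | _ | equal refl = trans
    (cong₂ _∧_ (all<-cong k (λ c → absorb c (occurs w c))) (trans (canonical-∷ r (suc r) r w absorb) (cong (λ b → not b ∧ canonical (suc r) w) gt?)))
    (growth-correct w (suc r) x<k bound)
    where
    step : ∀ r c → (c <ᵇ suc r) ≡ (c <ᵇ r) ∨ (r ≡ᵇ c)
    step zero    zero    = refl
    step zero    (suc c) = refl
    step (suc r) zero    = refl
    step (suc r) (suc c) = step r c
    absorb : ∀ c b → (c <ᵇ r) ∨ ((r ≡ᵇ c) ∨ b) ≡ (c <ᵇ suc r) ∨ b
    absorb c b = trans (sym (𝔹ₚ.∨-assoc (c <ᵇ r) (r ≡ᵇ c) b)) (cong (_∨ b) (sym (step r c)))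
  ... | _ | _ | _ | _ | greater _ = trans
    (cong (surjective r (x ∷ w) ∧_) (trans (all<-suc (length w) (λ i → all< (at (x ∷ w) i) (λ c → (c <ᵇ r) ∨ any< i (λ j → at (x ∷ w) j ≡ᵇ c))))
      (cong (_∧ all< (length w) (λ i → all< (at w i) (λ c → (c <ᵇ r) ∨ any< (suc i) (λ j → at (x ∷ w) j ≡ᵇ c)))) (trans (all<-below x r) (cong not gt?)))))
    (𝔹ₚ.∧-zeroʳ (surjective r (x ∷ w)))

  -- The first letter either is that of an open block or opens a new block; then the block is kept open or closed.
  V : ℕ → List ℕ → List ℕ → ℤ
  V r L []      = if (r ≡ᵇ k) ∧ null L then 1ℤ else 0ℤ
  V r L (x ∷ w) =
    if occurs L x then q ^ index x L ⊗ (V r (x ∷ delete x L) w ⊕ V r (delete x L) w)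
    else (if r ≡ᵇ x then V (suc r) (x ∷ L) w ⊕ V (suc r) L w else 0ℤ)

  value : ℕ → List ℕ → List ℕ → ℤ
  value r L w = if growth r w ∧ active r L w then q ^ entangled L w else 0ℤ

  -- The Boolean o tells whether x occurs again. Keeping its block open is consistent only if it
  -- does, closing it only if it does not, so exactly one of the two terms can survive.
  choose : ∀ g a o {i e₀ e₁ e₂} → (a ≡ true → e₀ ≡ i + e₁) → (o ≡ false → e₁ ≡ e₂) →
           q ^ i ⊗ ((if g ∧ (a ∧ o) then q ^ e₁ else 0ℤ) ⊕ (if g ∧ (a ∧ not o) then q ^ e₂ else 0ℤ))
           ≡ (if g ∧ a then q ^ e₀ else 0ℤ)
  choose false a     o     {i} p₁ p₂ = ℤₚ.*-zeroʳ (q ^ i)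
  choose true  false o     {i} p₁ p₂ = ℤₚ.*-zeroʳ (q ^ i)
  choose true  true  true  {i} {e₀} {e₁} p₁ p₂ = trans (cong (q ^ i ⊗_) (ℤₚ.+-identityʳ (q ^ e₁)))
    (trans (sym (ℤₚ.^-distribˡ-+-* q i e₁)) (cong (q ^_) (sym (p₁ refl))))
  choose true  true  false {i} {e₀} {e₁} {e₂} p₁ p₂ = trans (cong (q ^ i ⊗_) (ℤₚ.+-identityˡ (q ^ e₂)))
    (trans (sym (ℤₚ.^-distribˡ-+-* q i e₂)) (cong (q ^_) (trans (cong (i +_) (sym (p₂ refl))) (sym (p₁ refl)))))

  -- `V` guesses after each letter whether its block continues. For a fixed word only the guesses
  -- that agree with later occurrences survive, and along them the indices add up to the number of
  -- crossings.
  V-value : ∀ w r L → Unique L → All (_< r) L → V r L w ≡ value r L w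
  V-value []      r []      u bound = cong (λ b → if (r ≡ᵇ k) ∧ b then 1ℤ else 0ℤ) (sym (trivially r))
    where
    trivially : ∀ r → all< r (λ _ → true) ≡ true
    trivially zero    = refl
    trivially (suc r) = trans (all<-suc r (λ _ → true)) (trivially r)
  V-value []      r (y ∷ L) u (y<r ∷ bound) = trans
    (cong (λ b → if b then 1ℤ else 0ℤ) (𝔹ₚ.∧-zeroʳ (r ≡ᵇ k)))
    (cong (λ b → if b then q ^ entangled (y ∷ L) [] else 0ℤ)
      (sym (trans (cong ((r ≡ᵇ k) ∧_) inactive) (𝔹ₚ.∧-zeroʳ (r ≡ᵇ k)))))
    where
    inactive : active r (y ∷ L) [] ≡ false
    inactive = trans (active-extract (y ∷ L) (y ∷ L) [] [] y<r (λ _ → refl) (λ _ → refl))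
      (trans (cong (λ b → activeExcept y r (y ∷ L) [] ∧ agree false b) (occurs-∷-≡ y L)) (𝔹ₚ.∧-zeroʳ _))
  V-value (x ∷ w) r L u bound with occurs L x in o
  ... | true = begin
    q ^ index x L ⊗ (V r (x ∷ delete x L) w ⊕ V r (delete x L) w)
      ≡⟨ cong₂ (λ s t → q ^ index x L ⊗ (s ⊕ t)) (V-value w r (x ∷ delete x L) (delete-≢ x u ∷ delete-Unique x u) (x<r ∷ delete-All x bound))
                                                 (V-value w r (delete x L) (delete-Unique x u) (delete-All x bound)) ⟩
    q ^ index x L ⊗ (value r (x ∷ delete x L) w ⊕ value r (delete x L) w)
      ≡⟨ cong₂ (λ s t → q ^ index x L ⊗ ((if growth r w ∧ s then q ^ entangled (x ∷ delete x L) w else 0ℤ) ⊕ (if growth r w ∧ t then q ^ entangled (delete x L) w else 0ℤ)))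
           (trans (active-extract L (x ∷ delete x L) w w x<r (λ y≢x → trans (occurs-∷-≢ (delete x L) y≢x) (delete-occurs L y≢x)) (λ _ → refl))
                  (cong (λ b → activeExcept x r L w ∧ agree (occurs w x) b) (occurs-∷-≡ x (delete x L))))
           (trans (active-extract L (delete x L) w w x<r (delete-occurs L) (λ _ → refl))
                  (cong (λ b → activeExcept x r L w ∧ agree (occurs w x) b) (≢⇒absent (delete-≢ x u)))) ⟩
    q ^ index x L ⊗ ((if growth r w ∧ (activeExcept x r L w ∧ occurs w x) then q ^ entangled (x ∷ delete x L) w else 0ℤ) ⊕
                     (if growth r w ∧ (activeExcept x r L w ∧ not (occurs w x)) then q ^ entangled (delete x L) w else 0ℤ))
      ≡⟨ choose (growth r w) (activeExcept x r L w) (occurs w x) {index x L}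
           (λ a → entangled-old x L w u o (activeExcept-all x r L w bound a)) (entangled-absent x (delete x L) w) ⟩
    (if growth r w ∧ activeExcept x r L w then q ^ entangled L (x ∷ w) else 0ℤ)
      ≡⟨ cong₂ (λ g a → if g ∧ a then q ^ entangled L (x ∷ w) else 0ℤ) grows
           (trans (active-extract L L w (x ∷ w) x<r (λ _ → refl) (occurs-∷-≢ w))
             (trans (cong₂ (λ b c → activeExcept x r L w ∧ agree b c) (occurs-∷-≡ x w) o) (𝔹ₚ.∧-identityʳ _))) ⟨
    value r L (x ∷ w) ∎
    where
    x<r : x < r
    x<r = occurs-All x bound o
    grows : growth r (x ∷ w) ≡ growth r w
    grows with x <ᵇ r | r <ᵇ x | x ≡ᵇ r | r ≡ᵇ x | order x r
    ... | _ | _ | _ | _ | less _      = refl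
    ... | _ | _ | _ | _ | greater r<x = contradiction r<x (ℕₚ.<⇒≯ x<r)
    ... | _ | _ | _ | _ | equal x≡r   = contradiction x≡r (ℕₚ.<⇒≢ x<r)
  ... | false with x <ᵇ r | r <ᵇ x | x ≡ᵇ r | r ≡ᵇ x | order x r
  ...   | _ | _ | _ | _ | greater _  = refl
  ...   | _ | _ | _ | _ | less x<r   = cong (λ b → if b then q ^ entangled L (x ∷ w) else 0ℤ) (sym (begin
    growth r w ∧ active r L (x ∷ w)
      ≡⟨ cong (growth r w ∧_) (active-extract L L w (x ∷ w) x<r (λ _ → refl) (occurs-∷-≢ w)) ⟩
    growth r w ∧ (activeExcept x r L w ∧ agree (occurs (x ∷ w) x) (occurs L x))
      ≡⟨ cong₂ (λ b c → growth r w ∧ (activeExcept x r L w ∧ agree b c)) (occurs-∷-≡ x w) o ⟩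
    growth r w ∧ (activeExcept x r L w ∧ false)
      ≡⟨ ∧-zero₂ (growth r w) (activeExcept x r L w) ⟩
    false ∎))
  ...   | _ | _ | _ | _ | equal refl = begin
    V (suc r) (r ∷ L) w ⊕ V (suc r) L w
      ≡⟨ cong₂ _⊕_ (V-value w (suc r) (r ∷ L) (absent⇒≢ L o ∷ u) (ℕₚ.n<1+n r ∷ All.map ℕₚ.m<n⇒m<1+n bound))
                   (V-value w (suc r) L u (All.map ℕₚ.m<n⇒m<1+n bound)) ⟩
    value (suc r) (r ∷ L) w ⊕ value (suc r) L w
      ≡⟨ cong₂ (λ s t → (if growth (suc r) w ∧ s then q ^ entangled (r ∷ L) w else 0ℤ) ⊕ (if growth (suc r) w ∧ t then q ^ entangled L w else 0ℤ))
           (trans (active-extract L (r ∷ L) w w (ℕₚ.n<1+n r) (occurs-∷-≢ L) (λ _ → refl))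
                  (cong (λ b → activeExcept r (suc r) L w ∧ agree (occurs w r) b) (occurs-∷-≡ r L)))
           (trans (active-extract L L w w (ℕₚ.n<1+n r) (λ _ → refl) (λ _ → refl))
                  (cong (λ b → activeExcept r (suc r) L w ∧ agree (occurs w r) b) o)) ⟩
    (if growth (suc r) w ∧ (activeExcept r (suc r) L w ∧ occurs w r) then q ^ entangled (r ∷ L) w else 0ℤ) ⊕
    (if growth (suc r) w ∧ (activeExcept r (suc r) L w ∧ not (occurs w r)) then q ^ entangled L w else 0ℤ)
      ≡⟨ ℤₚ.*-identityˡ _ ⟨
    1ℤ ⊗ ((if growth (suc r) w ∧ (activeExcept r (suc r) L w ∧ occurs w r) then q ^ entangled (r ∷ L) w else 0ℤ) ⊕
          (if growth (suc r) w ∧ (activeExcept r (suc r) L w ∧ not (occurs w r)) then q ^ entangled L w else 0ℤ))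
      ≡⟨ choose (growth (suc r) w) (activeExcept r (suc r) L w) (occurs w r) {0}
           (λ _ → entangled-new w (absent⇒≢ L o)) (entangled-absent r L w) ⟩
    (if growth (suc r) w ∧ activeExcept r (suc r) L w then q ^ entangled L (r ∷ w) else 0ℤ)
      ≡⟨ cong (λ a → if growth (suc r) w ∧ a then q ^ entangled L (r ∷ w) else 0ℤ) except ⟩
    (if growth (suc r) w ∧ active r L (r ∷ w) then q ^ entangled L (r ∷ w) else 0ℤ) ∎
    where
    except : activeExcept r (suc r) L w ≡ active r L (r ∷ w)
    except = begin
      activeExcept r (suc r) L w
        ≡⟨ all<-last r (λ y → (r ≡ᵇ y) ∨ agree (occurs w y) (occurs L y)) ⟩
      activeExcept r r L w ∧ ((r ≡ᵇ r) ∨ agree (occurs w r) (occurs L r))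
        ≡⟨ cong (λ b → activeExcept r r L w ∧ (b ∨ agree (occurs w r) (occurs L r))) (≡ᵇ-refl r) ⟩
      activeExcept r r L w ∧ true
        ≡⟨ 𝔹ₚ.∧-identityʳ _ ⟩
      activeExcept r r L w
        ≡⟨ all<-cong< r (λ y y<r → trans (cong (_∨ agree (occurs w y) (occurs L y)) (≢⇒≡ᵇ-false (ℕₚ.<⇒≢ y<r ∘ sym)))
                                         (cong (λ b → agree b (occurs L y)) (sym (occurs-∷-≢ w (ℕₚ.<⇒≢ y<r))))) ⟩
      active r L (r ∷ w) ∎

  ∑-index : ∀ c L → Unique L → All (_< k) L →
            ∑ (upTo k) (λ x → if occurs L x then q ^ index x L ⊗ c else 0ℤ) ≡ bracket q (length L) ⊗ c
  ∑-index c []      u bound = ∑-zero (upTo k) (λ _ → refl)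
  ∑-index c (y ∷ L) (a ∷ u) (y<k ∷ bound) = begin
    ∑ (upTo k) (λ x → if occurs (y ∷ L) x then q ^ index x (y ∷ L) ⊗ c else 0ℤ)
      ≡⟨ ∑-cong (upTo k) first ⟩
    ∑ (upTo k) (λ x → (if y ≡ᵇ x then c else 0ℤ) ⊕ q ⊗ (if occurs L x then q ^ index x L ⊗ c else 0ℤ))
      ≡⟨ ∑-⊕ (upTo k) (λ x → if y ≡ᵇ x then c else 0ℤ) (λ x → q ⊗ (if occurs L x then q ^ index x L ⊗ c else 0ℤ)) ⟩
    ∑ (upTo k) (λ x → if y ≡ᵇ x then c else 0ℤ) ⊕ ∑ (upTo k) (λ x → q ⊗ (if occurs L x then q ^ index x L ⊗ c else 0ℤ))
      ≡⟨ cong₂ _⊕_ (∑-single k y c y<k)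
           (trans (∑-⊗ˡ (upTo k) q (λ x → if occurs L x then q ^ index x L ⊗ c else 0ℤ)) (cong (q ⊗_) (∑-index c L u bound))) ⟩
    c ⊕ q ⊗ (bracket q (length L) ⊗ c)
      ≡⟨ collect q c (bracket q (length L)) ⟩
    (1ℤ ⊕ q ⊗ bracket q (length L)) ⊗ c
      ≡⟨ cong (_⊗ c) (bracket-suc q (length L)) ⟨
    bracket q (suc (length L)) ⊗ c ∎
    where
    collect : ∀ q c b → c ⊕ q ⊗ (b ⊗ c) ≡ (1ℤ ⊕ q ⊗ b) ⊗ c
    collect = solve-∀
    later : ∀ x → (if occurs L x then q ^ suc (index x L) ⊗ c else 0ℤ) ≡ 0ℤ ⊕ q ⊗ (if occurs L x then q ^ index x L ⊗ c else 0ℤ)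
    later x with occurs L x
    ... | true  = trans (ℤₚ.*-assoc q (q ^ index x L) c) (sym (ℤₚ.+-identityˡ _))
    ... | false = sym (trans (ℤₚ.+-identityˡ _) (ℤₚ.*-zeroʳ q))
    first : ∀ x → (if occurs (y ∷ L) x then q ^ index x (y ∷ L) ⊗ c else 0ℤ)
                  ≡ (if y ≡ᵇ x then c else 0ℤ) ⊕ q ⊗ (if occurs L x then q ^ index x L ⊗ c else 0ℤ)
    first x with y <ᵇ x | x <ᵇ y | y ≡ᵇ x | x ≡ᵇ y | order y x
    ... | _ | _ | _ | _ | less _     = later x
    ... | _ | _ | _ | _ | greater _  = later x
    ... | _ | _ | _ | _ | equal refl = trans (ℤₚ.*-identityˡ c) (sym (trans
      (cong (λ b → c ⊕ q ⊗ (if b then q ^ index x L ⊗ c else 0ℤ)) (≢⇒absent a))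
      (trans (cong (c ⊕_) (ℤₚ.*-zeroʳ q)) (ℤₚ.+-identityʳ c))))

  Zstay : ℕ → ℕ → ℕ → ℤ
  Zstay n κ zero    = 0ℤ
  Zstay n κ (suc h) = Z n κ (suc h) ⊕ Z n κ h

  Zold-bracket : ∀ n κ h → bracket q h ⊗ Zstay n κ h ≡ Zold n κ h
  Zold-bracket n κ zero    = refl
  Zold-bracket n κ (suc h) = refl

  -- Because continuation is guessed, the rest depends on L only through its length; the choice
  -- among the open blocks enters through the index of the letter alone and sums to `bracket q h`.
  ∑-V : ∀ n κ r L → r + κ ≡ k → Unique L → All (_< r) L → ∑ (words n k) (V r L) ≡ Z n κ (length L)
  ∑-V zero    zero    r []      e u bound = trans (ℤₚ.+-identityʳ _)
    (cong (λ b → if b ∧ true then 1ℤ else 0ℤ) (trans (cong (_≡ᵇ k) (trans (sym (ℕₚ.+-identityʳ r)) e)) (≡ᵇ-refl k)))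
  ∑-V zero    (suc κ) r []      e u bound = trans (ℤₚ.+-identityʳ _)
    (cong (λ b → if b ∧ true then 1ℤ else 0ℤ) (≢⇒≡ᵇ-false (ℕₚ.<⇒≢ (subst (r <_) e (ℕₚ.m<m+n r (s≤s z≤n))))))
  ∑-V zero    κ       r (y ∷ L) e u bound = trans (ℤₚ.+-identityʳ _)
    (trans (cong (λ b → if b then 1ℤ else 0ℤ) (𝔹ₚ.∧-zeroʳ (r ≡ᵇ k))) (nothing-left κ))
    where
    nothing-left : ∀ κ → 0ℤ ≡ Z 0 κ (suc (length L))
    nothing-left zero    = refl
    nothing-left (suc κ) = refl
  ∑-V (suc n) κ       r L       e u bound = begin
    ∑ (words (suc n) k) (V r L)
      ≡⟨ ∑-words-suc n k (V r L) ⟩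
    ∑ (words n k) (λ w → ∑ (upTo k) (λ x → V r L (x ∷ w)))
      -- `words` varies the first letter innermost; it has to be fixed before the induction
      -- hypothesis applies to the remaining word.
      ≡⟨ ∑-swap (words n k) (upTo k) (λ w x → V r L (x ∷ w)) ⟩
    ∑ (upTo k) (λ x → ∑ (words n k) (λ w → V r L (x ∷ w)))
      ≡⟨ ∑-upTo-cong k letter ⟩
    ∑ (upTo k) (λ x → (if occurs L x then q ^ index x L ⊗ stay else 0ℤ) ⊕ (if r ≡ᵇ x then fresh′ else 0ℤ))
      ≡⟨ ∑-⊕ (upTo k) (λ x → if occurs L x then q ^ index x L ⊗ stay else 0ℤ) (λ x → if r ≡ᵇ x then fresh′ else 0ℤ) ⟩
    ∑ (upTo k) (λ x → if occurs L x then q ^ index x L ⊗ stay else 0ℤ) ⊕ ∑ (upTo k) (λ x → if r ≡ᵇ x then fresh′ else 0ℤ)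
      ≡⟨ cong₂ _⊕_ (trans (∑-index stay L u (All.map (λ y<r → ℕₚ.<-≤-trans y<r r≤k) bound)) (Zold-bracket n κ h)) (opening κ e) ⟩
    Zold n κ h ⊕ fresh′
      ≡⟨ ℤₚ.+-comm (Zold n κ h) fresh′ ⟩
    Z (suc n) κ h ∎
    where
    h = length L
    stay fresh′ : ℤ
    stay = Zstay n κ h
    fresh′ = Zopen n κ h ⊕ Znew n κ h
    r≤k : r ≤ k
    r≤k = subst (r ≤_) e (ℕₚ.m≤m+n r κ)
    opening : ∀ κ → r + κ ≡ k → ∑ (upTo k) (λ x → if r ≡ᵇ x then Zopen n κ h ⊕ Znew n κ h else 0ℤ) ≡ Zopen n κ h ⊕ Znew n κ h
    opening zero    e = ∑-zero (upTo k) (λ x → none (r ≡ᵇ x))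
      where
      none : ∀ b → (if b then 0ℤ else 0ℤ) ≡ 0ℤ
      none true  = refl
      none false = refl
    opening (suc κ) e = ∑-single k r _ (subst (r <_) e (ℕₚ.m<m+n r (s≤s z≤n)))
    opened : ∀ κ → r + κ ≡ k → r < k → occurs L r ≡ false →
             ∑ (words n k) (λ w → V (suc r) (r ∷ L) w ⊕ V (suc r) L w) ≡ Zopen n κ h ⊕ Znew n κ h
    opened zero    e r<k o = contradiction (trans (sym (ℕₚ.+-identityʳ r)) e) (ℕₚ.<⇒≢ r<k)
    opened (suc κ) e r<k o = trans (∑-⊕ (words n k) (V (suc r) (r ∷ L)) (V (suc r) L))
      (cong₂ _⊕_ (∑-V n κ (suc r) (r ∷ L) (trans (sym (ℕₚ.+-suc r κ)) e) (absent⇒≢ L o ∷ u) (ℕₚ.n<1+n r ∷ All.map ℕₚ.m<n⇒m<1+n bound))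
                 (∑-V n κ (suc r) L (trans (sym (ℕₚ.+-suc r κ)) e) u (All.map ℕₚ.m<n⇒m<1+n bound)))
    letter : ∀ x → x < k → ∑ (words n k) (λ w → V r L (x ∷ w))
                           ≡ (if occurs L x then q ^ index x L ⊗ stay else 0ℤ) ⊕ (if r ≡ᵇ x then fresh′ else 0ℤ)
    letter x x<k with occurs L x in o
    ... | true = begin
      ∑ (words n k) (λ w → q ^ index x L ⊗ (V r (x ∷ delete x L) w ⊕ V r (delete x L) w))
        ≡⟨ ∑-⊗ˡ (words n k) (q ^ index x L) (λ w → V r (x ∷ delete x L) w ⊕ V r (delete x L) w) ⟩
      q ^ index x L ⊗ ∑ (words n k) (λ w → V r (x ∷ delete x L) w ⊕ V r (delete x L) w)
        ≡⟨ cong (q ^ index x L ⊗_) (trans (∑-⊕ (words n k) (V r (x ∷ delete x L)) (V r (delete x L)))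
             (cong₂ _⊕_ (∑-V n κ r (x ∷ delete x L) e (delete-≢ x u ∷ delete-Unique x u) (x<r ∷ delete-All x bound))
                        (∑-V n κ r (delete x L) e (delete-Unique x u) (delete-All x bound)))) ⟩
      q ^ index x L ⊗ Zstay n κ (suc (length (delete x L)))
        ≡⟨ cong (λ j → q ^ index x L ⊗ Zstay n κ j) (delete-length x L o) ⟨
      q ^ index x L ⊗ stay
        ≡⟨ ℤₚ.+-identityʳ _ ⟨
      q ^ index x L ⊗ stay ⊕ 0ℤ
        ≡⟨ cong (λ b → q ^ index x L ⊗ stay ⊕ (if b then fresh′ else 0ℤ)) (≢⇒≡ᵇ-false (ℕₚ.<⇒≢ x<r ∘ sym)) ⟨
      q ^ index x L ⊗ stay ⊕ (if r ≡ᵇ x then fresh′ else 0ℤ) ∎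
      where
      x<r : x < r
      x<r = occurs-All x bound o
    ... | false with x <ᵇ r | r <ᵇ x | x ≡ᵇ r | r ≡ᵇ x | order x r
    ...   | _ | _ | _ | _ | less _     = ∑-zero (words n k) (λ _ → refl)
    ...   | _ | _ | _ | _ | greater _  = ∑-zero (words n k) (λ _ → refl)
    ...   | _ | _ | _ | _ | equal refl = trans (opened κ e x<k o) (sym (ℤₚ.+-identityˡ fresh′))

  ∑-partitions : ∀ n → ∑ (words n k) (λ f → if isSurj n k f ∧ isCanonical n f then q ^ cro n f else 0ℤ) ≡ Z n k 0
  ∑-partitions n = trans (∑-words-cong n k convert) (∑-V n k 0 [] refl [] [])
    where
    convert : ∀ w → length w ≡ n → All (_< k) w → (if isSurj n k w ∧ isCanonical n w then q ^ cro n w else 0ℤ) ≡ V 0 [] w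
    convert w refl bound = begin
      (if isSurj n k w ∧ isCanonical n w then q ^ cro n w else 0ℤ)
        ≡⟨ cong₂ (λ b e → if b then q ^ e else 0ℤ)
             (trans (cong (_∧ isCanonical n w) (all<-cong k (λ c → any<-at w (_≡ᵇ c)))) (growth-correct w 0 z≤n bound))
             (cro-croᵣ w) ⟩
      (if growth 0 w then q ^ croᵣ w else 0ℤ)
        ≡⟨ cong₂ (λ b e → if b then q ^ e else 0ℤ) (𝔹ₚ.∧-identityʳ (growth 0 w)) (ℕₚ.+-identityʳ (croᵣ w)) ⟨
      value 0 [] w
        ≡⟨ V-value w 0 [] [] [] ⟨
      V 0 [] w ∎

-- Comparison of coefficients

eval : List ℤ → ℤ → ℤ
eval []      q = 0ℤ
eval (c ∷ p) q = c ⊕ q ⊗ eval p q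

coeff : List ℤ → ℕ → ℤ
coeff []      d       = 0ℤ
coeff (c ∷ p) zero    = c
coeff (c ∷ p) (suc d) = coeff p d

_⊞_ : List ℤ → List ℤ → List ℤ
[]      ⊞ p′       = p′
(c ∷ p) ⊞ []       = c ∷ p
(c ∷ p) ⊞ (c′ ∷ p′) = (c ⊕ c′) ∷ (p ⊞ p′)

eval-⊞ : ∀ p p′ q → eval (p ⊞ p′) q ≡ eval p q ⊕ eval p′ q
eval-⊞ []      p′        q = sym (ℤₚ.+-identityˡ _)
eval-⊞ (c ∷ p) []        q = sym (ℤₚ.+-identityʳ _)
eval-⊞ (c ∷ p) (c′ ∷ p′) q = trans (cong (λ x → c ⊕ c′ ⊕ q ⊗ x) (eval-⊞ p p′ q)) (regroup c c′ q (eval p q) (eval p′ q))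
  where
  regroup : ∀ c c′ q x y → c ⊕ c′ ⊕ q ⊗ (x ⊕ y) ≡ (c ⊕ q ⊗ x) ⊕ (c′ ⊕ q ⊗ y)
  regroup = solve-∀

coeff-⊞ : ∀ p p′ d → coeff (p ⊞ p′) d ≡ coeff p d ⊕ coeff p′ d
coeff-⊞ []      p′        d       = sym (ℤₚ.+-identityˡ _)
coeff-⊞ (c ∷ p) []        d       = sym (ℤₚ.+-identityʳ _)
coeff-⊞ (c ∷ p) (c′ ∷ p′) zero    = refl
coeff-⊞ (c ∷ p) (c′ ∷ p′) (suc d) = coeff-⊞ p p′ d

-- Links a function of the integer q to its coefficients, so that all sums are handled at a fixed q
-- and coefficients are compared only at the end.
record HasCoefficients (E : ℤ → ℤ) (c : ℕ → ℤ) : Set where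
  field
    polynomial : List ℤ
    eval≡      : ∀ q → eval polynomial q ≡ E q
    coeff≡     : ∀ d → coeff polynomial d ≡ c d

open HasCoefficients

zeroᴴ : HasCoefficients (λ _ → 0ℤ) (λ _ → 0ℤ)
zeroᴴ = record { polynomial = [] ; eval≡ = λ _ → refl ; coeff≡ = λ _ → refl }

_+ᴴ_ : ∀ {E E′ c c′} → HasCoefficients E c → HasCoefficients E′ c′ →
       HasCoefficients (λ q → E q ⊕ E′ q) (λ d → c d ⊕ c′ d)
H +ᴴ H′ = record
  { polynomial = polynomial H ⊞ polynomial H′
  ; eval≡      = λ q → trans (eval-⊞ (polynomial H) (polynomial H′) q) (cong₂ _⊕_ (eval≡ H q) (eval≡ H′ q))
  ; coeff≡     = λ d → trans (coeff-⊞ (polynomial H) (polynomial H′) d) (cong₂ _⊕_ (coeff≡ H d) (coeff≡ H′ d))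
  }

scaleᴴ : ∀ {E c} a → HasCoefficients E c → HasCoefficients (λ q → a ⊗ E q) (λ d → a ⊗ c d)
scaleᴴ a H = record
  { polynomial = map (a ⊗_) (polynomial H)
  ; eval≡      = λ q → trans (eval-scale (polynomial H) q) (cong (a ⊗_) (eval≡ H q))
  ; coeff≡     = λ d → trans (coeff-scale (polynomial H) d) (cong (a ⊗_) (coeff≡ H d))
  }
  where
  regroup : ∀ a c q x → a ⊗ c ⊕ q ⊗ (a ⊗ x) ≡ a ⊗ (c ⊕ q ⊗ x)
  regroup = solve-∀
  eval-scale : ∀ p q → eval (map (a ⊗_) p) q ≡ a ⊗ eval p q
  eval-scale []      q = sym (ℤₚ.*-zeroʳ a)
  eval-scale (c ∷ p) q = trans (cong (λ x → a ⊗ c ⊕ q ⊗ x) (eval-scale p q)) (regroup a c q (eval p q))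
  coeff-scale : ∀ p d → coeff (map (a ⊗_) p) d ≡ a ⊗ coeff p d
  coeff-scale []      d       = sym (ℤₚ.*-zeroʳ a)
  coeff-scale (c ∷ p) zero    = refl
  coeff-scale (c ∷ p) (suc d) = coeff-scale p d

monomialᴴ : ∀ e → HasCoefficients (_^ e) (λ d → ℤ.+ 𝟙 (e ≡ᵇ d))
monomialᴴ zero    = record
  { polynomial = 1ℤ ∷ []
  ; eval≡      = λ q → cong (1ℤ ⊕_) (ℤₚ.*-zeroʳ q)
  ; coeff≡     = λ { zero → refl ; (suc d) → refl }
  }
monomialᴴ (suc e) = record
  { polynomial = 0ℤ ∷ polynomial (monomialᴴ e)
  ; eval≡      = λ q → trans (ℤₚ.+-identityˡ _) (cong (q ⊗_) (eval≡ (monomialᴴ e) q))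
  ; coeff≡     = λ { zero → refl ; (suc d) → coeff≡ (monomialᴴ e) d }
  }

castᴴ : ∀ {E E′ c c′} → (∀ q → E q ≡ E′ q) → (∀ d → c d ≡ c′ d) → HasCoefficients E c → HasCoefficients E′ c′
castᴴ e f H = record
  { polynomial = polynomial H
  ; eval≡      = λ q → trans (eval≡ H q) (e q)
  ; coeff≡     = λ d → trans (coeff≡ H d) (f d)
  }

∑ᴴ : ∀ (xs : List A) {E : A → ℤ → ℤ} {c : A → ℕ → ℤ} → (∀ x → HasCoefficients (E x) (c x)) →
     HasCoefficients (λ q → ∑ xs (λ x → E x q)) (λ d → ∑ xs (λ x → c x d))
∑ᴴ []       H = zeroᴴ
∑ᴴ (x ∷ xs) H = H x +ᴴ ∑ᴴ xs H

countᴴ : ∀ (xs : List A) (p : A → Bool) (s : A → ℕ) →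
         HasCoefficients (λ q → ∑ xs (λ x → if p x then q ^ s x else 0ℤ))
                         (λ d → ℤ.+ length (filterᵇ (λ x → p x ∧ (s x ≡ᵇ d)) xs))
countᴴ xs p s = castᴴ (λ _ → refl) count (∑ᴴ xs (λ x → single (p x) (s x)))
  where
  single : ∀ b e → HasCoefficients (λ q → if b then q ^ e else 0ℤ) (λ d → ℤ.+ 𝟙 (b ∧ (e ≡ᵇ d)))
  single true  e = monomialᴴ e
  single false e = zeroᴴ
  pos : ∀ (f : _ → ℕ) xs → ∑ xs (λ x → ℤ.+ f x) ≡ ℤ.+ foldr _+_ 0 (map f xs)
  pos f []       = refl
  pos f (x ∷ xs) = cong (ℤ.+ f x ⊕_) (pos f xs)
  count : ∀ d → ∑ xs (λ x → ℤ.+ 𝟙 (p x ∧ (s x ≡ᵇ d))) ≡ ℤ.+ length (filterᵇ (λ x → p x ∧ (s x ≡ᵇ d)) xs)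
  count d = trans (pos (λ x → 𝟙 (p x ∧ (s x ≡ᵇ d))) xs)
                  (cong ℤ.+_ (sym (length-filterᵇ (λ x → p x ∧ (s x ≡ᵇ d)) xs)))

-- At q = |c₀| + 1 the constant term c₀ is a multiple of q, hence 0.
vanishing : ∀ p → (∀ q → eval p (ℤ.+ suc q) ≡ 0ℤ) → ∀ d → coeff p d ≡ 0ℤ
vanishing []      e d = refl
vanishing (c ∷ p) e = λ { zero → c≡0 ; (suc d) → vanishing p tail d }
  where
  q₀ = ℤ.∣ c ∣
  c≡0 : c ≡ 0ℤ
  c≡0 = ℤₚ.∣i∣≡0⇒i≡0 (small q₀ (ℤ.∣ eval p (ℤ.+ suc q₀) ∣) (begin
    ℤ.∣ c ∣                                           ≡⟨ cong ℤ.∣_∣ (isolate c _ (e q₀)) ⟩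
    ℤ.∣ ⊝ (ℤ.+ suc q₀ ⊗ eval p (ℤ.+ suc q₀)) ∣        ≡⟨ ℤₚ.∣-i∣≡∣i∣ (ℤ.+ suc q₀ ⊗ eval p (ℤ.+ suc q₀)) ⟩
    ℤ.∣ ℤ.+ suc q₀ ⊗ eval p (ℤ.+ suc q₀) ∣            ≡⟨ ℤₚ.∣i*j∣≡∣i∣*∣j∣ (ℤ.+ suc q₀) (eval p (ℤ.+ suc q₀)) ⟩
    suc q₀ * ℤ.∣ eval p (ℤ.+ suc q₀) ∣                ∎))
    where
    isolate : ∀ x y → x ⊕ y ≡ 0ℤ → x ≡ ⊝ y
    isolate x y eq = begin
      x              ≡⟨ add x y ⟩
      (x ⊕ y) ⊕ ⊝ y  ≡⟨ cong (_⊕ ⊝ y) eq ⟩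
      0ℤ ⊕ ⊝ y       ≡⟨ ℤₚ.+-identityˡ (⊝ y) ⟩
      ⊝ y            ∎
      where
      add : ∀ x y → x ≡ (x ⊕ y) ⊕ ⊝ y
      add = solve-∀
    small : ∀ a b → a ≡ suc a * b → a ≡ 0
    small a zero    eq = trans eq (ℕₚ.*-zeroʳ (suc a))
    small a (suc b) eq = contradiction (ℕₚ.m≤m*n (suc a) (suc b)) (ℕₚ.<⇒≱ (subst (_< suc a) eq (ℕₚ.n<1+n a)))
  tail : ∀ q → eval p (ℤ.+ suc q) ≡ 0ℤ
  -- The factor q is cancelled, which is possible since only positive arguments occur in the
  -- hypothesis; the quotient again satisfies it.
  tail q with ℤₚ.i*j≡0⇒i≡0∨j≡0 (ℤ.+ suc q) {eval p (ℤ.+ suc q)} (begin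
    ℤ.+ suc q ⊗ eval p (ℤ.+ suc q)       ≡⟨ ℤₚ.+-identityˡ _ ⟨
    0ℤ ⊕ ℤ.+ suc q ⊗ eval p (ℤ.+ suc q)  ≡⟨ cong (_⊕ ℤ.+ suc q ⊗ eval p (ℤ.+ suc q)) c≡0 ⟨
    c ⊕ ℤ.+ suc q ⊗ eval p (ℤ.+ suc q)   ≡⟨ e q ⟩
    0ℤ                                   ∎)
  ... | inj₁ ()
  ... | inj₂ eq = eq

coefficients-unique : ∀ {E E′ c c′} → HasCoefficients E c → HasCoefficients E′ c′ → (∀ q → E q ≡ E′ q) → ∀ d → c d ≡ c′ d
coefficients-unique {E} {E′} {c} {c′} H H′ eq d = begin
  c d                              ≡⟨ restore (c d) (c′ d) ⟩
  c d ⊕ ⊝ 1ℤ ⊗ c′ d ⊕ c′ d         ≡⟨ cong (_⊕ c′ d) (coeff≡ D d) ⟨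
  coeff (polynomial D) d ⊕ c′ d    ≡⟨ cong (_⊕ c′ d) (vanishing (polynomial D) (λ q → trans (eval≡ D (ℤ.+ suc q)) (difference (ℤ.+ suc q))) d) ⟩
  0ℤ ⊕ c′ d                        ≡⟨ ℤₚ.+-identityˡ (c′ d) ⟩
  c′ d                             ∎
  where
  D : HasCoefficients (λ q → E q ⊕ ⊝ 1ℤ ⊗ E′ q) (λ d → c d ⊕ ⊝ 1ℤ ⊗ c′ d)
  D = H +ᴴ scaleᴴ (⊝ 1ℤ) H′
  restore : ∀ x y → x ≡ x ⊕ ⊝ 1ℤ ⊗ y ⊕ y
  restore = solve-∀
  cancel : ∀ x → x ⊕ ⊝ 1ℤ ⊗ x ≡ 0ℤ
  cancel = solve-∀
  difference : ∀ q → E q ⊕ ⊝ 1ℤ ⊗ E′ q ≡ 0ℤ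
  difference q = trans (cong (_⊕ ⊝ 1ℤ ⊗ E′ q) (eq q)) (cancel (E′ q))

-- The two families as polynomial functions of q

S₁-at S₂-at : ℕ → ℕ → ℤ → ℤ
S₁-at n k q = ∑ (words n n) (λ σ → if isPerm n σ ∧ (rlm n σ ≡ᵇ k) then q ^ inv′ n σ else 0ℤ)
S₂-at n k q = ∑ (words n k) (λ f → if isSurj n k f ∧ isCanonical n f then q ^ cro n f else 0ℤ)

filterᵇ-cong : ∀ {p p′ : A → Bool} → (∀ x → p x ≡ p′ x) → ∀ xs → length (filterᵇ p xs) ≡ length (filterᵇ p′ xs)
filterᵇ-cong {p = p} {p′} e xs = trans (length-filterᵇ p xs)
  (trans (cong (foldr _+_ 0) (Listₚ.map-cong (λ x → cong 𝟙 (e x)) xs)) (sym (length-filterᵇ p′ xs)))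

S₁ᴴ : ∀ n k → HasCoefficients (S₁-at n k) (λ d → ℤ.+ S₁coeff n k d)
S₁ᴴ n k = castᴴ (λ _ → refl)
  (λ d → cong ℤ.+_ (filterᵇ-cong (λ σ → 𝔹ₚ.∧-assoc (isPerm n σ) (rlm n σ ≡ᵇ k) (inv′ n σ ≡ᵇ d)) (words n n)))
  (countᴴ (words n n) (λ σ → isPerm n σ ∧ (rlm n σ ≡ᵇ k)) (inv′ n))

S₂ᴴ : ∀ n k → HasCoefficients (S₂-at n k) (λ d → ℤ.+ S₂coeff n k d)
S₂ᴴ n k = castᴴ (λ _ → refl)
  (λ d → cong ℤ.+_ (filterᵇ-cong (λ f → 𝔹ₚ.∧-assoc (isSurj n k f) (isCanonical n f) (cro n f ≡ᵇ d)) (words n k)))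
  (countᴴ (words n k) (λ f → isSurj n k f ∧ isCanonical n f) (cro n))

factor : ℕ → ℕ → ℕ → ℤ
factor n k j = sgn j ⊗ binom (n ∸ 1 + j) (n ∸ k + j) ⊗ binom (2 * n ∸ k) (n ∸ k ∸ j)

S₂-at-S₁-at : ∀ {n k} → k ≤ n → ∀ q →
  S₂-at n k q ≡ sgn (n ∸ k) ⊗ ∑ (upTo (suc (n ∸ k))) (λ j → factor n k j ⊗ S₁-at (n ∸ k + j) j q)
S₂-at-S₁-at {n} {k} k≤n q = begin
  S₂-at n k q
    ≡⟨ Partitions.∑-partitions q k n ⟩
  Z n k 0
    ≡⟨ subst (λ x → Z x k 0 ≡ sgn m ⊗ ∑ (upTo (suc m)) (λ j → sgn j ⊗ binom (x ∸ 1 + j) (m + j) ⊗ binom (2 * x ∸ k) (m ∸ j) ⊗ Records.X j 0 (m + j) 0))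
             (ℕₚ.m+[n∸m]≡n k≤n) (duality k m) ⟩
  sgn m ⊗ ∑ (upTo (suc m)) (λ j → factor n k j ⊗ Records.X j 0 (m + j) 0)
    ≡⟨ cong (sgn m ⊗_) (∑-cong (upTo (suc m)) (λ j → cong (factor n k j ⊗_) (Permutations.∑-permutations q (m + j) j))) ⟨
  sgn m ⊗ ∑ (upTo (suc m)) (λ j → factor n k j ⊗ S₁-at (m + j) j q) ∎
  where
  m = n ∸ k
  open Paths (bracket q)

open import Data.Integer using (+_)

theorem7p1 : (n k : ℕ) → k ≤ n → (d : ℕ) → + S₂coeff n k d ≡ RHScoeff n k d
theorem7p1 n k k≤n = coefficients-unique (S₂ᴴ n k)
  (scaleᴴ (sgn (n ∸ k)) (∑ᴴ (upTo (suc (n ∸ k))) (λ j → scaleᴴ (factor n k j) (S₁ᴴ (n ∸ k + j) j))))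
  (S₂-at-S₁-at k≤n)
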